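{- Let $s>t\ge 0$ be integers. Then $$\{a(ns+t,k)\mid n,k\in\mathbb{N},\ ns+t\ge 1\}=\{c(ns+t,k)\mid n,k\in\mathbb{N},\ ns+t\ge 1\}=\mathbb{Z}.$$
   Context: For a positive integer $N$, $\Phi_N(x)$ denotes the $N$-th cyclotomic polynomial, and $a(N,k)$ denotes the coefficient of $x^k$ in $\Phi_N(x)$ (so $a(N,k)=0$ for $k>\varphi(N)$). Also $c(N,k)$ denotes the coefficient of $x^k$ in the formal power series (Taylor series around $x=0$) of $1/\Phi_N(x)$, i.e. $1/\Phi_N(x)=\sum_{k\ge 0}c(N,k)x^k$. Here $\mathbb{N}$ denotes the natural numbers; only indices with $ns+t\ge1$ (so that $\Phi_{ns+t}$ is defined) are considered. -}

module Defs where

open import Data.Nat as ℕ using (ℕ; zero; suc)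
open import Data.Nat.Divisibility using (_∣?_)
open import Data.Integer as ℤ using (ℤ; +_; -_; _+_; _*_; _-_)
open import Data.List using (List; []; _∷_; _++_; [_]; length; reverse; map; replicate)
open import Relation.Nullary using (yes; no)
open import Data.Bool using (true; false)

-- Integer polynomials / power series as coefficient lists.
-- "Low-first" lists: index i holds the coefficient of x^i.
Poly : Set
Poly = List ℤ

coeff : Poly → ℕ → ℤ
coeff []       _       = + 0
coeff (a ∷ p)  zero    = a
coeff (a ∷ p)  (suc k) = coeff p k

addP : Poly → Poly → Poly
addP []      q       = q
addP p       []      = p
addP (a ∷ p) (b ∷ q) = (a + b) ∷ addP p q

mulP : Poly → Poly → Poly
mulP []      q = []
mulP (a ∷ p) q = addP (map (a *_) q) (+ 0 ∷ mulP p q)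

-- Long division of A by a MONIC B, both given HIGH-first (leading coeff first).
-- Returns the quotient high-first. Fuel = length of A.
private
  subPrefix : List ℤ → List ℤ → List ℤ
  subPrefix (x ∷ xs) (y ∷ ys) = (x - y) ∷ subPrefix xs ys
  subPrefix xs       _        = xs

  divFuel : ℕ → List ℤ → List ℤ → List ℤ
  divFuel zero    _        _        = []
  divFuel (suc f) []       _        = []
  divFuel (suc f) _        []       = []
  divFuel (suc f) (a ∷ as) (b ∷ bs) with length bs ℕ.≤ᵇ length as
  ... | false = []
  ... | true  = a ∷ divFuel f (subPrefix as (map (a *_) bs)) (b ∷ bs)

divMonic : Poly → Poly → Poly
divMonic A B = reverse (divFuel (length A) (reverse A) (reverse B))

xN-1 : ℕ → Poly
xN-1 N = - (+ 1) ∷ (replicate (N ℕ.∸ 1) (+ 0) ++ [ + 1 ])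

index : {A : Set} → A → List A → ℕ → A
index d []       _       = d
index d (x ∷ xs) zero    = x
index d (x ∷ xs) (suc i) = index d xs i

-- product of Φ_d over divisors d of m with d < m, where tbl holds Φ_1, …, Φ_(m-1)
private
  properDivProd : (m : ℕ) → List Poly → ℕ → Poly
  properDivProd m tbl zero = [ + 1 ]
  properDivProd m tbl (suc d) with suc d ∣? m
  ... | yes _ = mulP (index [] tbl d) (properDivProd m tbl d)
  ... | no  _ = properDivProd m tbl d

-- cycTable n = [Φ_1, …, Φ_n], via the recursive definition
--   Φ_m(x) = (x^m - 1) / ∏_{d ∣ m, d < m} Φ_d(x).
cycTable : ℕ → List Poly
cycTable zero    = []
cycTable (suc n) =
  let tbl = cycTable n
      m   = suc n
  in tbl ++ [ divMonic (xN-1 m) (properDivProd m tbl n) ]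

-- The N-th cyclotomic polynomial (low-first coefficients); meaningful for N ≥ 1.
Φ : ℕ → Poly
Φ N = index [] (cycTable N) (N ℕ.∸ 1)

a : ℕ → ℕ → ℤ
a N k = coeff (Φ N) k

-- Power series inverse of a polynomial p with constant term p₀ ∈ {1, -1}
-- (so p₀⁻¹ = p₀):  c₀ = p₀⁻¹,  c_k = - p₀⁻¹ · Σ_{j=1}^{k} p_j c_{k-j}.
private
  convSum : Poly → List ℤ → ℕ → ℕ → ℤ
  convSum p cs k zero    = + 0
  convSum p cs k (suc i) = coeff p (suc i) * index (+ 0) cs (k ℕ.∸ suc i) + convSum p cs k i

  invList : Poly → ℕ → List ℤ
  invList p zero    = [ coeff p 0 ]
  invList p (suc k) =
    let cs = invList p k
    in cs ++ [ - (coeff p 0 * convSum p cs (suc k) (suc k)) ]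

invCoeff : Poly → ℕ → ℤ
invCoeff p k = index (+ 0) (invList p k) k

c : ℕ → ℕ → ℤ
c N k = invCoeff (Φ N) k

{-# OPTIONS --safe #-}

-- Φ (N p) is Φ N (x^p) if p ∣ N, so the set of coefficients of Φ N depends only on the
-- radical of N.  Since p^h ≡ 1 mod s for a suitable h, it suffices to find, for a given
-- radical R, distinct primes g > s such that Φ (R ∏ g) has the coefficient z.
--
-- Let M > 1 be squarefree with Φ M = 1 + ε x + …, where ε = ±1 is at our disposal because an
-- extra prime flips it.  Let q > 2 deg (Φ M) be prime and A = 1/Φ (M q) = Φ M (x) / Φ M (x^q).
-- Then A is periodic mod M q, and A_n = 0 whenever n mod q > deg (Φ M).  Let p_1, …, p_r > k/2 be
-- primes congruent mod M q, and let N be M q times these and some primes exceeding k.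
-- Modulo x^(k+1), A (1 - ε ∑ x^(p_i)) is Φ N if the number of primes in N / (M q) is odd and
-- 1/Φ N if it is even.  For k = p_1 + j + l M q, with j = 0 or j = deg (Φ M) chosen such that
-- A_k = 0, its coefficient at x^k is -ε r.
--
-- Such primes exist: otherwise every late dyadic interval contains boundedly many primes, and
-- by Erdős' count the n < 2^K (a square times a product of distinct small primes, or
-- a multiple of a large prime) would be too few.
--
-- That ∏_{d ∣ n} Φ d = x^n - 1, i.e. that the defining divisions are exact, holds because the
-- ideal (Φ d, Φ e) contains a positive integer for d ≠ e.

module Submission where

open import Defs hiding (a; c)
open import Algebra.Bundles using (CommutativeRing)
open import Algebra.Structures using (IsCommutativeRing)
import Algebra.Properties.Ring as RingProperties
import Algebra.Solver.Ring.NaturalCoefficients.Default as NatSolver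
open import Data.Bool as Bool using (Bool; true; false; not)
import Data.Bool.Properties as Boolₚ
open import Data.Empty using (⊥-elim)
open import Data.Fin using (Fin; toℕ)
import Data.Fin.Properties as Finₚ
open import Data.Integer as ℤ using (ℤ; +_; -_; _+_; _*_)
import Data.Integer.Properties as ℤₚ
open import Data.Integer.Tactic.RingSolver using (solve-∀)
open import Data.List using (List; []; _∷_; _++_; [_]; length; map; replicate; reverse; _∷ʳ_; initLast;
  _∷ʳ′_; filter; drop; take; upTo; applyUpTo; applyDownFrom; concatMap; cartesianProductWith)
import Data.List.Properties as Listₚ
open import Data.List.Membership.Propositional using (_∈_; find; lose)
open import Data.List.Membership.Propositional.Properties using (∈-filter⁺; ∈-filter⁻; ∈-applyDownFrom⁺;
  ∈-applyDownFrom⁻; ∈-applyUpTo⁺; ∈-applyUpTo⁻; ∈-upTo⁺; ∈-upTo⁻; ∈-map⁺; ∈-map⁻; ∈-++⁺ˡ; ∈-++⁺ʳ; ∈-++⁻; ∈-cartesianProductWith⁺; ∈-concatMap⁺; ∈-∃++)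
open import Data.List.Membership.Propositional.Properties.WithK using (unique∧set⇒bag)
open import Data.List.Relation.Binary.BagAndSetEquality using (∼bag⇒↭)
open import Data.List.Relation.Binary.Permutation.Propositional as ↭ using (_↭_)
open import Data.List.Relation.Unary.All as All using (All; []; _∷_)
import Data.List.Relation.Unary.All.Properties as Allₚ
open import Data.List.Relation.Unary.AllPairs using ([]; _∷_)
open import Data.List.Relation.Unary.Any using (Any; any?; here; there)
open import Data.List.Relation.Unary.Unique.Propositional using (Unique)
import Data.List.Relation.Unary.Unique.Propositional.Properties as Uniqueₚ
open import Data.Nat as ℕ using (ℕ; zero; suc; z≤n; s≤s; NonZero)
open import Data.Nat.Coprimality using (Coprime; coprime-divisor; prime⇒coprime) renaming (sym to coprime-sym)
open import Data.Nat.Divisibility using (_∣_; _∣?_; divides; ∣-refl; ∣-trans; ∣⇒≤; 0∣⇒≡0; ∣-antisym;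
  *-cancelʳ-∣; *-monoˡ-∣; m∣m*n; n∣m*n; ∣m+n∣m⇒∣n; ∣n⇒∣m*n)
open import Data.Nat.DivMod using (_%_; _/_; m%n<n; m≡m%n+[m/n]*n; _mod_)
open import Data.Nat.GCD using (gcd; gcd-GCD; gcd[m,n]∣m; gcd[m,n]∣n; module Bézout)
open import Data.Nat.Induction using (<-rec)
open import Data.Nat.ListAction using (product)
open import Data.Nat.ListAction.Properties using (∈⇒∣product; product-++)
open import Data.Nat.Primality using (Prime; prime?; prime⇒nonZero; prime⇒nonTrivial; prime⇒irreducible; euclidsLemma)
open import Data.Nat.Primality.Factorisation using (factorise; module PrimeFactorisation)
import Data.Nat.Properties as ℕₚ
import Data.Nat.Tactic.RingSolver as ℕ-Solver
open import Data.Product using (∃-syntax; _×_; _,_; proj₁; proj₂)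
open import Data.Sum using (_⊎_; inj₁; inj₂)
open import Data.Unit using (⊤; tt)
open import Function using (_∘_)
open import Function.Bundles using (mk⇔)
open import Level using (0ℓ)
open import Relation.Binary.Definitions using (tri<; tri≈; tri>)
open import Relation.Binary.PropositionalEquality hiding ([_])
open import Relation.Nullary using (¬_; Dec; yes; no)
open import Relation.Nullary.Decidable using (¬?; _×-dec_; decidable-stable)
open import Relation.Nullary.Reflects using (invert)
open import Relation.Unary using (Decidable)

-- Copies of the private functions of Defs.  The left-hand sides left to
-- unification in the mutual blocks below are solved to the private originals.

-- The residue class of the `p_i` is never prescribed: it is enough that they are congruent to one
-- another modulo `L = M q` and lie between `X + L` and `2 X` for some `X`, so counting and
-- pigeonhole replace Dirichlet's theorem. The interval serves a single exponent `k`, which has to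
-- exceed every `p_i` for each to contribute and stay below every `2 p_i` for products of two
-- monomials to drop out. Congruence makes all contributions equal to the coefficient of `Φ M` at
-- `j`; this is known to be 1 at `j = 0` and at the degree. The gap produced by `q` clears the
-- remaining term `A_k`. Adjoining a prime `p` replaces `Φ N` by a binomial divided by `Φ N`, up to
-- high powers of `x`, so one construction yields both kinds of coefficient, and a prime beyond `k`
-- adjusts the parity. Exactness of the divisions uses no roots of unity: the product of the earlier
-- `Φ d` divides an integer multiple of `x^n - 1`, that integer annihilates the remainder of the
-- monic division, and the integers have no torsion.

subPre : List ℤ → List ℤ → List ℤ
subPre (x ∷ xs) (y ∷ ys) = (x ℤ.- y) ∷ subPre xs ys
subPre xs       _        = xs

quot : ℕ → List ℤ → List ℤ → List ℤ
quot zero    _        _        = []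
quot (suc f) []       _        = []
quot (suc f) _        []       = []
quot (suc f) (x ∷ xs) (b ∷ bs) with length bs ℕ.≤ᵇ length xs
... | false = []
... | true  = x ∷ quot f (subPre xs (map (x *_) bs)) (b ∷ bs)

properProd : ℕ → List Poly → ℕ → Poly
properProd m tbl zero = [ + 1 ]
properProd m tbl (suc d) with suc d ∣? m
... | yes _ = mulP (index [] tbl d) (properProd m tbl d)
... | no  _ = properProd m tbl d

conv : Poly → List ℤ → ℕ → ℕ → ℤ
conv p cs k zero    = + 0
conv p cs k (suc i) = coeff p (suc i) * index (+ 0) cs (k ℕ.∸ suc i) + conv p cs k i

lhs : {A : Set} {x y : A} → x ≡ y → A
lhs {x = x} _ = x

mutual
  divMonic-quot : ∀ A B → divMonic A B ≡ reverse (quot (length A) (reverse A) (reverse B))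
  -- Turning the arguments, and then the outer `reverse`, into variables makes the omitted left-hand
  -- side of `quot-correct` a pattern that unification can solve.
  divMonic-quot A B with length A | reverse A | reverse B
  ... | n | as | bs with reverse {A = ℤ}
  ... | rev = cong rev (quot-correct n as bs)

  quot-correct : ∀ n xs bs → _ ≡ quot n xs bs
  quot-correct zero    xs       bs = refl
  quot-correct (suc n) []       bs = refl
  quot-correct (suc n) (x ∷ xs) [] = refl
  quot-correct (suc n) (x ∷ xs) (b ∷ bs) with length bs ℕ.≤ᵇ length xs
  ... | false = refl
  ... | true with map (x *_) bs
  ... | ys = cong (x ∷_) (trans (quot-correct n _ _)
                                (cong (λ l → quot n l (b ∷ bs)) (subPre-correct xs ys)))

  subPre-correct : ∀ xs ys → _ ≡ subPre xs ys
  subPre-correct (x ∷ xs) (y ∷ ys) = cong (_ ∷_) (subPre-correct xs ys)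
  subPre-correct []       _        = refl
  subPre-correct (x ∷ xs) []       = refl

mutual
  cycTable-suc : ∀ n → cycTable (suc n) ≡
    cycTable n ++ [ divMonic (xN-1 (suc n)) (properProd (suc n) (cycTable n) n) ]
  cycTable-suc n with cycTable n | suc n
  ... | t | m with length (xN-1 (suc n)) | reverse (xN-1 (suc n))
  ... | l | A with reverse {A = ℤ}
  ... | rev = cong (λ z → t ++ [ rev (lhs (quot-correct l A (rev z))) ]) (properProd-correct m t n)

  properProd-correct : ∀ m t n → _ ≡ properProd m t n
  properProd-correct m t zero = refl
  properProd-correct m t (suc d) with suc d ∣? m
  ... | yes _ = cong (mulP (index [] t d)) (properProd-correct m t d)
  ... | no  _ = properProd-correct m t d

mutual
  -- These trivial equations exist only so that unification finds the private list behind
  -- `invCoeff`; `lhs` then extracts it under the name `invCoeffs`.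
  invCoeff-refl : ∀ p k → invCoeff p k ≡ invCoeff p k
  invCoeff-refl p k with index (+ 0)
  ... | ix = cong (λ z → ix z k) (invCoeffs-refl p k)

  invCoeffs-refl : ∀ p k → _ ≡ _
  invCoeffs-refl p k = refl

invCoeffs : Poly → ℕ → List ℤ
invCoeffs p k = lhs (invCoeffs-refl p k)

mutual
  invCoeffs-suc : ∀ p k → invCoeffs p (suc k) ≡
    invCoeffs p k ++ [ - (coeff p 0 * conv p (invCoeffs p k) (suc k) (suc k)) ]
  invCoeffs-suc p k with invCoeffs p k | suc k
  ... | cs | m with coeff p m * index (+ 0) cs (k ℕ.∸ k)
  ... | x with ℤ._+_
  ... | plus = cong (λ z → cs ++ [ - (coeff p 0 * plus x z) ]) (conv-correct p cs m k)

  conv-correct : ∀ p cs k i → _ ≡ conv p cs k i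
  conv-correct p cs k zero = refl
  conv-correct p cs k (suc i) =
    cong (λ z → coeff p (suc i) * index (+ 0) cs (k ℕ.∸ suc i) + z) (conv-correct p cs k i)

-- The polynomial ring

+-congˡ : ∀ x {y z : ℤ} → y ≡ z → x + y ≡ x + z
+-congˡ x = cong (λ y → x + y)

infixl 7 _⋆_
-- The Cauchy product of two sequences, peeling the left factor in the same way as `mulP`.
_⋆_ : (ℕ → ℤ) → (ℕ → ℤ) → ℕ → ℤ
(f ⋆ g) zero    = f 0 * g 0
(f ⋆ g) (suc n) = f 0 * g (suc n) + ((f ∘ suc) ⋆ g) n

⋆-cong : ∀ n {f f′ g g′ : ℕ → ℤ} → (∀ i → i ℕ.≤ n → f i ≡ f′ i) → (∀ i → i ℕ.≤ n → g i ≡ g′ i) →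
         (f ⋆ g) n ≡ (f′ ⋆ g′) n
⋆-cong zero    p q = cong₂ _*_ (p 0 z≤n) (q 0 z≤n)
⋆-cong (suc n) p q = cong₂ _+_ (cong₂ _*_ (p 0 z≤n) (q (suc n) ℕₚ.≤-refl))
  (⋆-cong n (λ i i≤n → p (suc i) (s≤s i≤n)) (λ i i≤n → q i (ℕₚ.m≤n⇒m≤1+n i≤n)))

⋆-zeroˡ : ∀ g n → ((λ _ → + 0) ⋆ g) n ≡ + 0
⋆-zeroˡ g zero    = refl
⋆-zeroˡ g (suc n) = +-congˡ (+ 0) (⋆-zeroˡ g n)

⋆-scaleˡ : ∀ x f g n → ((λ i → x * f i) ⋆ g) n ≡ x * (f ⋆ g) n
⋆-scaleˡ x f g zero    = ℤₚ.*-assoc x (f 0) (g 0)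
⋆-scaleˡ x f g (suc n) = trans (+-congˡ (x * f 0 * g (suc n)) (⋆-scaleˡ x (f ∘ suc) g n)) (eq x (f 0) (g (suc n)) _)
  where
  eq : ∀ x u v w → x * u * v + x * w ≡ x * (u * v + w)
  eq = solve-∀

⋆-distribʳ : ∀ f g h n → ((λ i → f i + g i) ⋆ h) n ≡ (f ⋆ h) n + (g ⋆ h) n
⋆-distribʳ f g h zero    = ℤₚ.*-distribʳ-+ (h 0) (f 0) (g 0)
⋆-distribʳ f g h (suc n) = trans (+-congˡ ((f 0 + g 0) * h (suc n)) (⋆-distribʳ (f ∘ suc) (g ∘ suc) h n))
    (eq (f 0) (g 0) (h (suc n)) _ _)
  where
  eq : ∀ u v w y z → (u + v) * w + (y + z) ≡ (u * w + y) + (v * w + z)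
  eq = solve-∀

⋆-suc : ∀ f g n → (f ⋆ g) (suc n) ≡ (f ⋆ (g ∘ suc)) n + f (suc n) * g 0
⋆-suc f g zero    = refl
⋆-suc f g (suc n) = trans (+-congˡ (f 0 * g (suc (suc n))) (⋆-suc (f ∘ suc) g n))
    (sym (ℤₚ.+-assoc (f 0 * g (suc (suc n))) _ _))

⋆-comm : ∀ f g n → (f ⋆ g) n ≡ (g ⋆ f) n
⋆-comm f g zero    = ℤₚ.*-comm (f 0) (g 0)
⋆-comm f g (suc n) = begin
  f 0 * g (suc n) + ((f ∘ suc) ⋆ g) n ≡⟨ +-congˡ (f 0 * g (suc n)) (⋆-comm (f ∘ suc) g n) ⟩
  f 0 * g (suc n) + (g ⋆ (f ∘ suc)) n ≡⟨ eq (f 0) (g (suc n)) _ ⟩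
  (g ⋆ (f ∘ suc)) n + g (suc n) * f 0 ≡⟨ ⋆-suc g f n ⟨
  (g ⋆ f) (suc n)                     ∎
  where
  open ≡-Reasoning
  eq : ∀ u v w → u * v + w ≡ w + v * u
  eq = solve-∀

⋆-assoc : ∀ f g h n → ((f ⋆ g) ⋆ h) n ≡ (f ⋆ (g ⋆ h)) n
⋆-assoc f g h zero    = ℤₚ.*-assoc (f 0) (g 0) (h 0)
⋆-assoc f g h (suc n) = begin
  f 0 * g 0 * h (suc n) + ((λ i → f 0 * g (suc i) + ((f ∘ suc) ⋆ g) i) ⋆ h) n
    ≡⟨ +-congˡ (f 0 * g 0 * h (suc n)) (⋆-distribʳ (λ i → f 0 * g (suc i)) ((f ∘ suc) ⋆ g) h n) ⟩
  f 0 * g 0 * h (suc n) + (((λ i → f 0 * g (suc i)) ⋆ h) n + (((f ∘ suc) ⋆ g) ⋆ h) n)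
    ≡⟨ +-congˡ (f 0 * g 0 * h (suc n)) (cong₂ _+_ (⋆-scaleˡ (f 0) (g ∘ suc) h n) (⋆-assoc (f ∘ suc) g h n)) ⟩
  f 0 * g 0 * h (suc n) + (f 0 * ((g ∘ suc) ⋆ h) n + ((f ∘ suc) ⋆ (g ⋆ h)) n)
    ≡⟨ eq (f 0) (g 0) (h (suc n)) _ _ ⟩
  f 0 * (g ⋆ h) (suc n) + ((f ∘ suc) ⋆ (g ⋆ h)) n ∎
  where
  open ≡-Reasoning
  eq : ∀ u v w y z → u * v * w + (u * y + z) ≡ u * (v * w + y) + z
  eq = solve-∀

coeff-addP : ∀ p q n → coeff (addP p q) n ≡ coeff p n + coeff q n
coeff-addP []      q       n       = sym (ℤₚ.+-identityˡ (coeff q n))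
coeff-addP (x ∷ p) []      n       = sym (ℤₚ.+-identityʳ (coeff (x ∷ p) n))
coeff-addP (x ∷ p) (y ∷ q) zero    = refl
coeff-addP (x ∷ p) (y ∷ q) (suc n) = coeff-addP p q n

coeff-scale : ∀ x p n → coeff (map (x *_) p) n ≡ x * coeff p n
coeff-scale x []      n       = sym (ℤₚ.*-zeroʳ x)
coeff-scale x (y ∷ p) zero    = refl
coeff-scale x (y ∷ p) (suc n) = coeff-scale x p n

coeff-mulP : ∀ p q n → coeff (mulP p q) n ≡ (coeff p ⋆ coeff q) n
coeff-mulP []      q n       = sym (⋆-zeroˡ (coeff q) n)
coeff-mulP (x ∷ p) q zero    = begin
  coeff (addP (map (x *_) q) (+ 0 ∷ mulP p q)) 0 ≡⟨ coeff-addP (map (x *_) q) _ 0 ⟩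
  coeff (map (x *_) q) 0 + + 0                   ≡⟨ ℤₚ.+-identityʳ _ ⟩
  coeff (map (x *_) q) 0                         ≡⟨ coeff-scale x q 0 ⟩
  x * coeff q 0                                  ∎
  where open ≡-Reasoning
coeff-mulP (x ∷ p) q (suc n) = trans (coeff-addP (map (x *_) q) _ (suc n))
  (cong₂ _+_ (coeff-scale x q (suc n)) (coeff-mulP p q n))

infixl 6 _⊕_
infixl 7 _⊗_
infix  8 ⊝_

-- Sealed copies of the operations, so that unification treats them as injective.
abstract
  _⊕_ _⊗_ : Poly → Poly → Poly
  _⊕_ = addP
  _⊗_ = mulP

  ⊝_ : Poly → Poly
  ⊝_ = map (λ x → - x)

  ⊗-def : ∀ p q → p ⊗ q ≡ mulP p q
  ⊗-def p q = refl

  coeff-⊕ : ∀ p q n → coeff (p ⊕ q) n ≡ coeff p n + coeff q n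
  coeff-⊕ = coeff-addP

  coeff-⊗ : ∀ p q n → coeff (p ⊗ q) n ≡ (coeff p ⋆ coeff q) n
  coeff-⊗ = coeff-mulP

  coeff-⊝ : ∀ p n → coeff (⊝ p) n ≡ - coeff p n
  coeff-⊝ []      n       = refl
  coeff-⊝ (y ∷ p) zero    = refl
  coeff-⊝ (y ∷ p) (suc n) = coeff-⊝ p n

coeff-const* : ∀ x q n → coeff ([ x ] ⊗ q) n ≡ x * coeff q n
coeff-const* x q zero    = coeff-⊗ [ x ] q 0
coeff-const* x q (suc n) = trans (coeff-⊗ [ x ] q (suc n))
    (trans (+-congˡ (x * coeff q (suc n)) (⋆-zeroˡ (coeff q) n)) (ℤₚ.+-identityʳ _))

-- Polynomials compared on the coefficients whose index satisfies Q;
-- for Q = (_< K) this is ℤ[x]/(x^K).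
module Truncated (Q : ℕ → Set) (Q-down : ∀ {i j} → i ℕ.≤ j → Q j → Q i) where

  infix 4 _≈_
  -- Comparing coefficients instead of lists disregards trailing zeros; being a record lets `p` and
  -- `q` be inferred from a proof.
  record _≈_ (p q : Poly) : Set where
    constructor coeffwise
    field at : ∀ i → Q i → coeff p i ≡ coeff q i

  open _≈_ public

  private
    equal : ∀ {p q} → (∀ i → coeff p i ≡ coeff q i) → p ≈ q
    equal e = coeffwise λ i _ → e i

    via : ∀ {p q} (f g : ℕ → ℤ) → (∀ n → coeff p n ≡ f n) → (∀ n → coeff q n ≡ g n) →
          (∀ n → f n ≡ g n) → p ≈ q
    via f g e₁ e₂ e = equal λ n → trans (e₁ n) (trans (e n) (sym (e₂ n)))

    ⊗-assoc : ∀ p q r → p ⊗ q ⊗ r ≈ p ⊗ (q ⊗ r)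
    ⊗-assoc p q r = equal λ n → begin
      coeff (p ⊗ q ⊗ r) n             ≡⟨ coeff-⊗ (p ⊗ q) r n ⟩
      (coeff (p ⊗ q) ⋆ coeff r) n          ≡⟨ ⋆-cong n (λ i _ → coeff-⊗ p q i) (λ _ _ → refl) ⟩
      ((coeff p ⋆ coeff q) ⋆ coeff r) n       ≡⟨ ⋆-assoc (coeff p) (coeff q) (coeff r) n ⟩
      (coeff p ⋆ (coeff q ⋆ coeff r)) n       ≡⟨ ⋆-cong n (λ _ _ → refl) (λ i _ → coeff-⊗ q r i) ⟨
      (coeff p ⋆ coeff (q ⊗ r)) n          ≡⟨ coeff-⊗ p (q ⊗ r) n ⟨
      coeff (p ⊗ (q ⊗ r)) n             ∎
      where open ≡-Reasoning

    ⊗-comm : ∀ p q → p ⊗ q ≈ q ⊗ p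
    ⊗-comm p q = via _ _ (coeff-⊗ p q) (coeff-⊗ q p) (⋆-comm (coeff p) (coeff q))

    ⊗-distribʳ : ∀ r p q → (p ⊕ q) ⊗ r ≈ p ⊗ r ⊕ q ⊗ r
    ⊗-distribʳ r p q = equal λ n → begin
      coeff ((p ⊕ q) ⊗ r) n                     ≡⟨ coeff-⊗ (p ⊕ q) r n ⟩
      (coeff (p ⊕ q) ⋆ coeff r) n                  ≡⟨ ⋆-cong n (λ i _ → coeff-⊕ p q i) (λ _ _ → refl) ⟩
      ((λ i → coeff p i + coeff q i) ⋆ coeff r) n     ≡⟨ ⋆-distribʳ (coeff p) (coeff q) (coeff r) n ⟩
      (coeff p ⋆ coeff r) n + (coeff q ⋆ coeff r) n   ≡⟨ cong₂ _+_ (coeff-⊗ p r n) (coeff-⊗ q r n) ⟨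
      coeff (p ⊗ r) n + coeff (q ⊗ r) n         ≡⟨ coeff-⊕ (p ⊗ r) _ n ⟨
      coeff (p ⊗ r ⊕ q ⊗ r) n            ∎
      where open ≡-Reasoning

    ≈-trans : ∀ {p q r} → p ≈ q → q ≈ r → p ≈ r
    ≈-trans e f = coeffwise λ i qi → trans (at e i qi) (at f i qi)

    ⊗-cong : ∀ {p q r s} → p ≈ q → r ≈ s → p ⊗ r ≈ q ⊗ s
    ⊗-cong {p} {q} {r} {s} e f = coeffwise λ n qn → trans (coeff-⊗ p r n)
      (trans (⋆-cong n (λ i i≤n → at e i (Q-down i≤n qn)) (λ i i≤n → at f i (Q-down i≤n qn)))
             (sym (coeff-⊗ q s n)))

    ⊗-identityˡ : ∀ p → [ + 1 ] ⊗ p ≈ p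
    ⊗-identityˡ p = equal λ n → trans (coeff-const* (+ 1) p n) (ℤₚ.*-identityˡ _)

    isCommutativeRing : IsCommutativeRing _≈_ _⊕_ _⊗_ ⊝_ [] [ + 1 ]
    isCommutativeRing = record
      { isRing = record
        { +-isAbelianGroup = record
          { isGroup = record
            { isMonoid = record
              { isSemigroup = record
                { isMagma = record
                  { isEquivalence = record
                    { refl = equal λ _ → refl
                    ; sym = λ e → coeffwise λ i qi → sym (at e i qi)
                    ; trans = ≈-trans }
                  ; ∙-cong = λ {p} {q} {r} {s} e f → coeffwise λ n qn → trans (coeff-⊕ p r n)
                      (trans (cong₂ _+_ (at e n qn) (at f n qn)) (sym (coeff-⊕ q s n))) }
                ; assoc = λ p q r → equal λ n → trans (coeff-⊕ (p ⊕ q) r n)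
                    (trans (cong (λ z → z + coeff r n) (coeff-⊕ p q n))
                    (trans (ℤₚ.+-assoc (coeff p n) (coeff q n) (coeff r n))
                      (sym (trans (coeff-⊕ p (q ⊕ r) n) (+-congˡ (coeff p n) (coeff-⊕ q r n)))))) }
              ; identity = (λ p → equal λ n → trans (coeff-⊕ [] p n) (ℤₚ.+-identityˡ _))
                         , λ p → equal λ n → trans (coeff-⊕ p [] n) (ℤₚ.+-identityʳ _) }
            ; inverse = (λ p → equal λ n → trans (coeff-⊕ (⊝ p) p n)
                          (trans (cong (λ z → z + coeff p n) (coeff-⊝ p n)) (ℤₚ.+-inverseˡ (coeff p n))))
                      , λ p → equal λ n → trans (coeff-⊕ p (⊝ p) n)
                          (trans (+-congˡ (coeff p n) (coeff-⊝ p n)) (ℤₚ.+-inverseʳ (coeff p n)))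
            ; ⁻¹-cong = λ {p} {q} e → coeffwise λ n qn →
                trans (coeff-⊝ p n) (trans (cong (λ x → - x) (at e n qn)) (sym (coeff-⊝ q n))) }
          ; comm = λ p q → equal λ n → trans (coeff-⊕ p q n)
              (trans (ℤₚ.+-comm (coeff p n) (coeff q n)) (sym (coeff-⊕ q p n))) }
        ; *-cong = ⊗-cong
        ; *-assoc = ⊗-assoc
        ; *-identity = ⊗-identityˡ , λ p → ≈-trans (⊗-comm p [ + 1 ]) (⊗-identityˡ p)
        ; distrib = (λ r p q → ≈-trans (⊗-comm r (p ⊕ q)) (≈-trans (⊗-distribʳ r p q)
                      (coeffwise λ n qn → trans (coeff-⊕ (p ⊗ r) _ n)
                        (trans (cong₂ _+_ (at (⊗-comm p r) n qn) (at (⊗-comm q r) n qn))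
                               (sym (coeff-⊕ (r ⊗ p) _ n))))))
                  , ⊗-distribʳ }
      ; *-comm = ⊗-comm }

  ring : CommutativeRing 0ℓ 0ℓ
  ring = record { isCommutativeRing = isCommutativeRing }

module Exact = Truncated (λ _ → ⊤) (λ _ _ → tt)
module Below (K : ℕ) = Truncated (ℕ._< K) (λ i≤j j<K → ℕₚ.≤-<-trans i≤j j<K)

open Exact using (_≈_; coeffwise; at)
module R = CommutativeRing Exact.ring
open NatSolver R.commutativeSemiring using (solve; _:+_; _:*_; _:=_; con)
open RingProperties R.ring using (+-cancelʳ; -‿distribˡ-*; -‿distribʳ-*; -‿+-comm)
import Relation.Binary.Reasoning.Setoid R.setoid as ≈-Reasoning

≈⇒coeff : ∀ {p q} → p ≈ q → ∀ i → coeff p i ≡ coeff q i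
≈⇒coeff e i = at e i tt

coeff⇒≈ : ∀ {p q} → (∀ i → coeff p i ≡ coeff q i) → p ≈ q
coeff⇒≈ e = coeffwise λ i _ → e i

∷-cong : ∀ {x y p q} → x ≡ y → p ≈ q → x ∷ p ≈ y ∷ q
∷-cong x≡y e = coeff⇒≈ λ where
  zero    → x≡y
  (suc i) → ≈⇒coeff e i

shift : ℕ → Poly → Poly
shift n p = replicate n (+ 0) ++ p

X : ℕ → Poly
X n = shift n [ + 1 ]

0∷-⊗ : ∀ p q → (+ 0 ∷ p) ⊗ q ≈ + 0 ∷ (p ⊗ q)
0∷-⊗ p q = coeff⇒≈ λ where
  zero    → coeff-⊗ (+ 0 ∷ p) q 0
  (suc n) → trans (coeff-⊗ (+ 0 ∷ p) q (suc n)) (trans (ℤₚ.+-identityˡ _) (sym (coeff-⊗ p q n)))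

∷-⊕ : ∀ x y p q → (x + y) ∷ (p ⊕ q) ≈ (x ∷ p) ⊕ (y ∷ q)
∷-⊕ x y p q = coeff⇒≈ λ where
  zero    → sym (coeff-⊕ (x ∷ p) (y ∷ q) 0)
  (suc n) → trans (coeff-⊕ p q n) (sym (coeff-⊕ (x ∷ p) (y ∷ q) (suc n)))

X⊗ : ∀ n p → X n ⊗ p ≈ shift n p
X⊗ zero    p = R.*-identityˡ p
X⊗ (suc n) p = R.trans (0∷-⊗ (X n) p) (∷-cong refl (X⊗ n p))

X-+ : ∀ m n → X (m ℕ.+ n) ≈ X m ⊗ X n
X-+ m n = R.trans (R.reflexive (eq m)) (R.sym (X⊗ m (X n)))
  where
  eq : ∀ m → X (m ℕ.+ n) ≡ shift m (X n)
  eq zero    = refl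
  eq (suc m) = cong (+ 0 ∷_) (eq m)

coeff-shift-+ : ∀ n p i → coeff (shift n p) (n ℕ.+ i) ≡ coeff p i
coeff-shift-+ zero    p i = refl
coeff-shift-+ (suc n) p i = coeff-shift-+ n p i

coeff-shift-< : ∀ n p {i} → i ℕ.< n → coeff (shift n p) i ≡ + 0
coeff-shift-< (suc n) p {zero}  _         = refl
coeff-shift-< (suc n) p {suc i} (s≤s i<n) = coeff-shift-< n p i<n

++-⊕ : ∀ p q → p ++ q ≈ p ⊕ shift (length p) q
++-⊕ []      q = R.sym (R.+-identityˡ q)
++-⊕ (x ∷ p) q = R.trans (∷-cong (sym (ℤₚ.+-identityʳ x)) (++-⊕ p q)) (∷-⊕ x (+ 0) p _)

const-+ : ∀ x y → [ x + y ] ≈ [ x ] ⊕ [ y ]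
const-+ x y = R.trans (∷-cong refl (R.sym (R.+-identityˡ []))) (∷-⊕ x y [] [])

map-* : ∀ x p → map (x *_) p ≈ [ x ] ⊗ p
map-* x p = coeff⇒≈ λ n → trans (coeff-scale x p n) (sym (coeff-const* x p n))

∷ʳ-⊕ : ∀ p x → p ++ [ x ] ≈ p ⊕ [ x ] ⊗ X (length p)
∷ʳ-⊕ p x = R.trans (++-⊕ p [ x ])
  (R.+-congˡ (R.trans (R.sym (X⊗ (length p) [ x ])) (R.*-comm (X (length p)) [ x ])))

reverse-∷ : ∀ x p → reverse (x ∷ p) ≈ reverse p ⊕ [ x ] ⊗ X (length p)
reverse-∷ x p rewrite Listₚ.unfold-reverse x p | sym (Listₚ.length-reverse p) = ∷ʳ-⊕ (reverse p) x

-- Long division by a monic polynomial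

length-subPre : ∀ xs ys → length (subPre xs ys) ≡ length xs
length-subPre (x ∷ xs) (y ∷ ys) = cong suc (length-subPre xs ys)
length-subPre []       ys       = refl
length-subPre (x ∷ xs) []       = refl

-- High-first lists are aligned at their leading terms, so a prefix subtraction removes `ys`
-- multiplied by the power of `x` that makes up the difference in length.
reverse-subPre : ∀ xs ys → length ys ℕ.≤ length xs →
  reverse xs ≈ reverse (subPre xs ys) ⊕ X (length xs ℕ.∸ length ys) ⊗ reverse ys
reverse-subPre []       []       _ = R.sym (R.trans (R.+-identityˡ _) (R.zeroʳ (X 0)))
reverse-subPre (x ∷ xs) []       _ = R.sym (R.trans (R.+-congˡ (R.zeroʳ (X (suc (length xs))))) (R.+-identityʳ _))
reverse-subPre (x ∷ xs) (y ∷ ys) (s≤s len) = begin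
  reverse (x ∷ xs)                                     ≈⟨ reverse-∷ x xs ⟩
  reverse xs ⊕ [ x ] ⊗ X n
    ≈⟨ R.+-cong (reverse-subPre xs ys len) (R.*-congʳ (R.trans (∷-cong (eq x y) R.refl) (const-+ z y))) ⟩
  (reverse r ⊕ X d ⊗ reverse ys) ⊕ ([ z ] ⊕ [ y ]) ⊗ X n
    ≈⟨ R.+-congˡ (R.trans (R.distribʳ (X n) [ z ] [ y ]) (R.+-congˡ (R.*-congˡ Xn))) ⟩
  (reverse r ⊕ X d ⊗ reverse ys) ⊕ ([ z ] ⊗ X n ⊕ [ y ] ⊗ (X d ⊗ X m))
    ≈⟨ solve 7 (λ r a s z n y m → (r :+ a :* s) :+ (z :* n :+ y :* (a :* m)) := (r :+ z :* n) :+ a :*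
        (s :+ y :* m)) R.refl
         (reverse r) (X d) (reverse ys) [ z ] (X n) [ y ] (X m) ⟩
  (reverse r ⊕ [ z ] ⊗ X n) ⊕ X d ⊗ (reverse ys ⊕ [ y ] ⊗ X m)
    ≈⟨ R.+-cong (R.trans (R.+-congˡ (R.*-congˡ (R.reflexive (cong X (sym (length-subPre xs ys))))))
                         (R.sym (reverse-∷ z r))) (R.*-congˡ (R.sym (reverse-∷ y ys))) ⟩
  reverse (z ∷ r) ⊕ X d ⊗ reverse (y ∷ ys) ∎
  where
  open ≈-Reasoning
  n = length xs
  m = length ys
  d = n ℕ.∸ m
  z = x ℤ.- y
  r = subPre xs ys
  eq : ∀ x y → x ≡ (x ℤ.- y) + y
  eq = solve-∀
  Xn : X n ≈ X d ⊗ X m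
  Xn = R.trans (R.reflexive (cong X (sym (ℕₚ.m∸n+n≡m len)))) (X-+ d m)

length-quot : ∀ n xs b bs → length xs ℕ.≤ n → length (quot n xs (b ∷ bs)) ≡ length xs ℕ.∸ length bs
length-quot zero    []       b bs _ = sym (ℕₚ.0∸n≡0 (length bs))
length-quot (suc n) []       b bs _ = sym (ℕₚ.0∸n≡0 (length bs))
length-quot (suc n) (x ∷ xs) b bs (s≤s xs≤n)
  with length bs ℕ.≤ᵇ length xs | ℕₚ.≤ᵇ-reflects-≤ (length bs) (length xs)
... | false | bs≰xs = sym (ℕₚ.m≤n⇒m∸n≡0 (ℕₚ.≰⇒> (λ le → invert bs≰xs le)))
... | true  | bs≤xs = begin
  suc (length (quot n r (b ∷ bs)))
    ≡⟨ cong suc (length-quot n r b bs (subst (ℕ._≤ n) (sym (length-subPre xs _)) xs≤n)) ⟩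
  suc (length r ℕ.∸ length bs)       ≡⟨ cong (λ l → suc (l ℕ.∸ length bs)) (length-subPre xs _) ⟩
  suc (length xs ℕ.∸ length bs)      ≡⟨ ℕₚ.+-∸-assoc 1 (invert bs≤xs) ⟨
  suc (length xs) ℕ.∸ length bs      ∎
  where
  open ≡-Reasoning
  r = subPre xs (map (x *_) bs)

-- The invariant of long division. `bs` omits the leading 1, so its length is the degree of the
-- divisor and bounds the remainder.
reverse-quot : ∀ n xs bs → length xs ℕ.≤ n → ∃[ r ] (length r ℕ.≤ length bs ×
  reverse xs ≈ reverse (quot n xs (+ 1 ∷ bs)) ⊗ reverse (+ 1 ∷ bs) ⊕ r)
reverse-quot zero    []       bs _ = [] , z≤n , R.sym (R.trans (R.+-identityʳ _) (R.zeroˡ _))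
reverse-quot (suc n) []       bs _ = [] , z≤n , R.sym (R.trans (R.+-identityʳ _) (R.zeroˡ _))
reverse-quot (suc n) (x ∷ xs) bs (s≤s xs≤n)
  with length bs ℕ.≤ᵇ length xs | ℕₚ.≤ᵇ-reflects-≤ (length bs) (length xs)
... | false | bs≰xs = reverse (x ∷ xs)
                    , subst (ℕ._≤ length bs) (sym (Listₚ.length-reverse (x ∷ xs))) (ℕₚ.≰⇒> (λ le → invert bs≰xs le))
                    , R.sym (R.trans (R.+-congʳ (R.zeroˡ _)) (R.+-identityˡ _))
... | true  | bs≤xs′ = let (r , r≤ , eq) = reverse-quot n xs′ bs (subst (ℕ._≤ n) (sym lenxs′) xs≤n) in
  r , r≤ , (begin
  reverse (x ∷ xs)                  ≈⟨ reverse-∷ x xs ⟩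
  reverse xs ⊕ [ x ] ⊗ X (length xs)
    ≈⟨ R.+-cong (reverse-subPre xs ys ys≤xs) (R.*-congˡ Xn) ⟩
  (reverse xs′ ⊕ X (length xs ℕ.∸ length ys) ⊗ reverse ys) ⊕ [ x ] ⊗ (X d ⊗ X m)
    ≈⟨ R.+-congʳ (R.+-cong eq (R.*-cong
        (R.reflexive (cong (λ l → X (length xs ℕ.∸ l)) (Listₚ.length-map (x *_) bs))) rev-ys)) ⟩
  ((reverse q ⊗ B ⊕ r) ⊕ X d ⊗ ([ x ] ⊗ reverse bs)) ⊕ [ x ] ⊗ (X d ⊗ X m)
    ≈⟨ R.+-congʳ (R.+-congʳ (R.+-congʳ (R.*-congˡ rev-B))) ⟩
  ((reverse q ⊗ (reverse bs ⊕ X m) ⊕ r) ⊕ X d ⊗ ([ x ] ⊗ reverse bs)) ⊕ [ x ] ⊗ (X d ⊗ X m)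
    ≈⟨ solve 6 (λ q b m r d x → ((q :* (b :+ m) :+ r) :+ d :* (x :* b)) :+ x :* (d :* m) := (q :+ x :* d) :*
        (b :+ m) :+ r) R.refl
         (reverse q) (reverse bs) (X m) r (X d) [ x ] ⟩
  (reverse q ⊕ [ x ] ⊗ X d) ⊗ (reverse bs ⊕ X m) ⊕ r
    ≈⟨ R.+-congʳ (R.*-cong (R.trans (R.+-congˡ (R.*-congˡ (R.reflexive (cong X (sym lenq)))))
        (R.sym (reverse-∷ x q))) (R.sym rev-B)) ⟩
  reverse (x ∷ q) ⊗ B ⊕ r ∎)
  where
  open ≈-Reasoning
  bs≤xs = invert bs≤xs′
  m = length bs
  d = length xs ℕ.∸ m
  ys = map (x *_) bs
  xs′ = subPre xs ys
  q = quot n xs′ (+ 1 ∷ bs)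
  B = reverse (+ 1 ∷ bs)
  lenxs′ = length-subPre xs ys
  ys≤xs : length ys ℕ.≤ length xs
  ys≤xs = subst (ℕ._≤ length xs) (sym (Listₚ.length-map (x *_) bs)) bs≤xs
  lenq : length q ≡ d
  lenq = trans (length-quot n xs′ (+ 1) bs (subst (ℕ._≤ n) (sym lenxs′) xs≤n)) (cong (ℕ._∸ m) lenxs′)
  Xn : X (length xs) ≈ X d ⊗ X m
  Xn = R.trans (R.reflexive (cong X (sym (ℕₚ.m∸n+n≡m bs≤xs)))) (X-+ d m)
  rev-B : B ≈ reverse bs ⊕ X m
  rev-B = R.trans (reverse-∷ (+ 1) bs) (R.+-congˡ (R.*-identityˡ (X m)))
  rev-ys : reverse ys ≈ [ x ] ⊗ reverse bs
  rev-ys = R.trans (R.reflexive (sym (Listₚ.reverse-map (x *_) bs))) (map-* x (reverse bs))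

coeff-≥length : ∀ p {i} → length p ℕ.≤ i → coeff p i ≡ + 0
coeff-≥length []      _         = refl
coeff-≥length (x ∷ p) (s≤s len) = coeff-≥length p len

coeff-∷ʳ : ∀ p x → coeff (p ∷ʳ x) (length p) ≡ x
coeff-∷ʳ []      x = refl
coeff-∷ʳ (y ∷ p) x = coeff-∷ʳ p x

⋆-top : ∀ m l {f g : ℕ → ℤ} → (∀ i → m ℕ.< i → f i ≡ + 0) → (∀ i → l ℕ.< i → g i ≡ + 0) →
        (f ⋆ g) (m ℕ.+ l) ≡ f m * g l
⋆-top zero    zero    f0 g0 = refl
⋆-top zero    (suc l) {f} {g} f0 g0 = trans
  (+-congˡ (f 0 * g (suc l)) (trans (⋆-cong l (λ i _ → f0 (suc i) (s≤s z≤n)) (λ _ _ → refl)) (⋆-zeroˡ g l)))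
  (ℤₚ.+-identityʳ _)
⋆-top (suc m) l {f} {g} f0 g0 = trans
  (cong₂ _+_ (trans (cong (f 0 *_) (g0 _ (s≤s (ℕₚ.m≤n+m l m)))) (ℤₚ.*-zeroʳ (f 0)))
             (⋆-top m l (λ i m<i → f0 (suc i) (s≤s m<i)) g0))
  (ℤₚ.+-identityˡ _)

-- The length of the list is part of the notion: `divMonic` reverses its arguments and takes the
-- head for the leading coefficient, so trailing zeros would matter.
record Monic (n : ℕ) (p : Poly) : Set where
  constructor monic
  field
    length≡ : length p ≡ suc n
    top     : coeff p n ≡ + 1

  vanish : ∀ i → n ℕ.< i → coeff p i ≡ + 0
  vanish i n<i = coeff-≥length p (subst (ℕ._≤ i) (sym length≡) n<i)

open Monic public

Monic-∷ʳ : ∀ p → Monic (length p) (p ∷ʳ + 1)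
Monic-∷ʳ p = monic (trans (Listₚ.length-++ p) (ℕₚ.+-comm (length p) 1)) (coeff-∷ʳ p (+ 1))

Monic⇒∷ʳ : ∀ {n p} → Monic n p → ∃[ q ] (p ≡ q ∷ʳ + 1 × length q ≡ n)
Monic⇒∷ʳ {n} {p} (monic len top) with initLast p
... | q ∷ʳ′ x = q , cong (q ∷ʳ_) (trans (sym (coeff-∷ʳ q x)) (trans (cong (coeff (q ∷ʳ x)) lenq) top)) , lenq
  where
  lenq : length q ≡ n
  lenq = ℕₚ.suc-injective (trans (trans (ℕₚ.+-comm 1 (length q)) (sym (Listₚ.length-++ q))) len)

length-addP : ∀ p q → length (addP p q) ≡ length p ℕ.⊔ length q
length-addP []      q       = refl
length-addP (x ∷ p) []      = refl
length-addP (x ∷ p) (y ∷ q) = cong suc (length-addP p q)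

length-mulP : ∀ x p {n} q → length q ≡ suc n → length (mulP (x ∷ p) q) ≡ length p ℕ.+ suc n
length-mulP x []      {n} q len = begin
  length (addP (map (x *_) q) [ + 0 ])  ≡⟨ length-addP (map (x *_) q) [ + 0 ] ⟩
  length (map (x *_) q) ℕ.⊔ 1           ≡⟨ cong (ℕ._⊔ 1) (trans (Listₚ.length-map (x *_) q) len) ⟩
  suc (n ℕ.⊔ 0)                         ≡⟨ cong suc (ℕₚ.⊔-identityʳ n) ⟩
  suc n                                 ∎
  where open ≡-Reasoning
length-mulP x (y ∷ p) {n} q len = begin
  length (addP (map (x *_) q) (+ 0 ∷ mulP (y ∷ p) q))  ≡⟨ length-addP (map (x *_) q) _ ⟩
  length (map (x *_) q) ℕ.⊔ suc (length (mulP (y ∷ p) q))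
    ≡⟨ cong₂ ℕ._⊔_ (trans (Listₚ.length-map (x *_) q) len) (cong suc (length-mulP y p q len)) ⟩
  suc n ℕ.⊔ suc (length p ℕ.+ suc n)
    ≡⟨ ℕₚ.m≤n⇒m⊔n≡n (s≤s (ℕₚ.≤-trans (ℕₚ.n≤1+n n) (ℕₚ.m≤n+m (suc n) (length p)))) ⟩
  suc (length p ℕ.+ suc n) ∎
  where open ≡-Reasoning

Monic-⊗ : ∀ {m n p q} → Monic m p → Monic n q → Monic (m ℕ.+ n) (p ⊗ q)
Monic-⊗ {m} {n} {x ∷ p} {q} mp mq = subst (Monic (m ℕ.+ n)) (sym (⊗-def (x ∷ p) q)) (monic
  (trans (length-mulP x p q (length≡ mq)) (trans (cong (ℕ._+ suc n) (ℕₚ.suc-injective (length≡ mp))) (ℕₚ.+-suc m n)))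
  (trans (coeff-mulP (x ∷ p) q (m ℕ.+ n)) (trans (⋆-top m n (vanish mp) (vanish mq)) (cong₂ _*_ (top mp) (top mq)))))

reverse-Monic : ∀ {n p} → Monic n p → ∃[ q ] (reverse p ≡ + 1 ∷ q × length q ≡ n)
reverse-Monic mp with Monic⇒∷ʳ mp
... | q , refl , refl = reverse q , Listₚ.reverse-++ q [ + 1 ] , Listₚ.length-reverse q

divMonic-division : ∀ A {m B} → Monic m B → ∃[ r ] (length r ℕ.≤ m × A ≈ divMonic A B ⊗ B ⊕ r)
divMonic-division A {m} {B} mB with reverse-Monic mB
... | bs , revB , refl with reverse-quot (length A) (reverse A) bs (ℕₚ.≤-reflexive (Listₚ.length-reverse A))
... | r , r≤ , eq = r , r≤ , R.trans (R.reflexive (sym (Listₚ.reverse-involutive A)))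
        (R.trans eq (R.+-congʳ (R.*-cong
          (R.reflexive (sym (trans (divMonic-quot A B) (cong (λ z → reverse (quot (length A) (reverse A) z)) revB))))
          (R.reflexive (trans (cong reverse (sym revB)) (Listₚ.reverse-involutive B))))))

-- The leading 1 of the dividend becomes the head of the quotient. As `Monic` speaks of lists, this
-- is read off `quot` and not off the division equation.
Monic-divMonic : ∀ {m n A B} → Monic n A → Monic m B → m ℕ.≤ n → Monic (n ℕ.∸ m) (divMonic A B)
Monic-divMonic {m} {n} {A} {B} mA mB m≤n with reverse-Monic mA | reverse-Monic mB
... | as , revA , refl | bs , revB , refl
  rewrite divMonic-quot A B | revA | revB | length≡ mA
  with length bs ℕ.≤ᵇ length as in eq
... | false = ⊥-elim (subst Bool.T eq (ℕₚ.≤⇒≤ᵇ m≤n))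
... | true  = subst₂ Monic (trans (Listₚ.length-reverse q) lenq) (sym (Listₚ.unfold-reverse (+ 1) q))
    (Monic-∷ʳ (reverse q))
  where
  r = subPre as (map (+ 1 *_) bs)
  q = quot (length as) r (+ 1 ∷ bs)
  lenr = length-subPre as (map (+ 1 *_) bs)
  lenq : length q ≡ length as ℕ.∸ length bs
  lenq = trans (length-quot (length as) r (+ 1) bs (ℕₚ.≤-reflexive lenr)) (cong (ℕ._∸ length bs) lenr)

-- A leading coefficient of `W` reappears in `D ⊗ W` at an index of at least `m`, where everything
-- vanishes; hence the bound on the degree of `W` descends to nothing.
⊗-monic-small : ∀ {m D} → Monic m D → ∀ W → (∀ i → m ℕ.≤ i → coeff (D ⊗ W) i ≡ + 0) → W ≈ []
⊗-monic-small {m} {D} mD W DW0 = coeff⇒≈ (descend (length W) (λ i → coeff-≥length W))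
  where
  descend : ∀ l → (∀ i → l ℕ.≤ i → coeff W i ≡ + 0) → ∀ i → coeff W i ≡ + 0
  descend zero    W0 i = W0 i z≤n
  descend (suc l) W0 i = descend l (λ j l≤j → case (ℕₚ.m≤n⇒m<n∨m≡n l≤j)) i
    where
    Wl : coeff W l ≡ + 0
    Wl = begin
      coeff W l                       ≡⟨ ℤₚ.*-identityˡ _ ⟨
      + 1 * coeff W l                 ≡⟨ cong (_* coeff W l) (top mD) ⟨
      coeff D m * coeff W l           ≡⟨ ⋆-top m l (vanish mD) W0 ⟨
      (coeff D ⋆ coeff W) (m ℕ.+ l)   ≡⟨ coeff-⊗ D W (m ℕ.+ l) ⟨
      coeff (D ⊗ W) (m ℕ.+ l)         ≡⟨ DW0 (m ℕ.+ l) (ℕₚ.m≤m+n m l) ⟩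
      + 0                             ∎
      where open ≡-Reasoning
    case : ∀ {j} → l ℕ.< j ⊎ l ≡ j → coeff W j ≡ + 0
    case (inj₁ l<j)  = W0 _ l<j
    case (inj₂ refl) = Wl

small-multiple : ∀ {m D} → Monic m D → ∀ W R → (∀ i → m ℕ.≤ i → coeff R i ≡ + 0) → R ≈ D ⊗ W → R ≈ []
small-multiple {m} {D} mD W R R0 eq = R.trans eq (R.trans (R.*-congˡ W≈0) (R.zeroʳ D))
  where
  W≈0 : W ≈ []
  W≈0 = ⊗-monic-small mD W λ i m≤i → trans (sym (≈⇒coeff eq i)) (R0 i m≤i)

⊗-cancelˡ : ∀ {m D} → Monic m D → ∀ {p q} → D ⊗ p ≈ D ⊗ q → p ≈ q
⊗-cancelˡ {D = D} mD {p} {q} eq = begin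
  p               ≈⟨ R.+-identityʳ p ⟨
  p ⊕ []          ≈⟨ R.+-congˡ (R.-‿inverseˡ q) ⟨
  p ⊕ (⊝ q ⊕ q)   ≈⟨ R.+-assoc p (⊝ q) q ⟨
  (p ⊕ ⊝ q) ⊕ q   ≈⟨ R.+-congʳ (⊗-monic-small mD (p ⊕ ⊝ q) (λ i _ → ≈⇒coeff diff i)) ⟩
  [] ⊕ q          ≈⟨ R.+-identityˡ q ⟩
  q               ∎
  where
  open ≈-Reasoning
  diff : D ⊗ (p ⊕ ⊝ q) ≈ []
  diff = R.trans (R.distribˡ D p (⊝ q)) (R.trans (R.+-cong eq (R.sym (-‿distribʳ-* D q))) (R.-‿inverseʳ (D ⊗ q)))

-- The remainder times `suc k` is a multiple of `D` of degree below `m`, hence zero, and `suc k` can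
-- be cancelled.
divMonic-exact : ∀ F {m D} → Monic m D → ∀ k W → [ + suc k ] ⊗ F ≈ D ⊗ W → F ≈ divMonic F D ⊗ D
divMonic-exact F {m} {D} mD k W eq with divMonic-division F mD
... | r , r≤m , div = R.trans div (R.trans (R.+-congˡ r≈0) (R.+-identityʳ (Q ⊗ D)))
  where
  open ≈-Reasoning
  K = [ + suc k ]
  Q = divMonic F D
  V = W ⊕ ⊝ (K ⊗ Q)
  Kr : K ⊗ r ≈ D ⊗ V
  Kr = begin
    K ⊗ r                                      ≈⟨ R.+-identityʳ _ ⟨
    K ⊗ r ⊕ []                                 ≈⟨ R.+-congˡ (R.-‿inverseʳ (D ⊗ (K ⊗ Q))) ⟨
    K ⊗ r ⊕ (D ⊗ (K ⊗ Q) ⊕ ⊝ (D ⊗ (K ⊗ Q)))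
      ≈⟨ solve 5 (λ k r d q n → k :* r :+ (d :* (k :* q) :+ n) := k :* (q :* d :+ r) :+ n) R.refl K r D Q
          (⊝ (D ⊗ (K ⊗ Q))) ⟩
    K ⊗ (Q ⊗ D ⊕ r) ⊕ ⊝ (D ⊗ (K ⊗ Q))       ≈⟨ R.+-cong (R.trans (R.*-congˡ (R.sym div)) eq) (-‿distribʳ-* D (K ⊗ Q)) ⟩
    D ⊗ W ⊕ D ⊗ ⊝ (K ⊗ Q)                   ≈⟨ R.distribˡ D W (⊝ (K ⊗ Q)) ⟨
    D ⊗ V                                      ∎
  K≈0 : K ⊗ r ≈ []
  K≈0 = small-multiple mD V (K ⊗ r) (λ i m≤i → trans (coeff-const* (+ suc k) r i)
          (trans (cong (+ suc k *_) (coeff-≥length r (ℕₚ.≤-trans r≤m m≤i))) (ℤₚ.*-zeroʳ (+ suc k)))) Kr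
  r≈0 : r ≈ []
  r≈0 = coeff⇒≈ λ i → ℤₚ.*-cancelˡ-≡ (+ suc k) (coeff r i) (+ 0)
          (trans (sym (coeff-const* (+ suc k) r i)) (trans (≈⇒coeff K≈0 i) (sym (ℤₚ.*-zeroʳ (+ suc k)))))

-- The factorisation of x^n - 1

𝟙 : Poly
𝟙 = [ + 1 ]

xN-1⊕𝟙 : ∀ {n} → 0 ℕ.< n → xN-1 n ⊕ 𝟙 ≈ X n
xN-1⊕𝟙 {suc n} _ = R.trans (R.sym (∷-⊕ (- (+ 1)) (+ 1) (X n) [])) (∷-cong refl (R.+-identityʳ (X n)))

-- The geometric sum `(x^(kg) - 1)/(x^g - 1)` with `k` terms.
geo : ℕ → ℕ → Poly
geo g zero    = []
geo g (suc k) = 𝟙 ⊕ X g ⊗ geo g k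

-- The 1 stands on the left because `xN-1 0` is `x - 1` and not 0: in this form `k = 0` is covered
-- too, and no subtraction gets in the way of the semiring solver.
xN-1⊗geo⊕𝟙 : ∀ {g} → 0 ℕ.< g → ∀ k → xN-1 g ⊗ geo g k ⊕ 𝟙 ≈ X (k ℕ.* g)
xN-1⊗geo⊕𝟙 {g} g>0 zero    = R.trans (R.+-congʳ (R.zeroʳ (xN-1 g))) (R.+-identityˡ 𝟙)
xN-1⊗geo⊕𝟙 {g} g>0 (suc k) = begin
  y ⊗ (𝟙 ⊕ X g ⊗ G) ⊕ 𝟙
    ≈⟨ solve 3 (λ y x g → y :* (con 1 :+ x :* g) :+ con 1 := (y :+ con 1) :+ x :* (y :* g)) R.refl y (X g) G ⟩
  (y ⊕ 𝟙) ⊕ X g ⊗ (y ⊗ G)      ≈⟨ R.+-congʳ (xN-1⊕𝟙 g>0) ⟩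
  X g ⊕ X g ⊗ (y ⊗ G)          ≈⟨ solve 2 (λ x z → x :+ x :* z := x :* (z :+ con 1)) R.refl (X g) (y ⊗ G) ⟩
  X g ⊗ (y ⊗ G ⊕ 𝟙)            ≈⟨ R.*-congˡ (xN-1⊗geo⊕𝟙 g>0 k) ⟩
  X g ⊗ X (k ℕ.* g)            ≈⟨ X-+ g (k ℕ.* g) ⟨
  X (g ℕ.+ k ℕ.* g)            ∎
  where
  open ≈-Reasoning
  y = xN-1 g
  G = geo g k

xN-1-geo : ∀ {g} → 0 ℕ.< g → ∀ k → 0 ℕ.< k ℕ.* g → xN-1 (k ℕ.* g) ≈ xN-1 g ⊗ geo g k
xN-1-geo {g} g>0 k kg>0 = +-cancelʳ 𝟙 _ _ (R.trans (xN-1⊕𝟙 kg>0) (R.sym (xN-1⊗geo⊕𝟙 g>0 k)))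

-- Modulo `xN-1 g` each of the `k` terms of the geometric sum is 1.
geo-mod : ∀ {g} → 0 ℕ.< g → ∀ k → ∃[ V ] geo g k ≈ [ + k ] ⊕ xN-1 g ⊗ V
geo-mod {g} g>0 zero = [] , coeff⇒≈ λ where
    zero    → sym (eq 0 refl)
    (suc n) → sym (eq (suc n) refl)
  where
  eq : ∀ n → coeff [ + 0 ] n ≡ + 0 → coeff ([ + 0 ] ⊕ xN-1 g ⊗ []) n ≡ + 0
  eq n e = trans (coeff-⊕ [ + 0 ] _ n) (cong₂ _+_ e (≈⇒coeff (R.zeroʳ (xN-1 g)) n))
geo-mod {g} g>0 (suc k) with geo-mod g>0 k
... | V , eq = [ + k ] ⊕ X g ⊗ V , (begin
  𝟙 ⊕ X g ⊗ geo g k                    ≈⟨ R.+-congˡ (R.*-congˡ eq) ⟩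
  𝟙 ⊕ X g ⊗ (K ⊕ y ⊗ V)
    ≈⟨ solve 5 (λ x k y v o → o :+ x :* (k :+ y :* v) := o :+ (x :* k :+ y :* (x :* v))) R.refl (X g) K y V 𝟙 ⟩
  𝟙 ⊕ (X g ⊗ K ⊕ y ⊗ (X g ⊗ V))        ≈⟨ R.+-congˡ (R.+-congʳ (R.*-congʳ (xN-1⊕𝟙 g>0))) ⟨
  𝟙 ⊕ ((y ⊕ 𝟙) ⊗ K ⊕ y ⊗ (X g ⊗ V))
    ≈⟨ solve 4 (λ k y v x → con 1 :+ ((y :+ con 1) :* k :+ y :* (x :* v)) := (con 1 :+ k) :+ y :*
        (k :+ x :* v)) R.refl K y V (X g) ⟩
  (𝟙 ⊕ K) ⊕ y ⊗ (K ⊕ X g ⊗ V)          ≈⟨ R.+-congʳ (const-+ (+ 1) (+ k)) ⟨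
  [ + suc k ] ⊕ y ⊗ (K ⊕ X g ⊗ V)      ∎)
  where
  open ≈-Reasoning
  y = xN-1 g
  K = [ + k ]

prod : (ℕ → Poly) → List ℕ → Poly
prod f []       = 𝟙
prod f (d ∷ ds) = f d ⊗ prod f ds

prod-↭ : ∀ f {xs ys} → xs ↭ ys → prod f xs ≈ prod f ys
prod-↭ f ↭.refl         = R.refl
prod-↭ f (↭.prep x p)   = R.*-congˡ (prod-↭ f p)
prod-↭ f (↭.swap x y p) = R.trans (R.*-congˡ (R.*-congˡ (prod-↭ f p)))
  (solve 3 (λ a b c → a :* (b :* c) := b :* (a :* c)) R.refl (f x) (f y) _)
prod-↭ f (↭.trans p q)  = R.trans (prod-↭ f p) (prod-↭ f q)

prod-cong : ∀ {f g} xs → (∀ {x} → x ∈ xs → f x ≈ g x) → prod f xs ≈ prod g xs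
prod-cong []       e = R.refl
prod-cong (x ∷ xs) e = R.*-cong (e (here refl)) (prod-cong xs (e ∘ there))

prod-filter : ∀ f {P : ℕ → Set} (P? : Decidable P) xs →
              prod f xs ≈ prod f (filter P? xs) ⊗ prod f (filter (¬? ∘ P?) xs)
prod-filter f P? []       = R.sym (R.*-identityˡ 𝟙)
prod-filter f P? (x ∷ xs) with P? x
... | yes _ = R.trans (R.*-congˡ (prod-filter f P? xs)) (R.sym (R.*-assoc _ _ _))
... | no  _ = R.trans (R.*-congˡ (prod-filter f P? xs))
  (solve 3 (λ a b c → a :* (b :* c) := b :* (a :* c)) R.refl (f x) _ _)

prod-∈ : ∀ f {x xs} → x ∈ xs → ∃[ W ] prod f xs ≈ f x ⊗ W
prod-∈ f {x} {_ ∷ xs} (here refl) = prod f xs , R.refl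
prod-∈ f {x} {y ∷ xs} (there i) with prod-∈ f i
... | W , eq = f y ⊗ W , R.trans (R.*-congˡ eq)
    (solve 3 (λ a b c → a :* (b :* c) := b :* (a :* c)) R.refl (f y) (f x) W)

unique-↭ : {xs ys : List ℕ} → Unique xs → Unique ys → (∀ {x} → x ∈ xs → x ∈ ys) → (∀ {x} → x ∈ ys → x ∈ xs) → xs ↭ ys
unique-↭ u v f g = ∼bag⇒↭ (unique∧set⇒bag u v (mk⇔ f g))

abstract
  -- Listed downwards, the order in which `properProd` multiplies.
  divisorsUpTo : ℕ → ℕ → List ℕ
  divisorsUpTo m n = filter (_∣? m) (applyDownFrom suc n)

  divisorsUpTo-zero : ∀ m → divisorsUpTo m 0 ≡ []
  divisorsUpTo-zero m = refl

  divisorsUpTo-accept : ∀ {m n} → suc n ∣ m → divisorsUpTo m (suc n) ≡ suc n ∷ divisorsUpTo m n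
  divisorsUpTo-accept {m} = Listₚ.filter-accept (_∣? m)

  divisorsUpTo-reject : ∀ {m n} → ¬ suc n ∣ m → divisorsUpTo m (suc n) ≡ divisorsUpTo m n
  divisorsUpTo-reject {m} = Listₚ.filter-reject (_∣? m)

  ∈-divisorsUpTo⁺ : ∀ {m n d} → 0 ℕ.< d → d ℕ.≤ n → d ∣ m → d ∈ divisorsUpTo m n
  ∈-divisorsUpTo⁺ {d = suc d} _ d≤n d∣m = ∈-filter⁺ (_∣? _) (∈-applyDownFrom⁺ suc d≤n) d∣m

  ∈-divisorsUpTo⁻ : ∀ {m n d} → d ∈ divisorsUpTo m n → 0 ℕ.< d × d ℕ.≤ n × d ∣ m
  ∈-divisorsUpTo⁻ {m} {n} d∈ with ∈-filter⁻ (_∣? m) {xs = applyDownFrom suc n} d∈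
  ... | d∈′ , d∣m with ∈-applyDownFrom⁻ suc {n = n} d∈′
  ... | i , i<n , refl = s≤s z≤n , i<n , d∣m

  divisors-unique : ∀ m n → Unique (divisorsUpTo m n)
  divisors-unique m n = Uniqueₚ.filter⁺ (_∣? m)
    (Uniqueₚ.applyDownFrom⁺₁ suc n (λ j<i _ eq → ℕₚ.<⇒≢ j<i (sym (ℕₚ.suc-injective eq))))

divisors : ℕ → List ℕ
divisors n = divisorsUpTo n n

∣-pos : ∀ {d n} → 0 ℕ.< n → d ∣ n → 0 ℕ.< d
∣-pos {zero}  n>0 0∣n = ⊥-elim (ℕₚ.<⇒≢ n>0 (sym (0∣⇒≡0 0∣n)))
∣-pos {suc d} n>0 _   = s≤s z≤n

∈-divisors⁺ : ∀ {n d} → 0 ℕ.< n → d ∣ n → d ∈ divisors n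
∈-divisors⁺ {suc n} n>0 d∣n = ∈-divisorsUpTo⁺ (∣-pos n>0 d∣n) (∣⇒≤ d∣n) d∣n

∈-divisors⁻ : ∀ {n d} → d ∈ divisors n → 0 ℕ.< d × d ∣ n
∈-divisors⁻ {n} d∈ = let (a , _ , b) = ∈-divisorsUpTo⁻ {n} {n} d∈ in a , b

divisors-suc : ∀ n → divisors (suc n) ≡ suc n ∷ divisorsUpTo (suc n) n
divisors-suc n = divisorsUpTo-accept ∣-refl

index-++ˡ : {A : Set} (d : A) → ∀ xs ys {i} → i ℕ.< length xs → index d (xs ++ ys) i ≡ index d xs i
index-++ˡ d (x ∷ xs) ys {zero}  _         = refl
index-++ˡ d (x ∷ xs) ys {suc i} (s≤s i<n) = index-++ˡ d xs ys i<n

index-∷ʳ : {A : Set} (d : A) → ∀ xs y → index d (xs ++ [ y ]) (length xs) ≡ y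
index-∷ʳ d []       y = refl
index-∷ʳ d (x ∷ xs) y = index-∷ʳ d xs y

length-cycTable : ∀ n → length (cycTable n) ≡ n
length-cycTable zero    = refl
length-cycTable (suc n) = trans (Listₚ.length-++ (cycTable n)) (trans (ℕₚ.+-comm _ 1) (cong suc (length-cycTable n)))

index-cycTable : ∀ n {d} → d ℕ.< n → index [] (cycTable n) d ≡ Φ (suc d)
index-cycTable (suc n) {d} (s≤s d≤n) with ℕₚ.m≤n⇒m<n∨m≡n d≤n
... | inj₁ d<n  = trans (index-++ˡ [] (cycTable n) _ (subst (d ℕ.<_) (sym (length-cycTable n)) d<n))
    (index-cycTable n d<n)
... | inj₂ refl = refl

-- The table stays that of `N` while the recursion descends through `n`.
properProd-divisors : ∀ m N n → n ℕ.≤ N → properProd m (cycTable N) n ≡ prod Φ (divisorsUpTo m n)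
properProd-divisors m N zero    _   = cong (prod Φ) (sym (divisorsUpTo-zero m))
properProd-divisors m N (suc d) d<N with suc d ∣? m
... | yes d∣m = begin
  mulP (index [] (cycTable N) d) (properProd m (cycTable N) d)  ≡⟨ ⊗-def _ _ ⟨
  index [] (cycTable N) d ⊗ properProd m (cycTable N) d
    ≡⟨ cong₂ _⊗_ (index-cycTable N d<N) (properProd-divisors m N d (ℕₚ.<⇒≤ d<N)) ⟩
  prod Φ (suc d ∷ divisorsUpTo m d)                             ≡⟨ cong (prod Φ) (divisorsUpTo-accept d∣m) ⟨
  prod Φ (divisorsUpTo m (suc d))                               ∎
  where open ≡-Reasoning
... | no  d∤m = trans (properProd-divisors m N d (ℕₚ.<⇒≤ d<N)) (cong (prod Φ) (sym (divisorsUpTo-reject d∤m)))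

Φ-suc : ∀ n → Φ (suc n) ≡ divMonic (xN-1 (suc n)) (prod Φ (divisorsUpTo (suc n) n))
Φ-suc n = begin
  index [] (cycTable (suc n)) n                       ≡⟨ cong (λ t → index [] t n) (cycTable-suc n) ⟩
  index [] (cycTable n ++ [ Q ]) n                    ≡⟨ cong (index [] (cycTable n ++ [ Q ])) (length-cycTable n) ⟨
  index [] (cycTable n ++ [ Q ]) (length (cycTable n)) ≡⟨ index-∷ʳ [] (cycTable n) Q ⟩
  Q
    ≡⟨ cong (divMonic (xN-1 (suc n))) (properProd-divisors (suc n) n n ℕₚ.≤-refl) ⟩
  divMonic (xN-1 (suc n)) (prod Φ (divisorsUpTo (suc n) n)) ∎
  where
  open ≡-Reasoning
  Q = divMonic (xN-1 (suc n)) (properProd (suc n) (cycTable n) n)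

Monic-xN-1 : ∀ {n} → 0 ℕ.< n → Monic n (xN-1 n)
Monic-xN-1 {suc n} _ = monic (cong suc
    (trans (Listₚ.length-++ (replicate n (+ 0))) (trans (cong (ℕ._+ 1) (Listₚ.length-replicate n)) (ℕₚ.+-comm n 1))))
  (trans (cong (coeff (X n)) (sym (ℕₚ.+-identityʳ n))) (coeff-shift-+ n 𝟙 0))

-- Both facts pass through the induction together: monicity of the earlier `Φ d` makes their product
-- an admissible divisor in the next long division.
record Cyclotomic (n : ℕ) : Set where
  constructor cyclotomic
  field
    Φ-product : prod Φ (divisors n) ≈ xN-1 n
    {deg}     : ℕ
    isMonic   : Monic deg (Φ n)

open Cyclotomic

-- Comaximality, and divisibility up to a positive integer

record Ideal (p q f : Poly) : Set where
  constructor ideal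
  field
    {U V} : Poly
    comb  : f ≈ U ⊗ p ⊕ V ⊗ q

ideal-swap : ∀ {p q f} → Ideal p q f → Ideal q p f
ideal-swap (ideal e) = ideal (R.trans e (R.+-comm _ _))

ideal-multiple : ∀ {p q f g} W → Ideal p q f → g ≈ f ⊗ W → Ideal p q g
ideal-multiple {p} {q} W (ideal {U} {V} e) eq = ideal (R.trans eq (R.trans (R.*-congʳ e)
  (solve 5 (λ u p v q w → (u :* p :+ v :* q) :* w := (u :* w) :* p :+ (v :* w) :* q) R.refl U p V q W)))

ideal-first : ∀ {p q} W {f} → f ≈ p ⊗ W → Ideal p q f
ideal-first {p} {q} W eq = ideal {U = W} {V = []} (R.trans eq (R.trans (R.*-comm p W)
  (R.sym (R.trans (R.+-congˡ (R.zeroˡ q)) (R.+-identityʳ _)))))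

ideal-subtract : ∀ {p q f g h} → f ⊕ g ≈ h → Ideal p q g → Ideal p q h → Ideal p q f
ideal-subtract {p} {q} {f} {g} {h} eq (ideal {U} {V} e) (ideal {U′} {V′} e′) = ideal (begin
  f                            ≈⟨ R.+-identityʳ f ⟨
  f ⊕ []                       ≈⟨ R.+-congˡ (R.-‿inverseʳ g) ⟨
  f ⊕ (g ⊕ ⊝ g)                ≈⟨ R.+-assoc f g (⊝ g) ⟨
  (f ⊕ g) ⊕ ⊝ g                ≈⟨ R.+-cong (R.trans eq e′) (R.-‿cong e) ⟩
  (U′ ⊗ p ⊕ V′ ⊗ q) ⊕ ⊝ (U ⊗ p ⊕ V ⊗ q)       ≈⟨ R.+-congˡ (-‿+-comm (U ⊗ p) (V ⊗ q)) ⟨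
  (U′ ⊗ p ⊕ V′ ⊗ q) ⊕ (⊝ (U ⊗ p) ⊕ ⊝ (V ⊗ q)) ≈⟨ R.+-congˡ (R.+-cong (-‿distribˡ-* U p) (-‿distribˡ-* V q)) ⟩
  (U′ ⊗ p ⊕ V′ ⊗ q) ⊕ (⊝ U ⊗ p ⊕ ⊝ V ⊗ q)
    ≈⟨ solve 6 (λ u p v q w x → (u :* p :+ v :* q) :+ (w :* p :+ x :* q) := (u :+ w) :* p :+
        (v :+ x) :* q) R.refl U′ p V′ q (⊝ U) (⊝ V) ⟩
  (U′ ⊕ ⊝ U) ⊗ p ⊕ (V′ ⊕ ⊝ V) ⊗ q ∎)
  where
  open ≈-Reasoning

Φ∣xN-1 : ∀ {d} → 0 ℕ.< d → Cyclotomic d → ∃[ W ] xN-1 d ≈ Φ d ⊗ W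
Φ∣xN-1 d>0 C with prod-∈ Φ (∈-divisors⁺ d>0 ∣-refl)
... | W , eq = W , R.trans (R.sym (Φ-product C)) eq

-- If `g + u d = v e`, then `x^g - 1` is `(x^(ve) - 1) - x^g (x^(ud) - 1)`, a difference of
-- multiples of `x^e - 1` and `x^d - 1`.
ideal-xN-1 : ∀ {p q d e g} → 0 ℕ.< d → 0 ℕ.< e → 0 ℕ.< g → Ideal p q (xN-1 d) → Ideal p q (xN-1 e) → ∀ x y →
             g ℕ.+ x ℕ.* d ≡ y ℕ.* e → Ideal p q (xN-1 g)
ideal-xN-1 {p} {q} {d} {e} {g} d>0 e>0 g>0 Id Ie x y eq = ideal-subtract (+-cancelʳ 𝟙 _ _ (begin
  (xN-1 g ⊕ xN-1 d ⊗ (geo d x ⊗ X g)) ⊕ 𝟙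
    ≈⟨ solve 4 (λ a b c x → (a :+ b :* (c :* x)) :+ con 1 := (a :+ con 1) :+ b :* c :* x) R.refl (xN-1 g)
        (xN-1 d) (geo d x) (X g) ⟩
  (xN-1 g ⊕ 𝟙) ⊕ xN-1 d ⊗ geo d x ⊗ X g        ≈⟨ R.+-congʳ (xN-1⊕𝟙 g>0) ⟩
  X g ⊕ xN-1 d ⊗ geo d x ⊗ X g
    ≈⟨ solve 2 (λ x z → x :+ z :* x := x :* (z :+ con 1)) R.refl (X g) (xN-1 d ⊗ geo d x) ⟩
  X g ⊗ (xN-1 d ⊗ geo d x ⊕ 𝟙)                 ≈⟨ R.*-congˡ (xN-1⊗geo⊕𝟙 d>0 x) ⟩
  X g ⊗ X (x ℕ.* d)                            ≈⟨ X-+ g (x ℕ.* d) ⟨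
  X (g ℕ.+ x ℕ.* d)                            ≈⟨ R.reflexive (cong X eq) ⟩
  X (y ℕ.* e)                                  ≈⟨ xN-1⊗geo⊕𝟙 e>0 y ⟨
  xN-1 e ⊗ geo e y ⊕ 𝟙                         ∎))
  (ideal-multiple (geo d x ⊗ X g) Id R.refl) (ideal-multiple (geo e y) Ie R.refl)
  where open ≈-Reasoning

ideal-gcd : ∀ {p q d e} → 0 ℕ.< d → 0 ℕ.< e → Ideal p q (xN-1 d) → Ideal p q (xN-1 e) → Ideal p q (xN-1 (gcd d e))
ideal-gcd {d = d} {e} d>0 e>0 Id Ie with Bézout.identity (gcd-GCD d e)
... | Bézout.+- x y eq = ideal-xN-1 e>0 d>0 (∣-pos d>0 (gcd[m,n]∣m d e)) Ie Id y x eq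
... | Bézout.-+ x y eq = ideal-xN-1 d>0 e>0 (∣-pos d>0 (gcd[m,n]∣m d e)) Id Ie x y eq

divisors-∣ : ∀ {g d} → 0 ℕ.< d → g ∣ d → filter (_∣? g) (divisors d) ↭ divisors g
divisors-∣ {g} {d} d>0 g∣d = unique-↭ (Uniqueₚ.filter⁺ (_∣? g) (divisors-unique d d)) (divisors-unique g g)
  (λ x∈ → ∈-divisors⁺ (∣-pos d>0 g∣d) (proj₂ (∈-filter⁻ (_∣? g) {xs = divisors d} x∈)))
  (λ x∈ → let (_ , x∣g) = ∈-divisors⁻ x∈ in ∈-filter⁺ (_∣? g) (∈-divisors⁺ d>0 (∣-trans x∣g g∣d)) x∣g)

-- Modulo x^g - 1 the quotient (x^d - 1)/(x^g - 1), a multiple of Φ d, is the integer d/g.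
ideal-quotient : ∀ {d g q} → 0 ℕ.< d → g ∣ d → g ≢ d → Cyclotomic d → Cyclotomic g →
                 Ideal (Φ d) q (xN-1 g) → ∃[ k ] Ideal (Φ d) q [ + suc k ]
ideal-quotient d>0 (divides zero refl) _ _ _ _ = ⊥-elim (ℕₚ.<-irrefl refl d>0)
ideal-quotient {d} {g} {q} d>0 g∣d@(divides (suc k) refl) g≢d Cd Cg Ig =
  k , ideal-subtract (R.sym (proj₂ mod)) (ideal-multiple (proj₁ mod) Ig R.refl) (ideal-first H geo≈)
  where
  open ≈-Reasoning
  g>0 = ∣-pos d>0 g∣d
  mod = geo-mod g>0 (suc k)
  rest = filter (¬? ∘ (_∣? g)) (divisors d)
  d∈rest : d ∈ rest
  d∈rest = ∈-filter⁺ (¬? ∘ (_∣? g)) (∈-divisors⁺ d>0 ∣-refl) (λ d∣g → g≢d (∣-antisym g∣d d∣g))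
  H = proj₁ (prod-∈ Φ d∈rest)
  geo≈ : geo g (suc k) ≈ Φ d ⊗ H
  -- Cancelling `x^g - 1` from the factorisation of `x^d - 1` leaves the `Φ` of those divisors of
  -- `d` that do not divide `g`, among them `d` itself.
  geo≈ = ⊗-cancelˡ (Monic-xN-1 g>0) (begin
    xN-1 g ⊗ geo g (suc k)                                        ≈⟨ xN-1-geo g>0 (suc k) d>0 ⟨
    xN-1 d                                                        ≈⟨ Φ-product Cd ⟨
    prod Φ (divisors d)                                           ≈⟨ prod-filter Φ (_∣? g) (divisors d) ⟩
    prod Φ (filter (_∣? g) (divisors d)) ⊗ prod Φ rest
      ≈⟨ R.*-cong (R.trans (prod-↭ Φ (divisors-∣ d>0 g∣d)) (Φ-product Cg)) (proj₂ (prod-∈ Φ d∈rest)) ⟩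
    xN-1 g ⊗ (Φ d ⊗ H)                                            ∎)

-- The ideal contains `xN-1 (gcd d e)`. Since `d ≢ e`, the gcd is a proper divisor of one of the
-- two, and `ideal-quotient` applies on that side.
Φ-comaximal : ∀ {d e} → 0 ℕ.< d → 0 ℕ.< e → d ≢ e → Cyclotomic d → Cyclotomic e → Cyclotomic (gcd d e) →
              ∃[ k ] Ideal (Φ d) (Φ e) [ + suc k ]
Φ-comaximal {d} {e} d>0 e>0 d≢e Cd Ce Cg = case (gcd d e ℕₚ.≟ d)
  where
  Ig : Ideal (Φ d) (Φ e) (xN-1 (gcd d e))
  Ig = ideal-gcd d>0 e>0 (ideal-first _ (proj₂ (Φ∣xN-1 d>0 Cd))) (ideal-swap (ideal-first _ (proj₂ (Φ∣xN-1 e>0 Ce))))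
  case : Dec (gcd d e ≡ d) → ∃[ k ] Ideal (Φ d) (Φ e) [ + suc k ]
  case (no g≢d)  = ideal-quotient d>0 (gcd[m,n]∣m d e) g≢d Cd Cg Ig
  case (yes g≡d) = let (k , I) = ideal-quotient e>0 (gcd[m,n]∣n d e) (λ g≡e → d≢e (trans (sym g≡d) g≡e)) Ce Cg (ideal-swap Ig)
                   in k , ideal-swap I

infix 4 _∣⁺_
-- Divisibility with a denominator allowed, since comaximality over the integers can fail: `Φ 1` and
-- `Φ 2` generate 2 but not 1.
_∣⁺_ : Poly → Poly → Set
P ∣⁺ G = ∃[ k ] ∃[ W ] [ + suc k ] ⊗ G ≈ P ⊗ W

const-* : ∀ x y → [ x ] ⊗ [ y ] ≈ [ x * y ]
const-* x y = R.trans (R.sym (map-* x [ y ])) R.refl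

-- Euclid's lemma with denominators: multiply the relation `U P + V Q = suc k` by `suc l` and `G`.
-- The witness `l + k * suc l` is the predecessor of `suc k * suc l`.
∣⁺-comaximal : ∀ {P Q G} → ∃[ k ] Ideal P Q [ + suc k ] → P ∣⁺ Q ⊗ G → P ∣⁺ G
∣⁺-comaximal {P} {Q} {G} (k , ideal {U} {V} I) (l , W , eq) = l ℕ.+ k ℕ.* suc l , U ⊗ L ⊗ G ⊕ V ⊗ W , (begin
  [ + (suc k ℕ.* suc l) ] ⊗ G
    ≈⟨ R.*-congʳ (R.trans (R.reflexive (cong [_] (ℤₚ.pos-* (suc k) (suc l)))) (R.sym (const-* (+ suc k) (+ suc l)))) ⟩
  [ + suc k ] ⊗ L ⊗ G             ≈⟨ R.*-congʳ (R.*-congʳ I) ⟩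
  (U ⊗ P ⊕ V ⊗ Q) ⊗ L ⊗ G
    ≈⟨ solve 6 (λ u p v q l g → (u :* p :+ v :* q) :* l :* g := u :* p :* l :* g :+ v :*
        (l :* (q :* g))) R.refl U P V Q L G ⟩
  U ⊗ P ⊗ L ⊗ G ⊕ V ⊗ (L ⊗ (Q ⊗ G)) ≈⟨ R.+-congˡ (R.*-congˡ eq) ⟩
  U ⊗ P ⊗ L ⊗ G ⊕ V ⊗ (P ⊗ W)
    ≈⟨ solve 6 (λ u p v w l g → u :* p :* l :* g :+ v :* (p :* w) := p :* (u :* l :* g :+ v :* w)) R.refl U P V W L G ⟩
  P ⊗ (U ⊗ L ⊗ G ⊕ V ⊗ W)         ∎)
  where
  open ≈-Reasoning
  L = [ + suc l ]

∣⁺-prod : ∀ f {P G} es → (∀ {e} → e ∈ es → ∃[ k ] Ideal P (f e) [ + suc k ]) → P ∣⁺ prod f es ⊗ G → P ∣⁺ G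
∣⁺-prod f {P} {G} []       I (k , W , eq) = k , W , R.trans (R.*-congˡ (R.sym (R.*-identityˡ G))) eq
∣⁺-prod f {P} {G} (e ∷ es) I (k , W , eq) = ∣⁺-prod f es (I ∘ there)
  (∣⁺-comaximal (I (here refl)) (k , W , R.trans (R.*-congˡ (R.sym (R.*-assoc (f e) (prod f es) G))) eq))

-- If `prod f es ⊗ B` is an integer multiple of `F`, then `f e` divides it; being comaximal to every
-- factor of `prod f es`, it divides `B` up to an integer.
prod-∣⁺ : ∀ f {F} es → Unique es → (∀ {d e} → d ∈ es → e ∈ es → d ≢ e → ∃[ k ] Ideal (f d) (f e) [ + suc k ]) →
          (∀ {e} → e ∈ es → ∃[ W ] F ≈ f e ⊗ W) → prod f es ∣⁺ F
prod-∣⁺ f {F} [] _ _ _ = 0 , F , R.refl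
prod-∣⁺ f {F} (e ∷ es) (e∉es ∷ u) com div
  with prod-∣⁺ f es u (λ d∈ e∈ → com (there d∈) (there e∈)) (div ∘ there) | div (here refl)
... | k , B , eqB | A , eqA
  with ∣⁺-prod f {f e} {B} es (λ e′∈ → com (here refl) (there e′∈) (All.lookup e∉es e′∈))
         (0 , [ + suc k ] ⊗ A , (begin
           𝟙 ⊗ (prod f es ⊗ B)       ≈⟨ R.*-identityˡ _ ⟩
           prod f es ⊗ B             ≈⟨ eqB ⟨
           [ + suc k ] ⊗ F           ≈⟨ R.*-congˡ eqA ⟩
           [ + suc k ] ⊗ (f e ⊗ A)   ≈⟨ solve 3 (λ a b c → a :* (b :* c) := b :* (a :* c)) R.refl [ + suc k ] (f e) A ⟩
           f e ⊗ ([ + suc k ] ⊗ A)   ∎))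
  where open ≈-Reasoning
... | l , W , eqW = k ℕ.+ l ℕ.* suc k , W , (begin
  [ + (suc l ℕ.* suc k) ] ⊗ F
    ≈⟨ R.*-congʳ (R.trans (R.reflexive (cong [_] (ℤₚ.pos-* (suc l) (suc k)))) (R.sym (const-* (+ suc l) (+ suc k)))) ⟩
  [ + suc l ] ⊗ [ + suc k ] ⊗ F     ≈⟨ R.*-assoc _ _ F ⟩
  [ + suc l ] ⊗ ([ + suc k ] ⊗ F)   ≈⟨ R.*-congˡ eqB ⟩
  [ + suc l ] ⊗ (prod f es ⊗ B)
    ≈⟨ solve 3 (λ a b c → a :* (b :* c) := b :* (a :* c)) R.refl [ + suc l ] (prod f es) B ⟩
  prod f es ⊗ ([ + suc l ] ⊗ B)     ≈⟨ R.*-congˡ eqW ⟩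
  prod f es ⊗ (f e ⊗ W)             ≈⟨ solve 3 (λ a b c → a :* (b :* c) := b :* a :* c) R.refl (prod f es) (f e) W ⟩
  f e ⊗ prod f es ⊗ W               ∎)
  where open ≈-Reasoning

Monic-prod : ∀ f es → (∀ {e} → e ∈ es → ∃[ n ] Monic n (f e)) → ∃[ n ] Monic n (prod f es)
Monic-prod f []       _ = 0 , monic refl refl
Monic-prod f (e ∷ es) m = let (_ , m₁) = m (here refl) ; (_ , m₂) = Monic-prod f es (m ∘ there) in _ , Monic-⊗ m₁ m₂

Φ-step : ∀ n → (∀ {m} → 0 ℕ.< m → m ℕ.≤ n → Cyclotomic m) → Cyclotomic (suc n)
Φ-step n IH = cyclotomic product′ (subst (Monic (suc n ℕ.∸ m)) (sym (Φ-suc n)) (Monic-divMonic mF mD m≤N))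
  where
  open ≈-Reasoning
  N = suc n
  es = divisorsUpTo N n
  D = prod Φ es
  F = xN-1 N
  mF : Monic N F
  mF = Monic-xN-1 (s≤s z≤n)
  IH′ : ∀ {e} → e ∈ es → Cyclotomic e
  IH′ e∈ = let (e>0 , e≤n , _) = ∈-divisorsUpTo⁻ {N} {n} e∈ in IH e>0 e≤n
  mD′ = Monic-prod Φ es (λ e∈ → _ , isMonic (IH′ e∈))
  m = proj₁ mD′
  mD : Monic m D
  mD = proj₂ mD′
  com : ∀ {d e} → d ∈ es → e ∈ es → d ≢ e → ∃[ k ] Ideal (Φ d) (Φ e) [ + suc k ]
  com {d} {e} d∈ e∈ d≢e = Φ-comaximal d>0 (proj₁ (∈-divisorsUpTo⁻ {N} {n} e∈)) d≢e (IH′ d∈) (IH′ e∈)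
      (IH (∣-pos d>0 g∣d) (ℕₚ.≤-trans (∣⇒≤ {{ℕ.>-nonZero d>0}} g∣d) d≤n))
    where
    d>0 = proj₁ (∈-divisorsUpTo⁻ {N} {n} d∈)
    d≤n = proj₁ (proj₂ (∈-divisorsUpTo⁻ {N} {n} d∈))
    g∣d = gcd[m,n]∣m d e
  div : ∀ {e} → e ∈ es → ∃[ W ] F ≈ Φ e ⊗ W
  div {e} e∈ with ∈-divisorsUpTo⁻ {N} {n} e∈
  ... | e>0 , e≤n , divides k N≡ with Φ∣xN-1 e>0 (IH e>0 e≤n)
  ... | W , eq = W ⊗ geo e k , (begin
    xN-1 N              ≈⟨ R.reflexive (cong xN-1 N≡) ⟩
    xN-1 (k ℕ.* e)      ≈⟨ xN-1-geo e>0 k (subst (0 ℕ.<_) N≡ (s≤s z≤n)) ⟩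
    xN-1 e ⊗ geo e k    ≈⟨ R.*-congʳ eq ⟩
    Φ e ⊗ W ⊗ geo e k   ≈⟨ R.*-assoc _ _ _ ⟩
    Φ e ⊗ (W ⊗ geo e k) ∎)
  D∣⁺F = prod-∣⁺ Φ es (divisors-unique N n) com div
  exact : F ≈ divMonic F D ⊗ D
  exact = divMonic-exact F mD (proj₁ D∣⁺F) (proj₁ (proj₂ D∣⁺F)) (proj₂ (proj₂ D∣⁺F))
  product′ : prod Φ (divisors N) ≈ F
  product′ = begin
    prod Φ (divisors N)   ≈⟨ R.reflexive (cong (prod Φ) (divisors-suc n)) ⟩
    Φ N ⊗ D               ≈⟨ R.*-congʳ (R.reflexive (Φ-suc n)) ⟩
    divMonic F D ⊗ D      ≈⟨ exact ⟨
    F                     ∎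
  F≉0 : ¬ F ≈ []
  F≉0 eq with trans (sym (≈⇒coeff eq N)) (top mF)
  ... | ()
  -- Were the degree of `D` larger than `N`, the multiple `F` of `D` would be zero.
  m≤N : m ℕ.≤ N
  m≤N = ℕₚ.≮⇒≥ λ N<m → F≉0 (small-multiple mD (divMonic F D) F
          (λ i m≤i → vanish mF i (ℕₚ.<-≤-trans N<m m≤i)) (R.trans exact (R.*-comm _ D)))

abstract
  Φ-cyclotomic : ∀ {n} → 0 ℕ.< n → Cyclotomic n
  Φ-cyclotomic {n} = <-rec (λ n → 0 ℕ.< n → Cyclotomic n) step n
    where
    step : ∀ n → (∀ {m} → m ℕ.< n → 0 ℕ.< m → Cyclotomic m) → 0 ℕ.< n → Cyclotomic n
    step (suc n) IH _ = Φ-step n (λ m>0 m≤n → IH (s≤s m≤n) m>0)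

-- Substituting x^p

const-zero : [ + 0 ] ≈ []
const-zero = coeff⇒≈ λ { zero → refl ; (suc _) → refl }

∷-split : ∀ x f → x ∷ f ≈ [ x ] ⊕ (+ 0 ∷ f)
∷-split x f = R.trans (∷-cong (sym (ℤₚ.+-identityʳ x)) (R.sym (R.+-identityˡ f))) (∷-⊕ x (+ 0) [] f)

-- The substitution `f(x^p)`, by Horner's scheme.
expand : ℕ → Poly → Poly
expand p []      = []
expand p (x ∷ f) = [ x ] ⊕ X p ⊗ expand p f

module _ (p : ℕ) where

  expand-zero : ∀ f → f ≈ [] → expand p f ≈ []
  expand-zero []      _  = R.refl
  expand-zero (x ∷ f) eq = R.trans
    (R.+-cong (R.trans (∷-cong (≈⇒coeff eq 0) R.refl) const-zero)
              (R.trans (R.*-congˡ (expand-zero f (coeff⇒≈ λ i → ≈⇒coeff eq (suc i)))) (R.zeroʳ (X p))))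
    (R.+-identityʳ [])

  expand-cong : ∀ {f g} → f ≈ g → expand p f ≈ expand p g
  expand-cong {[]}    {g}     eq = R.sym (expand-zero g (R.sym eq))
  expand-cong {x ∷ f} {[]}    eq = expand-zero (x ∷ f) eq
  expand-cong {x ∷ f} {y ∷ g} eq = R.+-cong (∷-cong (≈⇒coeff eq 0) R.refl)
    (R.*-congˡ (expand-cong {f} {g} (coeff⇒≈ λ i → ≈⇒coeff eq (suc i))))

  expand-⊕ : ∀ f g → expand p (f ⊕ g) ≈ expand p f ⊕ expand p g
  expand-⊕ []      g       = R.trans (expand-cong (R.+-identityˡ g)) (R.sym (R.+-identityˡ _))
  expand-⊕ (x ∷ f) []      = R.trans (expand-cong (R.+-identityʳ (x ∷ f))) (R.sym (R.+-identityʳ _))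
  expand-⊕ (x ∷ f) (y ∷ g) = begin
    expand p ((x ∷ f) ⊕ (y ∷ g))                                 ≈⟨ expand-cong (∷-⊕ x y f g) ⟨
    [ x + y ] ⊕ X p ⊗ expand p (f ⊕ g)                           ≈⟨ R.+-cong (const-+ x y) (R.*-congˡ (expand-⊕ f g)) ⟩
    ([ x ] ⊕ [ y ]) ⊕ X p ⊗ (expand p f ⊕ expand p g)
      ≈⟨ solve 5 (λ a b x f g → (a :+ b) :+ x :* (f :+ g) := (a :+ x :* f) :+
          (b :+ x :* g)) R.refl [ x ] [ y ] (X p) (expand p f) (expand p g) ⟩
    expand p (x ∷ f) ⊕ expand p (y ∷ g)                          ∎
    where open ≈-Reasoning

  expand-const* : ∀ x g → expand p ([ x ] ⊗ g) ≈ [ x ] ⊗ expand p g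
  expand-const* x g = R.trans (expand-cong (R.sym (map-* x g))) (go g)
    where
    go : ∀ g → expand p (map (x *_) g) ≈ [ x ] ⊗ expand p g
    go []      = R.sym (R.zeroʳ [ x ])
    go (y ∷ g) = R.trans (R.+-cong (R.sym (const-* x y)) (R.*-congˡ (go g)))
      (solve 4 (λ a b x g → a :* b :+ x :* (a :* g) := a :* (b :+ x :* g)) R.refl [ x ] [ y ] (X p) (expand p g))

  expand-0∷ : ∀ f → expand p (+ 0 ∷ f) ≈ X p ⊗ expand p f
  expand-0∷ f = R.trans (R.+-congʳ const-zero) (R.+-identityˡ _)

  expand-⊗ : ∀ f g → expand p (f ⊗ g) ≈ expand p f ⊗ expand p g
  expand-⊗ []      g = R.trans (expand-cong (R.zeroˡ g)) (R.sym (R.zeroˡ _))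
  expand-⊗ (x ∷ f) g = begin
    expand p ((x ∷ f) ⊗ g)                       ≈⟨ expand-cong (R.*-congʳ (∷-split x f)) ⟩
    expand p (([ x ] ⊕ (+ 0 ∷ f)) ⊗ g)
      ≈⟨ expand-cong (R.trans (R.distribʳ g [ x ] (+ 0 ∷ f)) (R.+-congˡ (0∷-⊗ f g))) ⟩
    expand p ([ x ] ⊗ g ⊕ (+ 0 ∷ f ⊗ g))         ≈⟨ expand-⊕ ([ x ] ⊗ g) (+ 0 ∷ f ⊗ g) ⟩
    expand p ([ x ] ⊗ g) ⊕ expand p (+ 0 ∷ f ⊗ g)
      ≈⟨ R.+-cong (expand-const* x g) (R.trans (expand-0∷ (f ⊗ g)) (R.*-congˡ (expand-⊗ f g))) ⟩
    [ x ] ⊗ G ⊕ X p ⊗ (expand p f ⊗ G)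
      ≈⟨ solve 4 (λ a x f g → a :* g :+ x :* (f :* g) := (a :+ x :* f) :* g) R.refl [ x ] (X p) (expand p f) G ⟩
    expand p (x ∷ f) ⊗ expand p g                ∎
    where
    open ≈-Reasoning
    G = expand p g

  expand-const : ∀ x → expand p [ x ] ≈ [ x ]
  expand-const x = R.trans (R.+-congˡ (R.zeroʳ (X p))) (R.+-identityʳ [ x ])

  expand-X : ∀ n → expand p (X n) ≈ X (n ℕ.* p)
  expand-X zero    = expand-const (+ 1)
  expand-X (suc n) = R.trans (expand-0∷ (X n)) (R.trans (R.*-congˡ (expand-X n)) (R.sym (X-+ p (n ℕ.* p))))

  expand-xN-1 : ∀ {n} → 0 ℕ.< n → 0 ℕ.< n ℕ.* p → expand p (xN-1 n) ≈ xN-1 (n ℕ.* p)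
  expand-xN-1 {n} n>0 np>0 = +-cancelʳ 𝟙 _ _ (begin
    expand p (xN-1 n) ⊕ 𝟙          ≈⟨ R.+-congˡ (expand-const (+ 1)) ⟨
    expand p (xN-1 n) ⊕ expand p 𝟙 ≈⟨ expand-⊕ (xN-1 n) 𝟙 ⟨
    expand p (xN-1 n ⊕ 𝟙)          ≈⟨ expand-cong (xN-1⊕𝟙 n>0) ⟩
    expand p (X n)                 ≈⟨ expand-X n ⟩
    X (n ℕ.* p)                    ≈⟨ xN-1⊕𝟙 np>0 ⟨
    xN-1 (n ℕ.* p) ⊕ 𝟙             ∎)
    where open ≈-Reasoning

  expand-prod : ∀ f ds → expand p (prod f ds) ≈ prod (expand p ∘ f) ds
  expand-prod f []       = expand-const (+ 1)
  expand-prod f (d ∷ ds) = R.trans (expand-⊗ (f d) (prod f ds)) (R.*-congˡ (expand-prod f ds))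

  coeff-expand : 0 ℕ.< p → ∀ f k → coeff (expand p f) (k ℕ.* p) ≡ coeff f k
  coeff-expand p>0 []      k       = refl
  coeff-expand p>0 (x ∷ f) zero    = begin
    coeff (expand p (x ∷ f)) 0                   ≡⟨ coeff-⊕ [ x ] _ 0 ⟩
    x + coeff (X p ⊗ expand p f) 0
      ≡⟨ +-congˡ x (trans (≈⇒coeff (X⊗ p (expand p f)) 0) (coeff-shift-< p _ p>0)) ⟩
    x + + 0                                      ≡⟨ ℤₚ.+-identityʳ x ⟩
    x                                            ∎
    where open ≡-Reasoning
  coeff-expand p>0 (x ∷ f) (suc k) = begin
    coeff (expand p (x ∷ f)) n                   ≡⟨ coeff-⊕ [ x ] _ n ⟩
    coeff [ x ] n + coeff (X p ⊗ expand p f) n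
      ≡⟨ cong₂ _+_ (coeff-≥length [ x ] (ℕₚ.m≤n⇒m≤n+o (k ℕ.* p) p>0)) (≈⇒coeff (X⊗ p (expand p f)) n) ⟩
    + 0 + coeff (shift p (expand p f)) n         ≡⟨ ℤₚ.+-identityˡ _ ⟩
    coeff (shift p (expand p f)) n               ≡⟨ coeff-shift-+ p (expand p f) (k ℕ.* p) ⟩
    coeff (expand p f) (k ℕ.* p)                 ≡⟨ coeff-expand p>0 f k ⟩
    coeff f k                                    ∎
    where
    open ≡-Reasoning
    n = p ℕ.+ k ℕ.* p

expand-expand : ∀ p q f → expand p (expand q f) ≈ expand (q ℕ.* p) f
expand-expand p q []      = R.refl
expand-expand p q (x ∷ f) = begin
  expand p ([ x ] ⊕ X q ⊗ expand q f)                  ≈⟨ expand-⊕ p [ x ] _ ⟩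
  expand p [ x ] ⊕ expand p (X q ⊗ expand q f)         ≈⟨ R.+-cong (expand-const p x) (expand-⊗ p (X q) (expand q f)) ⟩
  [ x ] ⊕ expand p (X q) ⊗ expand p (expand q f)       ≈⟨ R.+-congˡ (R.*-cong (expand-X p q) (expand-expand p q f)) ⟩
  [ x ] ⊕ X (q ℕ.* p) ⊗ expand (q ℕ.* p) f             ∎
  where open ≈-Reasoning

expand-1 : ∀ f → expand 1 f ≈ f
expand-1 []      = R.refl
expand-1 (x ∷ f) = R.trans (R.+-congˡ (R.trans (X⊗ 1 (expand 1 f)) (∷-cong refl (expand-1 f)))) (R.sym (∷-split x f))

prod-++ : ∀ f xs ys → prod f (xs ++ ys) ≈ prod f xs ⊗ prod f ys
prod-++ f []       ys = R.sym (R.*-identityˡ _)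
prod-++ f (x ∷ xs) ys = R.trans (R.*-congˡ (prod-++ f xs ys)) (R.sym (R.*-assoc (f x) (prod f xs) (prod f ys)))

prod-map : ∀ f (h : ℕ → ℕ) xs → prod f (map h xs) ≡ prod (f ∘ h) xs
prod-map f h []       = refl
prod-map f h (x ∷ xs) = cong (f (h x) ⊗_) (prod-map f h xs)

prod-⊗ : ∀ f g xs → prod (λ x → f x ⊗ g x) xs ≈ prod f xs ⊗ prod g xs
prod-⊗ f g []       = R.sym (R.*-identityˡ 𝟙)
prod-⊗ f g (x ∷ xs) = R.trans (R.*-congˡ (prod-⊗ f g xs))
  (solve 4 (λ a b c d → (a :* b) :* (c :* d) := (a :* c) :* (b :* d)) R.refl (f x) (g x) (prod f xs) (prod g xs))

-- Cyclotomic polynomials of `M p` for a prime `p`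

module _ {p : ℕ} (p-prime : Prime p) where

  private instance
    p≢0 : NonZero p
    p≢0 = prime⇒nonZero p-prime

  prime>0 : 0 ℕ.< p
  prime>0 = ℕ.>-nonZero⁻¹ p

  prime>1 : 1 ℕ.< p
  prime>1 = ℕ.nonTrivial⇒n>1 p {{prime⇒nonTrivial p-prime}}

  ∤⇒coprime : ∀ {d} → ¬ p ∣ d → Coprime d p
  ∤⇒coprime p∤d (x∣d , x∣p) with prime⇒irreducible p-prime x∣p
  ... | inj₁ x≡1  = x≡1
  ... | inj₂ refl = ⊥-elim (p∤d x∣d)

  private
    *p>0 : ∀ {M} → 0 ℕ.< M → 0 ℕ.< M ℕ.* p
    *p>0 M>0 = ℕₚ.*-mono-≤ M>0 prime>0

    ∣*p⇒∣ : ∀ {d M} → ¬ p ∣ d → d ∣ M ℕ.* p → d ∣ M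
    ∣*p⇒∣ {d} {M} p∤d d∣Mp = coprime-divisor (∤⇒coprime p∤d) (subst (d ∣_) (ℕₚ.*-comm M p) d∣Mp)

    ∣⇒*p∣ : ∀ {d M} → ¬ p ∣ d → d ∣ M → p ∣ M → d ℕ.* p ∣ M
    ∣⇒*p∣ {d} {M} p∤d (divides k refl) p∣M with euclidsLemma k d p-prime p∣M
    ... | inj₂ p∣d = ⊥-elim (p∤d p∣d)
    ... | inj₁ (divides j refl) = divides j (trans (ℕₚ.*-assoc j p d) (cong (j ℕ.*_) (ℕₚ.*-comm p d)))

    -- Both products are `x^(Mp) - 1`.
    expand-Φ-product : ∀ {M} → 0 ℕ.< M → prod Φ (divisors (M ℕ.* p)) ≈ prod (expand p ∘ Φ) (divisors M)
    expand-Φ-product {M} M>0 = begin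
      prod Φ (divisors (M ℕ.* p))       ≈⟨ Φ-product (Φ-cyclotomic (*p>0 M>0)) ⟩
      xN-1 (M ℕ.* p)                    ≈⟨ expand-xN-1 p M>0 (*p>0 M>0) ⟨
      expand p (xN-1 M)                 ≈⟨ expand-cong p (Φ-product (Φ-cyclotomic M>0)) ⟨
      expand p (prod Φ (divisors M))    ≈⟨ expand-prod p Φ (divisors M) ⟩
      prod (expand p ∘ Φ) (divisors M)  ∎
      where open ≈-Reasoning

    Monic-Φ : ∀ {n} → 0 ℕ.< n → ∃[ m ] Monic m (Φ n)
    Monic-Φ n>0 = _ , isMonic (Φ-cyclotomic n>0)

    divisors-∤ : ∀ {M} → 0 ℕ.< M → ¬ p ∣ M → divisors (M ℕ.* p) ↭ map (ℕ._* p) (divisors M) ++ divisors M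
    divisors-∤ {M} M>0 p∤M = unique-↭ (divisors-unique _ _)
      (Uniqueₚ.++⁺ (Uniqueₚ.map⁺ (ℕₚ.*-cancelʳ-≡ _ _ p) (divisors-unique M M)) (divisors-unique M M) disjoint) to from
      where
      disjoint : ∀ {d} → ¬ (d ∈ map (ℕ._* p) (divisors M) × d ∈ divisors M)
      disjoint (d∈₁ , d∈₂) with ∈-map⁻ (ℕ._* p) d∈₁
      ... | e , _ , refl = p∤M (∣-trans (n∣m*n e) (proj₂ (∈-divisors⁻ d∈₂)))
      to : ∀ {d} → d ∈ divisors (M ℕ.* p) → d ∈ map (ℕ._* p) (divisors M) ++ divisors M
      to {d} d∈ with ∈-divisors⁻ d∈ | p ∣? d
      ... | d>0 , d∣Mp | yes (divides e refl) = ∈-++⁺ˡ (∈-map⁺ (ℕ._* p) (∈-divisors⁺ {d = e} M>0 (*-cancelʳ-∣ p d∣Mp)))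
      ... | d>0 , d∣Mp | no p∤d               = ∈-++⁺ʳ _ (∈-divisors⁺ M>0 (∣*p⇒∣ p∤d d∣Mp))
      from : ∀ {d} → d ∈ map (ℕ._* p) (divisors M) ++ divisors M → d ∈ divisors (M ℕ.* p)
      from d∈ with ∈-++⁻ (map (ℕ._* p) (divisors M)) d∈
      ... | inj₂ d∈₂ = ∈-divisors⁺ (*p>0 M>0) (∣-trans (proj₂ (∈-divisors⁻ d∈₂)) (m∣m*n p))
      ... | inj₁ d∈₁ with ∈-map⁻ (ℕ._* p) d∈₁
      ... | e , e∈ , refl = ∈-divisors⁺ (*p>0 M>0) (*-monoˡ-∣ p (proj₂ (∈-divisors⁻ e∈)))

  -- Strong induction: the divisors of `M p` are those of `M` and their multiples by `p`, so by
  -- `expand-Φ-product` both sides have the same product over all divisors of `M`. They agree at the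
  -- proper divisors, which cancel.
  Φ-*-∤ : ∀ {M} → 0 ℕ.< M → ¬ p ∣ M → Φ (M ℕ.* p) ⊗ Φ M ≈ expand p (Φ M)
  Φ-*-∤ {N} = <-rec (λ M → 0 ℕ.< M → ¬ p ∣ M → Φ (M ℕ.* p) ⊗ Φ M ≈ expand p (Φ M)) step N
    where
    h : ℕ → Poly
    h d = Φ (d ℕ.* p) ⊗ Φ d
    step : ∀ M → (∀ {d} → d ℕ.< M → 0 ℕ.< d → ¬ p ∣ d → h d ≈ expand p (Φ d)) → 0 ℕ.< M → ¬ p ∣ M → h M ≈ expand p (Φ M)
    step (suc n) IH M>0 p∤M = ⊗-cancelˡ (proj₂ mono) (begin
      prod h es ⊗ h M                     ≈⟨ R.*-comm _ _ ⟩
      prod h (M ∷ es)                     ≈⟨ R.reflexive (cong (prod h) (divisors-suc n)) ⟨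
      prod h (divisors M)                 ≈⟨ prod-⊗ (Φ ∘ (ℕ._* p)) Φ (divisors M) ⟩
      prod (Φ ∘ (ℕ._* p)) (divisors M) ⊗ prod Φ (divisors M)
        ≈⟨ R.*-congʳ (R.reflexive (prod-map Φ (ℕ._* p) (divisors M))) ⟨
      prod Φ (map (ℕ._* p) (divisors M)) ⊗ prod Φ (divisors M) ≈⟨ prod-++ Φ (map (ℕ._* p) (divisors M)) (divisors M) ⟨
      prod Φ (map (ℕ._* p) (divisors M) ++ divisors M)         ≈⟨ prod-↭ Φ (divisors-∤ M>0 p∤M) ⟨
      prod Φ (divisors (M ℕ.* p))         ≈⟨ expand-Φ-product M>0 ⟩
      prod (expand p ∘ Φ) (divisors M)    ≈⟨ R.reflexive (cong (prod (expand p ∘ Φ)) (divisors-suc n)) ⟩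
      expand p (Φ M) ⊗ prod (expand p ∘ Φ) es ≈⟨ R.*-comm _ _ ⟩
      prod (expand p ∘ Φ) es ⊗ expand p (Φ M) ≈⟨ R.*-congʳ (prod-cong es eq) ⟨
      prod h es ⊗ expand p (Φ M)          ∎)
      where
      open ≈-Reasoning
      M = suc n
      es = divisorsUpTo M n
      bounds : ∀ {d} → d ∈ es → 0 ℕ.< d × d ℕ.≤ n × d ∣ M
      bounds = ∈-divisorsUpTo⁻ {M} {n}
      eq : ∀ {d} → d ∈ es → h d ≈ expand p (Φ d)
      eq d∈ = let (d>0 , d≤n , d∣M) = bounds d∈ in IH (s≤s d≤n) d>0 (λ p∣d → p∤M (∣-trans p∣d d∣M))
      mono : ∃[ m ] Monic m (prod h es)
      mono = Monic-prod h es λ d∈ → let (d>0 , _) = bounds d∈ in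
        _ , Monic-⊗ (proj₂ (Monic-Φ (*p>0 d>0))) (proj₂ (Monic-Φ d>0))

  -- The divisors of `M p` are those of `M` together with `d p` for `d` in `T`. In
  -- `expand-Φ-product` the former contribute `x^M - 1`, and so do, on the other side, the divisors
  -- of `M / p`. Cancelling leaves an equality of products over `T`, to which strong induction
  -- applies.
  Φ-*-∣ : ∀ {M} → 0 ℕ.< M → p ∣ M → Φ (M ℕ.* p) ≈ expand p (Φ M)
  Φ-*-∣ {N} = <-rec (λ M → 0 ℕ.< M → p ∣ M → Φ (M ℕ.* p) ≈ expand p (Φ M)) step N
    where
    h : ℕ → Poly
    h d = Φ (d ℕ.* p)
    step : ∀ M → (∀ {d} → d ℕ.< M → 0 ℕ.< d → p ∣ d → h d ≈ expand p (Φ d)) → 0 ℕ.< M → p ∣ M → h M ≈ expand p (Φ M)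
    step (suc n) IH M>0 p∣M@(divides M′ M≡) = ⊗-cancelˡ (proj₂ mono) (begin
      prod h T′ ⊗ h M                ≈⟨ R.*-comm _ _ ⟩
      prod h (M ∷ T′)                ≈⟨ R.reflexive (cong (prod h) T≡) ⟨
      prod h T                       ≈⟨ ⊗-cancelˡ (Monic-xN-1 M>0) cancelled ⟩
      prod (expand p ∘ Φ) T          ≈⟨ R.reflexive (cong (prod (expand p ∘ Φ)) T≡) ⟩
      prod (expand p ∘ Φ) (M ∷ T′)   ≈⟨ R.*-comm _ _ ⟩
      prod (expand p ∘ Φ) T′ ⊗ expand p (Φ M) ≈⟨ R.*-congʳ (prod-cong T′ eq) ⟨
      prod h T′ ⊗ expand p (Φ M)     ∎)
      where
      open ≈-Reasoning
      M = suc n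
      low? : ∀ d → Dec (d ℕ.* p ∣ M)
      low? d = d ℕ.* p ∣? M
      high? : ∀ d → Dec (¬ d ℕ.* p ∣ M)
      high? = ¬? ∘ low?
      -- The divisors of `M` containing the full power of `p` in `M`; in particular `p` divides each
      -- of them.
      T  = filter high? (divisors M)
      T′ = filter high? (divisorsUpTo M n)
      M∈T : ¬ M ℕ.* p ∣ M
      M∈T Mp∣M = ℕₚ.<-irrefl refl (ℕₚ.<-≤-trans (ℕₚ.m<m*n M p prime>1) (∣⇒≤ Mp∣M))
      T≡ : T ≡ M ∷ T′
      T≡ = trans (cong (filter high?) (divisors-suc n)) (Listₚ.filter-accept high? M∈T)
      T⊆ : ∀ {d} → d ∈ T′ → 0 ℕ.< d × d ℕ.≤ n × p ∣ d
      T⊆ {d} d∈ with ∈-filter⁻ high? {xs = divisorsUpTo M n} d∈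
      ... | d∈′ , dp∤M with ∈-divisorsUpTo⁻ {M} {n} d∈′
      ... | d>0 , d≤n , d∣M = d>0 , d≤n , decidable-stable (p ∣? d) (λ p∤d → dp∤M (∣⇒*p∣ p∤d d∣M p∣M))
      eq : ∀ {d} → d ∈ T′ → h d ≈ expand p (Φ d)
      eq d∈ = let (d>0 , d≤n , p∣d) = T⊆ d∈ in IH (s≤s d≤n) d>0 p∣d
      mono : ∃[ m ] Monic m (prod h T′)
      mono = Monic-prod h T′ λ d∈ → Monic-Φ (*p>0 (proj₁ (T⊆ d∈)))
      M′>0 : 0 ℕ.< M′
      M′>0 = ∣-pos M>0 (divides p (trans M≡ (ℕₚ.*-comm M′ p)))
      low-perm : filter low? (divisors M) ↭ divisors M′
      low-perm = unique-↭ (Uniqueₚ.filter⁺ low? (divisors-unique M M)) (divisors-unique M′ M′)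
        (λ {d} d∈ → ∈-divisors⁺ M′>0 (*-cancelʳ-∣ p
            (subst (d ℕ.* p ∣_) M≡ (proj₂ (∈-filter⁻ low? {xs = divisors M} d∈)))))
        (λ {d} d∈ → let (_ , d∣M′) = ∈-divisors⁻ d∈ ; dp∣M = subst (d ℕ.* p ∣_) (sym M≡) (*-monoˡ-∣ p d∣M′)
                in ∈-filter⁺ low? (∈-divisors⁺ M>0 (∣-trans (m∣m*n p) dp∣M)) dp∣M)
      divisors-perm : divisors (M ℕ.* p) ↭ divisors M ++ map (ℕ._* p) T
      divisors-perm = unique-↭ (divisors-unique _ _)
        (Uniqueₚ.++⁺ (divisors-unique M M)
            (Uniqueₚ.map⁺ (ℕₚ.*-cancelʳ-≡ _ _ p) (Uniqueₚ.filter⁺ high? (divisors-unique M M))) disjoint) to from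
        where
        T⁻ : ∀ {d} → d ∈ T → d ∈ divisors M × ¬ d ℕ.* p ∣ M
        T⁻ = ∈-filter⁻ high? {xs = divisors M}
        disjoint : ∀ {d} → ¬ (d ∈ divisors M × d ∈ map (ℕ._* p) T)
        disjoint (d∈₁ , d∈₂) with ∈-map⁻ (ℕ._* p) d∈₂
        ... | e , e∈ , refl = proj₂ (T⁻ e∈) (proj₂ (∈-divisors⁻ d∈₁))
        to : ∀ {d} → d ∈ divisors (M ℕ.* p) → d ∈ divisors M ++ map (ℕ._* p) T
        to {d} d∈ with ∈-divisors⁻ d∈ | d ∣? M
        ... | d>0 , d∣Mp | yes d∣M = ∈-++⁺ˡ (∈-divisors⁺ M>0 d∣M)
        ... | d>0 , d∣Mp | no d∤M with p ∣? d
        ... | no p∤d = ⊥-elim (d∤M (∣*p⇒∣ p∤d d∣Mp))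
        ... | yes (divides e refl) = ∈-++⁺ʳ _
            (∈-map⁺ (ℕ._* p) (∈-filter⁺ high? (∈-divisors⁺ {d = e} M>0 (*-cancelʳ-∣ p d∣Mp)) d∤M))
        from : ∀ {d} → d ∈ divisors M ++ map (ℕ._* p) T → d ∈ divisors (M ℕ.* p)
        from d∈ with ∈-++⁻ (divisors M) d∈
        ... | inj₁ d∈₁ = ∈-divisors⁺ (*p>0 M>0) (∣-trans (proj₂ (∈-divisors⁻ d∈₁)) (m∣m*n p))
        ... | inj₂ d∈₂ with ∈-map⁻ (ℕ._* p) d∈₂
        ... | e , e∈ , refl = ∈-divisors⁺ (*p>0 M>0) (*-monoˡ-∣ p (proj₂ (∈-divisors⁻ (proj₁ (T⁻ e∈)))))
      low-product : prod (expand p ∘ Φ) (filter low? (divisors M)) ≈ xN-1 M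
      low-product = begin
        prod (expand p ∘ Φ) (filter low? (divisors M)) ≈⟨ prod-↭ (expand p ∘ Φ) low-perm ⟩
        prod (expand p ∘ Φ) (divisors M′)              ≈⟨ expand-Φ-product M′>0 ⟨
        prod Φ (divisors (M′ ℕ.* p))                   ≈⟨ R.reflexive (cong (prod Φ ∘ divisors) M≡) ⟨
        prod Φ (divisors M)                            ≈⟨ Φ-product (Φ-cyclotomic M>0) ⟩
        xN-1 M                                         ∎
      cancelled : xN-1 M ⊗ prod h T ≈ xN-1 M ⊗ prod (expand p ∘ Φ) T
      cancelled = begin
        xN-1 M ⊗ prod h T
          ≈⟨ R.*-cong (Φ-product (Φ-cyclotomic M>0)) (R.reflexive (prod-map Φ (ℕ._* p) T)) ⟨
        prod Φ (divisors M) ⊗ prod Φ (map (ℕ._* p) T) ≈⟨ prod-++ Φ (divisors M) (map (ℕ._* p) T) ⟨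
        prod Φ (divisors M ++ map (ℕ._* p) T)      ≈⟨ prod-↭ Φ divisors-perm ⟨
        prod Φ (divisors (M ℕ.* p))                ≈⟨ expand-Φ-product M>0 ⟩
        prod (expand p ∘ Φ) (divisors M)           ≈⟨ prod-filter (expand p ∘ Φ) low? (divisors M) ⟩
        prod (expand p ∘ Φ) (filter low? (divisors M)) ⊗ prod (expand p ∘ Φ) T ≈⟨ R.*-congʳ low-product ⟩
        xN-1 M ⊗ prod (expand p ∘ Φ) T             ∎

Φ-*-product : ∀ {N} → 0 ℕ.< N → ∀ qs → All (λ q → Prime q × q ∣ N) qs → Φ (N ℕ.* product qs) ≈ expand (product qs) (Φ N)
Φ-*-product {N} N>0 [] [] = R.trans (R.reflexive (cong Φ (ℕₚ.*-identityʳ N))) (R.sym (expand-1 (Φ N)))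
Φ-*-product {N} N>0 (q ∷ qs) ((q-prime , q∣N) ∷ qs∣N) = begin
  Φ (N ℕ.* (q ℕ.* product qs))           ≈⟨ R.reflexive (cong Φ (ℕₚ.*-assoc N q (product qs))) ⟨
  Φ (N ℕ.* q ℕ.* product qs)
    ≈⟨ Φ-*-product (ℕₚ.*-mono-≤ N>0 (prime>0 q-prime)) qs (All.map (λ (r , d) → r , ∣-trans d (m∣m*n q)) qs∣N) ⟩
  expand (product qs) (Φ (N ℕ.* q))      ≈⟨ expand-cong (product qs) (Φ-*-∣ q-prime N>0 q∣N) ⟩
  expand (product qs) (expand q (Φ N))   ≈⟨ expand-expand (product qs) q (Φ N) ⟩
  expand (q ℕ.* product qs) (Φ N)        ∎
  where open ≈-Reasoning

-- Inverse series and low coefficients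

index-≥ : {A : Set} (d : A) → ∀ xs {i} → length xs ℕ.≤ i → index d xs i ≡ d
index-≥ d []       _         = refl
index-≥ d (x ∷ xs) (s≤s len) = index-≥ d xs len

-- `conv` keeps its total index fixed while `i` descends. Writing that index as `i + l` turns the
-- partial sum, completed by its term at 0, into a Cauchy product with a sequence shifted by `l`.
conv-⋆ : ∀ p cs i l → conv p cs (i ℕ.+ l) i + coeff p 0 * index (+ 0) cs (i ℕ.+ l)
         ≡ (coeff p ⋆ (λ x → index (+ 0) cs (x ℕ.+ l))) i
conv-⋆ p cs zero    l = ℤₚ.+-identityˡ _
conv-⋆ p cs (suc i) l = begin
  (coeff p (suc i) * g (i ℕ.+ l ℕ.∸ i) + conv p cs (suc i ℕ.+ l) i) + coeff p 0 * g (suc i ℕ.+ l)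
    ≡⟨ cong (λ z → (coeff p (suc i) * g z + conv p cs (suc i ℕ.+ l) i) + coeff p 0 * g (suc i ℕ.+ l)) (ℕₚ.m+n∸m≡n i l) ⟩
  (coeff p (suc i) * g l + conv p cs (suc i ℕ.+ l) i) + coeff p 0 * g (suc i ℕ.+ l)
    ≡⟨ eq (coeff p (suc i) * g l) _ _ ⟩
  (conv p cs (suc i ℕ.+ l) i + coeff p 0 * g (suc i ℕ.+ l)) + coeff p (suc i) * g l
    ≡⟨ cong (λ z → (conv p cs z i + coeff p 0 * g z) + coeff p (suc i) * g l) (ℕₚ.+-suc i l) ⟨
  (conv p cs (i ℕ.+ suc l) i + coeff p 0 * g (i ℕ.+ suc l)) + coeff p (suc i) * g l
    ≡⟨ cong (λ z → z + coeff p (suc i) * g l) (conv-⋆ p cs i (suc l)) ⟩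
  (coeff p ⋆ (λ x → g (x ℕ.+ suc l))) i + coeff p (suc i) * g l
    ≡⟨ cong (λ z → z + coeff p (suc i) * g l) (⋆-cong i (λ _ _ → refl) (λ x _ → cong g (ℕₚ.+-suc x l))) ⟩
  (coeff p ⋆ (λ x → g (suc x ℕ.+ l))) i + coeff p (suc i) * g l
    ≡⟨ ⋆-suc (coeff p) (λ x → g (x ℕ.+ l)) i ⟨
  (coeff p ⋆ (λ x → g (x ℕ.+ l))) (suc i) ∎
  where
  open ≡-Reasoning
  g = index (+ 0) cs
  eq : ∀ x y z → (x + y) + z ≡ (y + z) + x
  eq = solve-∀

length-invCoeffs : ∀ p k → length (invCoeffs p k) ≡ suc k
length-invCoeffs p zero    = refl
length-invCoeffs p (suc k) = trans (cong length (invCoeffs-suc p k))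
  (trans (Listₚ.length-++ (invCoeffs p k)) (trans (ℕₚ.+-comm _ 1) (cong suc (length-invCoeffs p k))))

-- An inverse modulo `x^(k+1)` is determined by the recursion that defines `invCoeff`, the constant
-- term being its own inverse.
invCoeff-truncated : ∀ p T k → coeff p 0 * coeff p 0 ≡ + 1 → Below._≈_ (suc k) (p ⊗ T) 𝟙 → invCoeff p k ≡ coeff T k
invCoeff-truncated p T k unit inv = go k ℕₚ.≤-refl k ℕₚ.≤-refl
  where
  open ≡-Reasoning
  p₀ = coeff p 0
  conv-eq : ∀ i → i ℕ.≤ k → (coeff p ⋆ coeff T) i ≡ coeff 𝟙 i
  conv-eq i i≤k = trans (sym (coeff-⊗ p T i)) (Below.at inv i (s≤s i≤k))
  go : ∀ n → n ℕ.≤ k → ∀ i → i ℕ.≤ n → index (+ 0) (invCoeffs p n) i ≡ coeff T i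
  go zero    n≤k zero _ = begin
    p₀                     ≡⟨ ℤₚ.*-identityʳ p₀ ⟨
    p₀ * + 1               ≡⟨ cong (p₀ *_) (conv-eq 0 z≤n) ⟨
    p₀ * (p₀ * coeff T 0)  ≡⟨ ℤₚ.*-assoc p₀ p₀ _ ⟨
    p₀ * p₀ * coeff T 0    ≡⟨ cong (_* coeff T 0) unit ⟩
    + 1 * coeff T 0        ≡⟨ ℤₚ.*-identityˡ _ ⟩
    coeff T 0              ∎
  go (suc n) n<k i i≤n with ℕₚ.m≤n⇒m<n∨m≡n i≤n
  ... | inj₁ (s≤s i≤n′) = begin
    index (+ 0) (invCoeffs p (suc n)) i   ≡⟨ cong (λ l → index (+ 0) l i) (invCoeffs-suc p n) ⟩
    index (+ 0) (cs ++ _) i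
      ≡⟨ index-++ˡ (+ 0) cs _ (subst (i ℕ.<_) (sym (length-invCoeffs p n)) (s≤s i≤n′)) ⟩
    index (+ 0) cs i                      ≡⟨ go n (ℕₚ.<⇒≤ n<k) i i≤n′ ⟩
    coeff T i                             ∎
    where cs = invCoeffs p n
  ... | inj₂ refl = begin
    index (+ 0) (invCoeffs p (suc n)) (suc n)   ≡⟨ cong (λ l → index (+ 0) l (suc n)) (invCoeffs-suc p n) ⟩
    index (+ 0) (cs ++ [ - (p₀ * s) ]) (suc n)  ≡⟨ cong (index (+ 0) (cs ++ [ - (p₀ * s) ])) (length-invCoeffs p n) ⟨
    index (+ 0) (cs ++ [ - (p₀ * s) ]) (length cs) ≡⟨ index-∷ʳ (+ 0) cs (- (p₀ * s)) ⟩
    - (p₀ * s)                                  ≡⟨ cong (λ z → - (p₀ * z)) s≡ ⟩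
    - (p₀ * w)                                  ≡⟨ eq p₀ (coeff T (suc n)) w ⟩
    p₀ * p₀ * coeff T (suc n) + - (p₀ * (p₀ * coeff T (suc n) + w))
      ≡⟨ cong₂ (λ y z → y * coeff T (suc n) + - (p₀ * z)) unit (conv-eq (suc n) n<k) ⟩
    + 1 * coeff T (suc n) + - (p₀ * + 0)        ≡⟨ eq′ p₀ (coeff T (suc n)) ⟩
    coeff T (suc n)                             ∎
    where
    cs = invCoeffs p n
    s = conv p cs (suc n) (suc n)
    w = ((λ i → coeff p (suc i)) ⋆ coeff T) n
    g = index (+ 0) cs
    -- The list stops at index `n`, so the default 0 is returned. This makes the term that `conv`
    -- omits from the Cauchy product vanish.
    g0 : g (suc n) ≡ + 0
    g0 = index-≥ (+ 0) cs (ℕₚ.≤-reflexive (length-invCoeffs p n))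
    s≡ : s ≡ w
    s≡ = begin
      s                                      ≡⟨ ℤₚ.+-identityʳ s ⟨
      s + + 0                                ≡⟨ +-congˡ s (trans (cong (p₀ *_) g0) (ℤₚ.*-zeroʳ p₀)) ⟨
      s + p₀ * g (suc n)                     ≡⟨ cong (λ m → conv p cs m (suc n) + p₀ * g m) (ℕₚ.+-identityʳ (suc n)) ⟨
      conv p cs (suc n ℕ.+ 0) (suc n) + p₀ * g (suc n ℕ.+ 0) ≡⟨ conv-⋆ p cs (suc n) 0 ⟩
      (coeff p ⋆ (λ x → g (x ℕ.+ 0))) (suc n)
        ≡⟨ ⋆-cong (suc n) {f = coeff p} {f′ = coeff p} (λ _ _ → refl) (λ x _ → cong g (ℕₚ.+-identityʳ x)) ⟩
      (coeff p ⋆ g) (suc n)                  ≡⟨⟩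
      p₀ * g (suc n) + ((λ i → coeff p (suc i)) ⋆ g) n
        ≡⟨ cong₂ _+_ (trans (cong (p₀ *_) g0) (ℤₚ.*-zeroʳ p₀)) (⋆-cong n (λ _ _ → refl) (go n (ℕₚ.<⇒≤ n<k))) ⟩
      + 0 + w                                ≡⟨ ℤₚ.+-identityˡ w ⟩
      w                                      ∎
    eq : ∀ p t w → - (p * w) ≡ p * p * t + - (p * (p * t + w))
    eq = solve-∀
    eq′ : ∀ p t → + 1 * t + - (p * + 0) ≡ t
    eq′ = solve-∀

Unit : ℤ → Set
Unit x = x ≡ + 1 ⊎ x ≡ - (+ 1)

-- The signs stay open because the radical may be 1, where `Φ 1 = x - 1`; one further prime turns
-- the constant term into 1.
record Low (M : ℕ) : Set where
  constructor low
  field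
    pos   : 0 ℕ.< M
    unit₀ : Unit (coeff (Φ M) 0)
    unit₁ : Unit (coeff (Φ M) 1)

record Normal (M : ℕ) (ε : ℤ) : Set where
  constructor normal
  field
    positive : 0 ℕ.< M
    const    : coeff (Φ M) 0 ≡ + 1
    linear   : coeff (Φ M) 1 ≡ ε

open Normal public

coeff-expand-1 : ∀ {p} → 1 ℕ.< p → ∀ f → coeff (expand p f) 1 ≡ + 0
coeff-expand-1 p>1 [] = refl
coeff-expand-1 {p} p>1 (x ∷ f) = trans (coeff-⊕ [ x ] _ 1) (trans (ℤₚ.+-identityˡ _)
  (trans (≈⇒coeff (X⊗ p (expand p f)) 1) (coeff-shift-< p _ p>1)))

-- Compare the two lowest coefficients in `Φ (M p) Φ M = Φ M (x^p)`, whose right side has no linear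
-- term as `p > 1`.
low-step : ∀ {M p} → Low M → Prime p → ¬ p ∣ M → Normal (M ℕ.* p) (- (coeff (Φ M) 1 * coeff (Φ M) 0))
low-step {M} {p} (low M>0 u₀ _) p-prime p∤M = normal (ℕₚ.*-mono-≤ M>0 (prime>0 p-prime)) A0 A1
  where
  open ≡-Reasoning
  f = Φ M
  F = Φ (M ℕ.* p)
  square : ∀ {x} → Unit x → x * x ≡ + 1
  square (inj₁ refl) = refl
  square (inj₂ refl) = refl
  eq = Φ-*-∤ p-prime M>0 p∤M
  e0 : coeff F 0 * coeff f 0 ≡ coeff f 0
  e0 = trans (sym (coeff-⊗ F f 0)) (trans (≈⇒coeff eq 0) (coeff-expand p (prime>0 p-prime) f 0))
  e1 : coeff F 0 * coeff f 1 + coeff F 1 * coeff f 0 ≡ + 0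
  e1 = trans (sym (coeff-⊗ F f 1)) (trans (≈⇒coeff eq 1) (coeff-expand-1 (prime>1 p-prime) f))
  A0 : coeff F 0 ≡ + 1
  A0 = begin
    coeff F 0                           ≡⟨ ℤₚ.*-identityʳ _ ⟨
    coeff F 0 * + 1                     ≡⟨ cong (coeff F 0 *_) (square u₀) ⟨
    coeff F 0 * (coeff f 0 * coeff f 0) ≡⟨ ℤₚ.*-assoc (coeff F 0) _ _ ⟨
    coeff F 0 * coeff f 0 * coeff f 0   ≡⟨ cong (_* coeff f 0) e0 ⟩
    coeff f 0 * coeff f 0               ≡⟨ square u₀ ⟩
    + 1                                 ∎
  A1 : coeff F 1 ≡ - (coeff f 1 * coeff f 0)
  A1 = begin
    coeff F 1                           ≡⟨ ℤₚ.*-identityʳ _ ⟨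
    coeff F 1 * + 1                     ≡⟨ cong (coeff F 1 *_) (square u₀) ⟨
    coeff F 1 * (coeff f 0 * coeff f 0) ≡⟨ arith (coeff F 0) (coeff f 1) (coeff F 1) (coeff f 0) ⟩
    (coeff F 0 * coeff f 1 + coeff F 1 * coeff f 0) * coeff f 0 + - (coeff F 0 * (coeff f 1 * coeff f 0))
      ≡⟨ cong₂ (λ x y → x * coeff f 0 + - (y * (coeff f 1 * coeff f 0))) e1 A0 ⟩
    + 0 * coeff f 0 + - (+ 1 * (coeff f 1 * coeff f 0)) ≡⟨ arith′ (coeff f 1) (coeff f 0) ⟩
    - (coeff f 1 * coeff f 0)           ∎
    where
    arith : ∀ a b c d → c * (d * d) ≡ (a * b + c * d) * d + - (a * (b * d))
    arith = solve-∀
    arith′ : ∀ b d → + 0 * d + - (+ 1 * (b * d)) ≡ - (b * d)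
    arith′ = solve-∀

unit-neg : ∀ {x} → Unit x → Unit (- x)
unit-neg (inj₁ refl) = inj₂ refl
unit-neg (inj₂ refl) = inj₁ refl

unit-* : ∀ {x y} → Unit x → Unit y → Unit (x * y)
unit-* (inj₁ refl) (inj₁ refl) = inj₁ refl
unit-* (inj₁ refl) (inj₂ refl) = inj₂ refl
unit-* (inj₂ refl) (inj₁ refl) = inj₂ refl
unit-* (inj₂ refl) (inj₂ refl) = inj₁ refl

normal⇒low : ∀ {M ε} → Unit ε → Normal M ε → Low M
normal⇒low u (normal M>0 c0 refl) = low M>0 (inj₁ c0) u

normal-step : ∀ {M p ε} → Unit ε → Normal M ε → Prime p → ¬ p ∣ M → Normal (M ℕ.* p) (- ε)
normal-step {M} {p} u n@(normal M>0 c0 refl) p-prime p∤M = subst (Normal (M ℕ.* p))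
  (cong (λ z → - z) (trans (cong (coeff (Φ M) 1 *_) c0) (ℤₚ.*-identityʳ _))) (low-step (normal⇒low u n) p-prime p∤M)

low-1 : Low 1
low-1 = low (s≤s z≤n) (inj₂ refl) (inj₁ refl)

-- R is the radical of product ts.
radical : ∀ ts → All Prime ts → ∃[ R ] ∃[ E ] (product ts ≡ R ℕ.* product E × All (λ q → Prime q × q ∣ R) E × Low R)
radical [] [] = 1 , [] , refl , [] , low-1
radical (p ∷ ts) (p-prime ∷ ts-prime) with radical ts ts-prime
... | R , E , eq , E∣R , lowR with p ∣? R
... | yes p∣R = R , p ∷ E , trans (cong (p ℕ.*_) eq) (swap p R (product E)) , (p-prime , p∣R) ∷ E∣R , lowR
  where
  swap : ∀ a b c → a ℕ.* (b ℕ.* c) ≡ b ℕ.* (a ℕ.* c)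
  swap a b c = trans (sym (ℕₚ.*-assoc a b c)) (trans (cong (ℕ._* c) (ℕₚ.*-comm a b)) (ℕₚ.*-assoc b a c))
... | no p∤R = R ℕ.* p , E , trans (cong (p ℕ.*_) eq)
    (trans (sym (ℕₚ.*-assoc p R _)) (cong (ℕ._* product E) (ℕₚ.*-comm p R)))
    , All.map (λ (r , d) → r , ∣-trans d (m∣m*n p)) E∣R
    , normal⇒low (unit-neg (unit-* (Low.unit₁ lowR) (Low.unit₀ lowR))) (low-step lowR p-prime p∤R)

-- Truncated products

odd? : {A : Set} → List A → Bool
odd? []       = false
odd? (_ ∷ xs) = not (odd? xs)

binomials : ℤ → List ℕ → Poly
binomials δ []       = 𝟙
binomials δ (p ∷ ps) = (𝟙 ⊕ [ δ ] ⊗ X p) ⊗ binomials δ ps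

monomials : List ℕ → Poly
monomials []       = []
monomials (p ∷ ps) = X p ⊕ monomials ps

∣product⇒∈ : ∀ {p} → Prime p → ∀ qs → All Prime qs → p ∣ product qs → p ∈ qs
∣product⇒∈ p-prime [] [] p∣1 = ⊥-elim (ℕₚ.<-irrefl refl (ℕₚ.<-≤-trans (prime>1 p-prime) (∣⇒≤ p∣1)))
∣product⇒∈ p-prime (q ∷ qs) (q-prime ∷ qs-prime) p∣ with euclidsLemma q (product qs) p-prime p∣
... | inj₂ p∣qs = there (∣product⇒∈ p-prime qs qs-prime p∣qs)
... | inj₁ p∣q with prime⇒irreducible q-prime p∣q
... | inj₁ refl = ⊥-elim (ℕₚ.<-irrefl refl (prime>1 p-prime))
... | inj₂ refl = here refl

module Window (K : ℕ) where
  private module T = CommutativeRing (Below.ring K)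
  open Below K public renaming (_≈_ to _≋_; coeffwise to coeffwise≋; at to at≋)
  open NatSolver T.commutativeSemiring using () renaming
      (solve to solve≋; _:+_ to _⊹_; _:*_ to _∙_; _:=_ to _≔_; con to κ)
  import Relation.Binary.Reasoning.Setoid T.setoid as ≋-Reasoning

  truncate : ∀ {p q} → p ≈ q → p ≋ q
  truncate e = coeffwise≋ λ i _ → ≈⇒coeff e i

  X-vanish : ∀ {n} → K ℕ.≤ n → X n ≋ []
  X-vanish {n} K≤n = coeffwise≋ λ i i<K → coeff-shift-< n 𝟙 (ℕₚ.<-≤-trans i<K K≤n)

  XX-vanish : ∀ {m n} → K ℕ.≤ m ℕ.+ m → K ℕ.≤ n ℕ.+ n → X m ⊗ X n ≋ []
  XX-vanish {m} {n} K≤2m K≤2n = T.trans (truncate (R.sym (X-+ m n))) (X-vanish (mean K m n K≤2m K≤2n))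
    where
    mean : ∀ k m n → k ℕ.≤ m ℕ.+ m → k ℕ.≤ n ℕ.+ n → k ℕ.≤ m ℕ.+ n
    mean k m n k≤2m k≤2n with ℕₚ.≤-total m n
    ... | inj₁ m≤n = ℕₚ.≤-trans k≤2m (ℕₚ.+-monoʳ-≤ m m≤n)
    ... | inj₂ n≤m = ℕₚ.≤-trans k≤2n (ℕₚ.+-monoˡ-≤ n n≤m)

  X⊗monomials-vanish : ∀ {p} → K ℕ.≤ p ℕ.+ p → ∀ qs → All (λ q → K ℕ.≤ q ℕ.+ q) qs → X p ⊗ monomials qs ≋ []
  X⊗monomials-vanish {p} p-big []       []           = T.zeroʳ (X p)
  X⊗monomials-vanish {p} p-big (q ∷ qs) (q-big ∷ qs-big) = T.trans (T.distribˡ (X p) (X q) (monomials qs))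
    (T.trans (T.+-cong (XX-vanish {p} {q} p-big q-big) (X⊗monomials-vanish p-big qs qs-big)) (T.+-identityʳ []))

  -- A product of two of the monomials has degree at least `K`, so only the terms linear in them
  -- survive.
  binomials-monomials : ∀ δ qs → All (λ q → K ℕ.≤ q ℕ.+ q) qs → binomials δ qs ≋ 𝟙 ⊕ [ δ ] ⊗ monomials qs
  binomials-monomials δ [] [] = T.sym (T.trans (T.+-congˡ (T.zeroʳ [ δ ])) (T.+-identityʳ 𝟙))
  binomials-monomials δ (q ∷ qs) (q-big ∷ qs-big) = begin
    (𝟙 ⊕ D ⊗ X q) ⊗ binomials δ qs              ≈⟨ T.*-congˡ (binomials-monomials δ qs qs-big) ⟩
    (𝟙 ⊕ D ⊗ X q) ⊗ (𝟙 ⊕ D ⊗ S)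
      ≈⟨ solve≋ 3 (λ d x s → (κ 1 ⊹ d ∙ x) ∙ (κ 1 ⊹ d ∙ s) ≔ (κ 1 ⊹ d ∙ (x ⊹ s)) ⊹ d ∙ d ∙ (x ∙ s)) T.refl D (X q) S ⟩
    (𝟙 ⊕ D ⊗ (X q ⊕ S)) ⊕ D ⊗ D ⊗ (X q ⊗ S)
      ≈⟨ T.+-congˡ (T.trans (T.*-congˡ (X⊗monomials-vanish q-big qs qs-big)) (T.zeroʳ _)) ⟩
    (𝟙 ⊕ D ⊗ (X q ⊕ S)) ⊕ []                    ≈⟨ T.+-identityʳ _ ⟩
    𝟙 ⊕ D ⊗ (X q ⊕ S)                           ∎
    where
    open ≋-Reasoning
    D = [ δ ]
    S = monomials qs

  expand-low : ∀ {p} → K ℕ.≤ p ℕ.+ p → ∀ f → expand p f ≋ [ coeff f 0 ] ⊕ [ coeff f 1 ] ⊗ X p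
  expand-low {p} p-big [] = T.sym
      (T.trans (T.+-cong (truncate const-zero) (T.trans (T.*-congʳ (truncate const-zero)) (T.zeroˡ (X p))))
          (T.+-identityʳ []))
  expand-low {p} p-big (x ∷ []) = T.+-congˡ
      (T.trans (T.zeroʳ (X p)) (T.sym (T.trans (T.*-congʳ (truncate const-zero)) (T.zeroˡ (X p)))))
  expand-low {p} p-big (x ∷ y ∷ f) = T.+-congˡ (begin
    X p ⊗ ([ y ] ⊕ X p ⊗ expand p f)
      ≈⟨ solve≋ 3 (λ x y f → x ∙ (y ⊹ x ∙ f) ≔ y ∙ x ⊹ (x ∙ x) ∙ f) T.refl (X p) [ y ] (expand p f) ⟩
    [ y ] ⊗ X p ⊕ (X p ⊗ X p) ⊗ expand p f
      ≈⟨ T.+-congˡ (T.trans (T.*-congʳ (XX-vanish {p} {p} p-big p-big)) (T.zeroˡ _)) ⟩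
    [ y ] ⊗ X p ⊕ []                              ≈⟨ T.+-identityʳ _ ⟩
    [ y ] ⊗ X p                                   ∎)
    where open ≋-Reasoning

  module _ {M δ} (u : Unit δ) (M-normal : Normal M δ) where

    -- The Boolean is the parity of the number of primes adjoined to `M`. A new prime `p` inverts
    -- `Φ N` and flips the linear coefficient; as `(1 - δ x^p)(1 + δ x^p)` is 1 in the window, both
    -- effects together give `U` the same factor `1 + δ x^p` at every step.
    State : Bool → ℕ → Poly → Set
    State false N U = Normal N δ     × Φ N ⊗ U ≋ Φ M
    State true  N U = Normal N (- δ) × Φ N ⊗ Φ M ≋ U

    private
      adjoin : ∀ {N ε p} → Normal N ε → Prime p → ¬ p ∣ N → K ℕ.≤ p ℕ.+ p → Φ (N ℕ.* p) ⊗ Φ N ≋ 𝟙 ⊕ [ ε ] ⊗ X p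
      adjoin {N} {p = p} (normal N>0 c0 c1) p-prime p∤N p-big = T.trans (truncate (Φ-*-∤ p-prime N>0 p∤N))
        (T.trans (expand-low p-big (Φ N))
            (T.+-cong (T.reflexive (cong [_] c0)) (T.*-congʳ (T.reflexive (cong [_] c1)))))

      step : ∀ b {N U p} → State b N U → Prime p → ¬ p ∣ N → K ℕ.≤ p ℕ.+ p →
        State (not b) (N ℕ.* p) ((𝟙 ⊕ [ δ ] ⊗ X p) ⊗ U)
      step false {N} {U} {p} (N-normal , eq) p-prime p∤N p-big = normal-step u N-normal p-prime p∤N , (begin
        Φ (N ℕ.* p) ⊗ Φ M              ≈⟨ T.*-congˡ eq ⟨
        Φ (N ℕ.* p) ⊗ (Φ N ⊗ U)        ≈⟨ T.*-assoc _ _ _ ⟨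
        Φ (N ℕ.* p) ⊗ Φ N ⊗ U          ≈⟨ T.*-congʳ (adjoin N-normal p-prime p∤N p-big) ⟩
        (𝟙 ⊕ [ δ ] ⊗ X p) ⊗ U          ∎)
        where open ≋-Reasoning
      step true {N} {U} {p} (N-normal , eq) p-prime p∤N p-big =
        subst (Normal (N ℕ.* p)) (ℤₚ.neg-involutive δ) (normal-step (unit-neg u) N-normal p-prime p∤N) , (begin
        F ⊗ ((𝟙 ⊕ D ⊗ x) ⊗ U)              ≈⟨ T.*-congˡ (T.*-congˡ eq) ⟨
        F ⊗ ((𝟙 ⊕ D ⊗ x) ⊗ (Φ N ⊗ Φ M))
          ≈⟨ solve≋ 4 (λ f b n m → f ∙ (b ∙ (n ∙ m)) ≔ (f ∙ n) ∙ b ∙ m) T.refl F (𝟙 ⊕ D ⊗ x) (Φ N) (Φ M) ⟩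
        (F ⊗ Φ N) ⊗ (𝟙 ⊕ D ⊗ x) ⊗ Φ M      ≈⟨ T.*-congʳ (T.*-congʳ (adjoin N-normal p-prime p∤N p-big)) ⟩
        (𝟙 ⊕ D′ ⊗ x) ⊗ (𝟙 ⊕ D ⊗ x) ⊗ Φ M
          ≈⟨ T.*-congʳ (solve≋ 3 (λ d e x → (κ 1 ⊹ d ∙ x) ∙ (κ 1 ⊹ e ∙ x) ≔ κ 1 ⊹
              ((d ⊹ e) ∙ x ⊹ d ∙ e ∙ (x ∙ x))) T.refl D′ D x) ⟩
        (𝟙 ⊕ ((D′ ⊕ D) ⊗ x ⊕ D′ ⊗ D ⊗ (x ⊗ x))) ⊗ Φ M
          ≈⟨ T.*-congʳ (T.+-congˡ (T.+-cong (T.trans (T.*-congʳ cancel) (T.zeroˡ x))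
              (T.trans (T.*-congˡ (XX-vanish {p} {p} p-big p-big)) (T.zeroʳ _)))) ⟩
        (𝟙 ⊕ ([] ⊕ [])) ⊗ Φ M              ≈⟨ T.*-congʳ (T.trans (T.+-congˡ (T.+-identityˡ [])) (T.+-identityʳ 𝟙)) ⟩
        𝟙 ⊗ Φ M                            ≈⟨ T.*-identityˡ _ ⟩
        Φ M                                ∎)
        where
        open ≋-Reasoning
        F = Φ (N ℕ.* p)
        x = X p
        D = [ δ ]
        D′ = [ - δ ]
        cancel : D′ ⊕ D ≋ []
        cancel = truncate (R.trans (R.sym (const-+ (- δ) δ))
            (R.trans (R.reflexive (cong [_] (ℤₚ.+-inverseˡ δ))) const-zero))

    Φ-truncated : ∀ qs → Unique qs → All Prime qs → All (λ q → ¬ q ∣ M × K ℕ.≤ q ℕ.+ q) qs →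
                  State (odd? qs) (M ℕ.* product qs) (binomials δ qs)
    Φ-truncated [] _ _ _ = subst (λ N → State false N 𝟙) (sym (ℕₚ.*-identityʳ M)) (M-normal , T.*-identityʳ (Φ M))
    Φ-truncated (q ∷ qs) (q∉qs ∷ uniq) (q-prime ∷ qs-prime) ((q∤M , q-big) ∷ qs-big) =
      subst (λ N → State (not (odd? qs)) N (binomials δ (q ∷ qs))) eq
        (step (odd? qs) (Φ-truncated qs uniq qs-prime qs-big) q-prime q∤N q-big)
      where
      eq : M ℕ.* product qs ℕ.* q ≡ M ℕ.* (q ℕ.* product qs)
      eq = trans (ℕₚ.*-assoc M (product qs) q) (cong (M ℕ.*_) (ℕₚ.*-comm (product qs) q))
      q∤N : ¬ q ∣ M ℕ.* product qs
      q∤N q∣N with euclidsLemma M (product qs) q-prime q∣N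
      ... | inj₁ q∣M  = q∤M q∣M
      ... | inj₂ q∣qs = All.lookup q∉qs (∣product⇒∈ q-prime qs qs-prime q∣qs) refl

-- Base-q digits: if deg P < q, no carries occur in P(x) C(x^q).
coeff-digits : ∀ {q} P → (∀ i → q ℕ.≤ i → coeff P i ≡ + 0) → ∀ C u {v} → v ℕ.< q →
               coeff (P ⊗ expand q C) (u ℕ.* q ℕ.+ v) ≡ coeff P v * coeff C u
coeff-digits P P0 [] u {v} v<q = trans (≈⇒coeff (R.zeroʳ P) _) (sym (ℤₚ.*-zeroʳ (coeff P v)))
coeff-digits {q} P P0 (x ∷ C) u {v} v<q = begin
  coeff (P ⊗ ([ x ] ⊕ X q ⊗ E)) n
    ≡⟨ ≈⇒coeff (solve 4 (λ p x q e → p :* (x :+ q :* e) := x :* p :+ q :* (p :* e)) R.refl P [ x ] (X q) E) n ⟩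
  coeff ([ x ] ⊗ P ⊕ X q ⊗ (P ⊗ E)) n                ≡⟨ coeff-⊕ ([ x ] ⊗ P) _ n ⟩
  coeff ([ x ] ⊗ P) n + coeff (X q ⊗ (P ⊗ E)) n      ≡⟨ cong₂ _+_ (coeff-const* x P n) (≈⇒coeff (X⊗ q (P ⊗ E)) n) ⟩
  x * coeff P n + coeff (shift q (P ⊗ E)) n          ≡⟨ digit u ⟩
  coeff P v * coeff (x ∷ C) u                        ∎
  where
  open ≡-Reasoning
  E = expand q C
  n = u ℕ.* q ℕ.+ v
  digit : ∀ u → let n = u ℕ.* q ℕ.+ v in x * coeff P n + coeff (shift q (P ⊗ E)) n ≡ coeff P v * coeff (x ∷ C) u
  digit zero    = trans (+-congˡ (x * coeff P v) (coeff-shift-< q (P ⊗ E) v<q))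
      (trans (ℤₚ.+-identityʳ _) (ℤₚ.*-comm x (coeff P v)))
  digit (suc u) = begin
    x * coeff P m + coeff (shift q (P ⊗ E)) m
      ≡⟨ cong (λ z → z + coeff (shift q (P ⊗ E)) m) (trans (cong (x *_) (P0 m q≤m)) (ℤₚ.*-zeroʳ x)) ⟩
    + 0 + coeff (shift q (P ⊗ E)) m                    ≡⟨ ℤₚ.+-identityˡ _ ⟩
    coeff (shift q (P ⊗ E)) m                          ≡⟨ cong (coeff (shift q (P ⊗ E))) (ℕₚ.+-assoc q (u ℕ.* q) v) ⟩
    coeff (shift q (P ⊗ E)) (q ℕ.+ (u ℕ.* q ℕ.+ v))    ≡⟨ coeff-shift-+ q (P ⊗ E) (u ℕ.* q ℕ.+ v) ⟩
    coeff (P ⊗ E) (u ℕ.* q ℕ.+ v)                      ≡⟨ coeff-digits P P0 C u v<q ⟩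
    coeff P v * coeff C u                              ∎
    where
    m = suc u ℕ.* q ℕ.+ v
    q≤m : q ℕ.≤ m
    q≤m = ℕₚ.≤-trans (ℕₚ.m≤m+n q (u ℕ.* q)) (ℕₚ.m≤m+n _ v)

Monic-unique : ∀ {m n p q} → Monic m p → Monic n q → p ≈ q → m ≡ n
Monic-unique {m} {n} mp mq eq with ℕₚ.<-cmp m n
... | tri≈ _ m≡n _ = m≡n
... | tri< m<n _ _ with trans (sym (top mq)) (trans (sym (≈⇒coeff eq n)) (vanish mp n m<n))
...   | ()
Monic-unique {m} {n} mp mq eq | tri> _ _ n<m with trans (sym (top mp)) (trans (≈⇒coeff eq m) (vanish mq m n<m))
...   | ()

Φ-cofactor : ∀ {M} → 0 ℕ.< M → ∃[ Q ] (Φ M ⊗ Q ≈ xN-1 M × ∃[ m ] Monic m Q)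
Φ-cofactor {suc n} M>0 = prod Φ es
  , R.trans (R.reflexive (cong (prod Φ) (sym (divisors-suc n)))) (Φ-product (Φ-cyclotomic M>0))
  , Monic-prod Φ es (λ e∈ → _ , isMonic (Φ-cyclotomic (proj₁ (∈-divisorsUpTo⁻ e∈))))
  where es = divisorsUpTo (suc n) n

geo-expand : ∀ g k → geo g k ≡ expand g (replicate k (+ 1))
geo-expand g zero    = refl
geo-expand g (suc k) = cong (λ z → 𝟙 ⊕ X g ⊗ z) (geo-expand g k)

coeff-replicate : ∀ {n i} x → i ℕ.< n → coeff (replicate n x) i ≡ x
coeff-replicate {suc n} {zero}  x _         = refl
coeff-replicate {suc n} {suc i} x (s≤s i<n) = coeff-replicate x i<n

unit≢0 : ∀ {x} → Unit x → x ≢ + 0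
unit≢0 (inj₁ refl) ()
unit≢0 (inj₂ refl) ()

-- 1/Φ M = -Q/(1 - x^M) with Q = (x^M - 1)/Φ M, cut off after T periods.
inverse : ∀ {M ε} → Unit ε → Normal M ε → ∀ T → ∃[ C ] (Φ M ⊗ C ⊕ X (T ℕ.* M) ≈ 𝟙 × (∀ i → i ℕ.< T →
  coeff C (i ℕ.* M) ≡ + 1))
inverse {M} u (normal M>0 c0 c1) T with Φ-cofactor M>0
... | Q , eq , m , mQ = ⊝ Z , (begin
  Φ M ⊗ ⊝ Z ⊕ X (T ℕ.* M)                   ≈⟨ R.+-cong (-‿distribʳ-* (Φ M) Z) (xN-1⊗geo⊕𝟙 M>0 T) ⟨
  ⊝ (Φ M ⊗ Z) ⊕ (xN-1 M ⊗ geo M T ⊕ 𝟙)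
    ≈⟨ R.+-congˡ (R.+-congʳ (R.trans (R.*-congʳ (R.sym eq)) (R.*-assoc (Φ M) Q (geo M T)))) ⟩
  ⊝ (Φ M ⊗ Z) ⊕ (Φ M ⊗ Z ⊕ 𝟙)               ≈⟨ R.+-assoc _ _ _ ⟨
  (⊝ (Φ M ⊗ Z) ⊕ Φ M ⊗ Z) ⊕ 𝟙               ≈⟨ R.+-congʳ (R.-‿inverseˡ (Φ M ⊗ Z)) ⟩
  [] ⊕ 𝟙                                    ≈⟨ R.+-identityˡ 𝟙 ⟩
  𝟙                                         ∎) , coeffs
  where
  open ≈-Reasoning
  Z = Q ⊗ geo M T
  mΦ = isMonic (Φ-cyclotomic M>0)
  -- As `ε` is nonzero, `Φ M` is not constant; hence `Q` has degree below `M` and its shifts by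
  -- multiples of `M` do not overlap.
  deg≥1 : 0 ℕ.< deg (Φ-cyclotomic M>0)
  deg≥1 = ℕₚ.≰⇒> λ deg≤0 → unit≢0 u (trans (sym c1) (vanish mΦ 1 (s≤s deg≤0)))
  m<M : m ℕ.< M
  m<M = subst (m ℕ.<_) (Monic-unique (Monic-⊗ mΦ mQ) (Monic-xN-1 M>0) eq) (ℕₚ.+-monoˡ-≤ m deg≥1)
  xN-1-0 : ∀ {n} → coeff (xN-1 n) 0 ≡ - (+ 1)
  xN-1-0 = refl
  Q0 : coeff Q 0 ≡ - (+ 1)
  Q0 = trans (sym (ℤₚ.*-identityˡ _))
      (trans (cong (_* coeff Q 0) (sym c0)) (trans (sym (coeff-⊗ (Φ M) Q 0)) (trans (≈⇒coeff eq 0) (xN-1-0 {M}))))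
  coeffs : ∀ i → i ℕ.< T → coeff (⊝ Z) (i ℕ.* M) ≡ + 1
  coeffs i i<T = trans (coeff-⊝ Z (i ℕ.* M)) (cong (λ z → - z) (trans
    (trans (cong₂ coeff (cong (Q ⊗_) (geo-expand M T)) (sym (ℕₚ.+-identityʳ (i ℕ.* M))))
           (coeff-digits Q (λ j M≤j → vanish mQ j (ℕₚ.<-≤-trans m<M M≤j)) (replicate T (+ 1)) i M>0))
    (cong₂ _*_ Q0 (coeff-replicate (+ 1) i<T))))

-- 1/Φ (M q) = Φ M (x) / Φ M (x^q) is supported on exponents whose residue mod q is at most deg (Φ M).
sparse-inverse : ∀ {M ε D q} → Unit ε → Normal M ε → Monic D (Φ M) → Prime q → ¬ q ∣ M → D ℕ.< q → ∀ T →
  ∃[ A ] (Φ (M ℕ.* q) ⊗ A ⊕ X (T ℕ.* (M ℕ.* q)) ≈ 𝟙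
       × (∀ u v → D ℕ.< v → v ℕ.< q → coeff A (u ℕ.* q ℕ.+ v) ≡ + 0)
       × (∀ i v → i ℕ.< T → v ℕ.< q → coeff A (i ℕ.* (M ℕ.* q) ℕ.+ v) ≡ coeff (Φ M) v))
sparse-inverse {M} {ε} {D} {q} u nM mΦ q-prime q∤M D<q T with inverse u nM T
... | C , eq , ones = A , eqA , gap , period
  where
  open ≈-Reasoning
  A = Φ M ⊗ expand q C
  eqA : Φ (M ℕ.* q) ⊗ A ⊕ X (T ℕ.* (M ℕ.* q)) ≈ 𝟙
  eqA = begin
    Φ (M ℕ.* q) ⊗ (Φ M ⊗ expand q C) ⊕ X (T ℕ.* (M ℕ.* q))
      ≈⟨ R.+-cong (R.trans (R.sym (R.*-assoc _ _ _)) (R.*-congʳ (Φ-*-∤ q-prime (positive nM) q∤M)))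
                  (R.trans (R.reflexive (cong X (sym (ℕₚ.*-assoc T M q)))) (R.sym (expand-X q (T ℕ.* M)))) ⟩
    expand q (Φ M) ⊗ expand q C ⊕ expand q (X (T ℕ.* M))  ≈⟨ R.+-congʳ (expand-⊗ q (Φ M) C) ⟨
    expand q (Φ M ⊗ C) ⊕ expand q (X (T ℕ.* M))           ≈⟨ expand-⊕ q _ _ ⟨
    expand q (Φ M ⊗ C ⊕ X (T ℕ.* M))                      ≈⟨ expand-cong q eq ⟩
    expand q 𝟙                                            ≈⟨ expand-const q (+ 1) ⟩
    𝟙                                                     ∎
  digits : ∀ u {v} → v ℕ.< q → coeff A (u ℕ.* q ℕ.+ v) ≡ coeff (Φ M) v * coeff C u
  digits = coeff-digits (Φ M) (λ i q≤i → vanish mΦ i (ℕₚ.<-≤-trans D<q q≤i)) C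
  gap : ∀ u v → D ℕ.< v → v ℕ.< q → coeff A (u ℕ.* q ℕ.+ v) ≡ + 0
  gap u v D<v v<q = trans (digits u v<q) (cong (_* coeff C u) (vanish mΦ v D<v))
  period : ∀ i v → i ℕ.< T → v ℕ.< q → coeff A (i ℕ.* (M ℕ.* q) ℕ.+ v) ≡ coeff (Φ M) v
  period i v i<T v<q = trans (cong (λ z → coeff A (z ℕ.+ v)) (sym (ℕₚ.*-assoc i M q)))
    (trans (digits (i ℕ.* M) v<q) (trans (cong (coeff (Φ M) v *_) (ones i i<T)) (ℤₚ.*-identityʳ _)))

-- Reading off coefficients of `Φ N` and of its inverse

coeff-monomials : ∀ A k qs → All (k ℕ.<_) qs → ∀ ps → All (λ p → ∃[ i ] (k ≡ p ℕ.+ i × coeff A i ≡ + 1)) ps →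
                  coeff (monomials (qs ++ ps) ⊗ A) k ≡ + length ps
coeff-monomials A k (q ∷ qs) (k<q ∷ k<qs) ps hits = begin
  coeff ((X q ⊕ S) ⊗ A) k                        ≡⟨ ≈⇒coeff (R.distribʳ A (X q) S) k ⟩
  coeff (X q ⊗ A ⊕ S ⊗ A) k                      ≡⟨ coeff-⊕ (X q ⊗ A) _ k ⟩
  coeff (X q ⊗ A) k + coeff (S ⊗ A) k
    ≡⟨ cong₂ _+_ (trans (≈⇒coeff (X⊗ q A) k) (coeff-shift-< q A k<q)) (coeff-monomials A k qs k<qs ps hits) ⟩
  + 0 + + length ps                              ≡⟨ ℤₚ.+-identityˡ _ ⟩
  + length ps                                    ∎
  where
  open ≡-Reasoning
  S = monomials (qs ++ ps)
coeff-monomials A k [] [] [] [] = ≈⇒coeff (R.zeroˡ A) k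
coeff-monomials A k [] [] (p ∷ ps) ((i , refl , hit) ∷ hits) = begin
  coeff ((X p ⊕ S) ⊗ A) k                        ≡⟨ ≈⇒coeff (R.distribʳ A (X p) S) k ⟩
  coeff (X p ⊗ A ⊕ S ⊗ A) k                      ≡⟨ coeff-⊕ (X p ⊗ A) _ k ⟩
  coeff (X p ⊗ A) k + coeff (S ⊗ A) k
    ≡⟨ cong₂ _+_ (trans (≈⇒coeff (X⊗ p A) k) (trans (coeff-shift-+ p A i) hit)) (coeff-monomials A k [] [] ps hits) ⟩
  + 1 + + length ps                              ∎
  where
  open ≡-Reasoning
  S = monomials ps

-- What is needed of Φ N to read off z as a coefficient of Φ N (b = true) or of 1/Φ N (b = false).
data Attains : Bool → Poly → ℤ → Set where
  direct    : ∀ {f z} k → coeff f k ≡ z → Attains true f z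
  reciprocal : ∀ {f z} k T → coeff f 0 ≡ + 1 → Below._≈_ (suc k) (f ⊗ T) 𝟙 → coeff T k ≡ z → Attains false f z

-- Modulo `x^(k+1)`, `U ⊗ A` is `Φ N` or its inverse according to the parity. As `v` lies in the
-- gap, `A` vanishes at `k`, and each `p` in `ps` adds `- ε` times the coefficient 1 of `A` at
-- `k - p`. The primes in `qs` adjust the parity and are invisible in the window.
attains-window : ∀ {M ε D q} → Unit ε → Normal M ε → Monic D (Φ M) → Prime q → ¬ q ∣ M → D ℕ.< q →
  ∀ k u v → k ≡ u ℕ.* q ℕ.+ v → D ℕ.< v → v ℕ.< q →
  ∀ j → j ℕ.< q → coeff (Φ M) j ≡ + 1 →
  ∀ qs → All (k ℕ.<_) qs →
  ∀ ps → All (λ p → ∃[ i ] k ≡ p ℕ.+ (i ℕ.* (M ℕ.* q) ℕ.+ j)) ps →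
  Unique (qs ++ ps) → All Prime (qs ++ ps) → All (λ p → ¬ p ∣ M ℕ.* q × k ℕ.< p ℕ.+ p) (qs ++ ps) →
  Attains (odd? (qs ++ ps)) (Φ (M ℕ.* q ℕ.* product (qs ++ ps))) (- ε * + length ps)
attains-window {M} {ε} {D} {q} unit nM mΦ q-prime q∤M D<q k u v k≡ D<v v<q j j<q Φj qs k<qs ps hits uniq primes sizes =
  finish (odd? (qs ++ ps)) (Φ-truncated (unit-neg unit) nMq (qs ++ ps) uniq primes sizes)
  where
  -- As `L` is positive, `suc k` periods reach beyond degree `k`.
  S-inv = sparse-inverse unit nM mΦ q-prime q∤M D<q (suc k)
  A = proj₁ S-inv
  eqA = proj₁ (proj₂ S-inv)
  gap = proj₁ (proj₂ (proj₂ S-inv))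
  period = proj₂ (proj₂ (proj₂ S-inv))
  open Window (suc k)
  module T = CommutativeRing (Below.ring (suc k))
  L = M ℕ.* q
  δ = - ε
  nMq : Normal L δ
  nMq = normal-step unit nM q-prime q∤M
  rs = qs ++ ps
  U = binomials δ rs
  S = monomials rs
  inv : Φ L ⊗ A ≋ 𝟙
  inv = T.trans (T.sym (T.trans (T.+-congˡ (X-vanish (ℕₚ.m≤m*n (suc k) L {{ℕ.>-nonZero (positive nMq)}})))
      (T.+-identityʳ _))) (truncate eqA)
  shiftA : ∀ {p} → ∃[ i ] k ≡ p ℕ.+ (i ℕ.* L ℕ.+ j) → ∃[ i ] (k ≡ p ℕ.+ i × coeff A i ≡ + 1)
  shiftA {p} (i , eq) = i ℕ.* L ℕ.+ j , eq , trans (period i j (s≤s i≤k) j<q) Φj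
    where
    i≤k : i ℕ.≤ k
    i≤k = ℕₚ.≤-trans (ℕₚ.m≤m*n i L {{ℕ.>-nonZero (positive nMq)}})
          (ℕₚ.≤-trans (ℕₚ.m≤m+n _ j) (ℕₚ.≤-trans (ℕₚ.m≤n+m _ p) (ℕₚ.≤-reflexive (sym eq))))
  value : coeff (U ⊗ A) k ≡ δ * + length ps
  value = begin
    coeff (U ⊗ A) k
      ≡⟨ at≋ (T.*-congʳ (binomials-monomials δ rs (All.map proj₂ sizes))) k ℕₚ.≤-refl ⟩
    coeff ((𝟙 ⊕ [ δ ] ⊗ S) ⊗ A) k
      ≡⟨ ≈⇒coeff (solve 3 (λ d s a → (con 1 :+ d :* s) :* a := a :+ d :* (s :* a)) R.refl [ δ ] S A) k ⟩
    coeff (A ⊕ [ δ ] ⊗ (S ⊗ A)) k            ≡⟨ coeff-⊕ A _ k ⟩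
    coeff A k + coeff ([ δ ] ⊗ (S ⊗ A)) k
      ≡⟨ cong₂ _+_ (trans (cong (coeff A) k≡) (gap u v D<v v<q)) (coeff-const* δ (S ⊗ A) k) ⟩
    + 0 + δ * coeff (S ⊗ A) k                ≡⟨ ℤₚ.+-identityˡ _ ⟩
    δ * coeff (S ⊗ A) k                      ≡⟨ cong (δ *_) (coeff-monomials A k qs k<qs ps (All.map shiftA hits)) ⟩
    δ * + length ps                          ∎
    where open ≡-Reasoning
  finish : ∀ b {N} → State (unit-neg unit) nMq b N U → Attains b (Φ N) (δ * + length ps)
  finish true  {N} (_ , eq) = direct k
      (trans (at≋ (T.trans (T.sym (T.*-identityʳ (Φ N))) (T.trans (T.*-congˡ (T.sym inv))
    (T.trans (T.sym (T.*-assoc (Φ N) (Φ L) A)) (T.*-congʳ eq)))) k ℕₚ.≤-refl) value)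
  finish false {N} (nN , eq) = reciprocal k (U ⊗ A) (const nN)
    (T.trans (T.sym (T.*-assoc (Φ N) U A)) (T.trans (T.*-congʳ eq) inv)) value

-- A congruence modulo `x^n` becomes an equation, to which the substitution of `x^E` can be applied.
below⇒exact : ∀ n f g → Below._≈_ n f g → ∃[ H ] f ≈ g ⊕ X n ⊗ H
below⇒exact n f g eq = drop n (f ⊕ ⊝ g) , (begin
  f                                   ≈⟨ R.+-identityˡ f ⟨
  [] ⊕ f                              ≈⟨ R.+-congʳ (R.-‿inverseʳ g) ⟨
  (g ⊕ ⊝ g) ⊕ f                       ≈⟨ R.+-assoc g (⊝ g) f ⟩
  g ⊕ (⊝ g ⊕ f)                       ≈⟨ R.+-congˡ (R.+-comm (⊝ g) f) ⟩
  g ⊕ (f ⊕ ⊝ g)                       ≈⟨ R.+-congˡ (shift-drop n (f ⊕ ⊝ g) low-zero) ⟩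
  g ⊕ shift n (drop n (f ⊕ ⊝ g))      ≈⟨ R.+-congˡ (X⊗ n _) ⟨
  g ⊕ X n ⊗ drop n (f ⊕ ⊝ g)          ∎)
  where
  open ≈-Reasoning
  shift-drop : ∀ n h → (∀ i → i ℕ.< n → coeff h i ≡ + 0) → h ≈ shift n (drop n h)
  shift-drop zero    h       h0 = R.refl
  shift-drop (suc n) []      h0 = R.trans (R.sym const-zero) (∷-cong refl (shift-drop-[] n))
    where
    shift-drop-[] : ∀ n → [] ≈ shift n []
    shift-drop-[] zero    = R.refl
    shift-drop-[] (suc n) = R.trans (R.sym const-zero) (∷-cong refl (shift-drop-[] n))
  shift-drop (suc n) (x ∷ h) h0 = ∷-cong (h0 0 (s≤s z≤n)) (shift-drop n h (λ i i<n → h0 (suc i) (s≤s i<n)))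
  low-zero : ∀ i → i ℕ.< n → coeff (f ⊕ ⊝ g) i ≡ + 0
  low-zero i i<n = trans (coeff-⊕ f (⊝ g) i)
      (trans (cong₂ _+_ (Below.at eq i i<n) (coeff-⊝ g i)) (ℤₚ.+-inverseʳ (coeff g i)))

attains-expand : ∀ {b f z} E → 0 ℕ.< E → ∀ {g} → g ≈ expand E f → Attains b f z → Attains b g z
attains-expand {f = f} E E>0 eq (direct k fk) = direct (k ℕ.* E)
    (trans (≈⇒coeff eq (k ℕ.* E)) (trans (coeff-expand E E>0 f k) fk))
attains-expand {f = f} E E>0 {g} eq (reciprocal k T f0 inv Tk) with below⇒exact (suc k) (f ⊗ T) 𝟙 inv
... | H , fT = reciprocal (k ℕ.* E) (expand E T) (trans (≈⇒coeff eq 0) (trans (coeff-expand E E>0 f 0) f0))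
    -- The error term starts at `suc k * E`, which is beyond `k * E` because `E` is positive.
    (B.trans (truncate gT) (B.trans
        (B.+-congˡ (B.trans (B.*-congʳ (X-vanish (ℕₚ.+-monoˡ-≤ (k ℕ.* E) E>0))) (B.zeroˡ _))) (B.+-identityʳ 𝟙)))
    (trans (coeff-expand E E>0 T k) Tk)
  where
  open Window (suc (k ℕ.* E))
  module B = CommutativeRing (Below.ring (suc (k ℕ.* E)))
  open ≈-Reasoning
  gT : g ⊗ expand E T ≈ 𝟙 ⊕ X (suc k ℕ.* E) ⊗ expand E H
  gT = begin
    g ⊗ expand E T                                ≈⟨ R.*-congʳ eq ⟩
    expand E f ⊗ expand E T                       ≈⟨ expand-⊗ E f T ⟨
    expand E (f ⊗ T)                              ≈⟨ expand-cong E fT ⟩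
    expand E (𝟙 ⊕ X (suc k) ⊗ H)                  ≈⟨ expand-⊕ E 𝟙 _ ⟩
    expand E 𝟙 ⊕ expand E (X (suc k) ⊗ H)
      ≈⟨ R.+-cong (expand-const E (+ 1)) (R.trans (expand-⊗ E (X (suc k)) H) (R.*-congʳ (expand-X E (suc k)))) ⟩
    𝟙 ⊕ X (suc k ℕ.* E) ⊗ expand E H              ∎

coefficient : Bool → ℕ → ℕ → ℤ
coefficient true  N k = coeff (Φ N) k
coefficient false N k = invCoeff (Φ N) k

attains⇒coefficient : ∀ {b N z} → Attains b (Φ N) z → ∃[ k ] coefficient b N k ≡ z
attains⇒coefficient (direct k eq) = k , eq
attains⇒coefficient {N = N} (reciprocal k T f0 inv eq) = k , trans
    (invCoeff-truncated (Φ N) T k (cong₂ _*_ f0 f0) inv) eq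

-- Primes in dyadic intervals

unique-⊆-length : ∀ {xs ys : List ℕ} → Unique xs → (∀ {x} → x ∈ xs → x ∈ ys) → length xs ℕ.≤ length ys
unique-⊆-length {[]} _ _ = z≤n
unique-⊆-length {x ∷ xs} {ys} (x∉xs ∷ u) sub with ∈-∃++ (sub (here refl))
... | as , bs , refl = ℕₚ.≤-trans (s≤s (unique-⊆-length u sub′)) (ℕₚ.≤-reflexive len)
  where
  sub′ : ∀ {y} → y ∈ xs → y ∈ as ++ bs
  sub′ {y} y∈ with ∈-++⁻ as (sub (there y∈))
  ... | inj₁ y∈as          = ∈-++⁺ˡ y∈as
  ... | inj₂ (here refl)   = ⊥-elim (All.lookup x∉xs y∈ refl)
  ... | inj₂ (there y∈bs)  = ∈-++⁺ʳ as y∈bs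
  len : suc (length (as ++ bs)) ≡ length (as ++ x ∷ bs)
  len = trans (cong suc (Listₚ.length-++ as))
      (trans (sym (ℕₚ.+-suc (length as) (length bs))) (sym (Listₚ.length-++ as)))

length-cartesianProductWith : ∀ (f : ℕ → ℕ → ℕ) xs ys → length (cartesianProductWith f xs ys) ≡ length xs ℕ.* length ys
length-cartesianProductWith f []       ys = refl
length-cartesianProductWith f (x ∷ xs) ys = trans (Listₚ.length-++ (map (f x) ys))
  (cong₂ ℕ._+_ (Listₚ.length-map (f x) ys) (length-cartesianProductWith f xs ys))

length-concatMap-≤ : ∀ (f : ℕ → List ℕ) {r} xs → (∀ {x} → x ∈ xs → length (f x) ℕ.≤ r) →
  length (concatMap f xs) ℕ.≤ length xs ℕ.* r
length-concatMap-≤ f []       _ = z≤n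
length-concatMap-≤ f (x ∷ xs) b = ℕₚ.≤-trans (ℕₚ.≤-reflexive (Listₚ.length-++ (f x)))
  (ℕₚ.+-mono-≤ (b (here refl)) (length-concatMap-≤ f xs (b ∘ there)))

-- Products over all subsets of the numbers below `y`, composite numbers and 0 included: the count
-- `2 ^ y` is small enough without restricting to primes.
distinctProducts : ℕ → List ℕ
distinctProducts zero    = [ 1 ]
distinctProducts (suc y) = distinctProducts y ++ map (y ℕ.*_) (distinctProducts y)

length-distinctProducts : ∀ y → length (distinctProducts y) ≡ 2 ℕ.^ y
length-distinctProducts zero    = refl
length-distinctProducts (suc y) = trans (Listₚ.length-++ (distinctProducts y))
  (cong₂ ℕ._+_ (length-distinctProducts y) (trans (Listₚ.length-map (y ℕ.*_) (distinctProducts y))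
    (trans (length-distinctProducts y) (sym (ℕₚ.+-identityʳ _)))))

-- Multiplying by `p` inserts `p` into the subset or, if it is already there, removes it and splits
-- off the square of `p`.
toggle : ∀ y {p a} → p ℕ.< y → a ∈ distinctProducts y →
  ∃[ a′ ] ∃[ b ] (a′ ∈ distinctProducts y × p ℕ.* a ≡ a′ ℕ.* (b ℕ.* b))
toggle (suc y) {p} {a} (s≤s p≤y) a∈ with ∈-++⁻ (distinctProducts y) a∈ | ℕₚ.m≤n⇒m<n∨m≡n p≤y
... | inj₁ a∈₁ | inj₁ p<y = let (a′ , b , a′∈ , eq) = toggle y p<y a∈₁ in a′ , b , ∈-++⁺ˡ a′∈ , eq
... | inj₁ a∈₁ | inj₂ refl = p ℕ.* a , 1 , ∈-++⁺ʳ (distinctProducts y) (∈-map⁺ (y ℕ.*_) a∈₁) , sym (ℕₚ.*-identityʳ _)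
... | inj₂ a∈₂ | p≤ with ∈-map⁻ (y ℕ.*_) a∈₂
toggle (suc y) {p} _ _ | inj₂ _ | inj₁ p<y | a₀ , a₀∈ , refl with toggle y p<y a₀∈
... | a′ , b , a′∈ , eq = y ℕ.* a′ , b , ∈-++⁺ʳ (distinctProducts y) (∈-map⁺ (y ℕ.*_) a′∈) , (begin
  p ℕ.* (y ℕ.* a₀)          ≡⟨ swap p y a₀ ⟩
  y ℕ.* (p ℕ.* a₀)          ≡⟨ cong (y ℕ.*_) eq ⟩
  y ℕ.* (a′ ℕ.* (b ℕ.* b))  ≡⟨ ℕₚ.*-assoc y a′ _ ⟨
  y ℕ.* a′ ℕ.* (b ℕ.* b)    ∎)
  where
  open ≡-Reasoning
  swap : ∀ a b c → a ℕ.* (b ℕ.* c) ≡ b ℕ.* (a ℕ.* c)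
  swap = ℕ-Solver.solve-∀
toggle (suc y) {p} _ _ | inj₂ _ | inj₂ refl | a₀ , a₀∈ , refl = a₀ , y , ∈-++⁺ˡ a₀∈ , square y a₀
  where
  square : ∀ y a → y ℕ.* (y ℕ.* a) ≡ a ℕ.* (y ℕ.* y)
  square = ℕ-Solver.solve-∀

-- The factors enter one at a time by `toggle`, and the squares split off accumulate in `b`.
smooth-form : ∀ y fs → All (ℕ._< y) fs → ∃[ a ] ∃[ b ] (a ∈ distinctProducts y × product fs ≡ a ℕ.* (b ℕ.* b))
smooth-form y [] [] = 1 , 1 , one y , refl
  where
  one : ∀ y → 1 ∈ distinctProducts y
  one zero    = here refl
  one (suc y) = ∈-++⁺ˡ (one y)
smooth-form y (p ∷ fs) (p<y ∷ fs<y) with smooth-form y fs fs<y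
... | a , b , a∈ , eq with toggle y p<y a∈
... | a′ , b′ , a′∈ , eq′ = a′ , b′ ℕ.* b , a′∈ , (begin
  p ℕ.* product fs                       ≡⟨ cong (p ℕ.*_) eq ⟩
  p ℕ.* (a ℕ.* (b ℕ.* b))                ≡⟨ ℕₚ.*-assoc p a _ ⟨
  p ℕ.* a ℕ.* (b ℕ.* b)                  ≡⟨ cong (ℕ._* (b ℕ.* b)) eq′ ⟩
  a′ ℕ.* (b′ ℕ.* b′) ℕ.* (b ℕ.* b)       ≡⟨ rearrange a′ b′ b ⟩
  a′ ℕ.* (b′ ℕ.* b ℕ.* (b′ ℕ.* b))       ∎)
  where
  open ≡-Reasoning
  rearrange : ∀ a b c → a ℕ.* (b ℕ.* b) ℕ.* (c ℕ.* c) ≡ a ℕ.* (b ℕ.* c ℕ.* (b ℕ.* c))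
  rearrange = ℕ-Solver.solve-∀

n<2^n : ∀ n → n ℕ.< 2 ℕ.^ n
n<2^n zero    = s≤s z≤n
n<2^n (suc n) = ℕₚ.+-mono-≤ (ℕₚ.≤-trans (s≤s z≤n) (n<2^n n))
    (ℕₚ.≤-trans (n<2^n n) (ℕₚ.≤-reflexive (sym (ℕₚ.+-identityʳ _))))

module _ (L : ℕ) .{{_ : NonZero L}} where

  class? : ∀ c p → Dec (Prime p × p % L ≡ c)
  class? c p = prime? p ×-dec (p % L ℕₚ.≟ c)

  -- The first `L` numbers of the dyadic interval are skipped: the exponent chosen later exceeds
  -- `2 X`, for `X = 2 ^ k`, by less than `2 L`, and must stay below `2 p`.
  classPrimes : ℕ → ℕ → List ℕ
  classPrimes k c = filter (class? c) (applyUpTo (λ i → 2 ℕ.^ k ℕ.+ L ℕ.+ i) (2 ℕ.^ suc k ℕ.∸ (2 ℕ.^ k ℕ.+ L)))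

  Sparse : ℕ → ℕ → Set
  Sparse r k = ∀ c → c ℕ.< L → length (classPrimes k c) ℕ.≤ r

  -- A list containing all primes of the dyadic interval; the `L` numbers skipped by `classPrimes`
  -- are put back wholesale.
  block : ℕ → List ℕ
  block k = applyUpTo (2 ℕ.^ k ℕ.+_) L ++ concatMap (classPrimes k) (upTo L)

  length-block : ∀ {r k} → Sparse r k → length (block k) ℕ.≤ L ℕ.* suc r
  length-block {r} {k} sparse = begin
    length (block k)                                    ≡⟨ Listₚ.length-++ (applyUpTo (2 ℕ.^ k ℕ.+_) L) ⟩
    length (applyUpTo (2 ℕ.^ k ℕ.+_) L) ℕ.+ length (concatMap (classPrimes k) (upTo L))
      ≤⟨ ℕₚ.+-mono-≤ (ℕₚ.≤-reflexive (Listₚ.length-applyUpTo (2 ℕ.^ k ℕ.+_) L))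
          (length-concatMap-≤ (classPrimes k) (upTo L) bound) ⟩
    L ℕ.+ length (upTo L) ℕ.* r                         ≡⟨ cong (λ l → L ℕ.+ l ℕ.* r) (Listₚ.length-upTo L) ⟩
    L ℕ.+ L ℕ.* r                                       ≡⟨ ℕₚ.*-suc L r ⟨
    L ℕ.* suc r                                         ∎
    where
    open ℕₚ.≤-Reasoning
    bound : ∀ {c} → c ∈ upTo L → length (classPrimes k c) ℕ.≤ r
    bound c∈ = sparse _ (∈-upTo⁻ c∈)

  ∈-block : ∀ {k p} → Prime p → 2 ℕ.^ k ℕ.≤ p → p ℕ.< 2 ℕ.^ suc k → p ∈ block k
  ∈-block {k} {p} p-prime lo hi with p ℕ.<? 2 ℕ.^ k ℕ.+ L
  ... | yes p<   = ∈-++⁺ˡ (subst (_∈ applyUpTo (2 ℕ.^ k ℕ.+_) L) (ℕₚ.m+[n∸m]≡n lo)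
                     (∈-applyUpTo⁺ (2 ℕ.^ k ℕ.+_) (ℕₚ.+-cancelˡ-< (2 ℕ.^ k) _ _
                         (subst (ℕ._< 2 ℕ.^ k ℕ.+ L) (sym (ℕₚ.m+[n∸m]≡n lo)) p<))))
  ... | no p≮    = ∈-++⁺ʳ (applyUpTo (2 ℕ.^ k ℕ.+_) L) (∈-concatMap⁺ (classPrimes k)
                     (lose (∈-upTo⁺ (m%n<n p L)) (∈-filter⁺ (class? (p % L)) p∈ (p-prime , refl))))
    where
    a = 2 ℕ.^ k ℕ.+ L
    a≤p : a ℕ.≤ p
    a≤p = ℕₚ.≮⇒≥ p≮
    p∈ : p ∈ applyUpTo (a ℕ.+_) (2 ℕ.^ suc k ℕ.∸ a)
    p∈ = subst (_∈ applyUpTo (a ℕ.+_) (2 ℕ.^ suc k ℕ.∸ a)) (ℕₚ.m+[n∸m]≡n a≤p)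
        (∈-applyUpTo⁺ (a ℕ.+_) (ℕₚ.∸-monoˡ-< hi a≤p))

  -- Covers the numbers below `2 ^ (k + d)` with a prime factor of at least `2 ^ k`, sorted by the
  -- dyadic interval of that factor, which bounds the cofactor.
  roughs : ℕ → ℕ → List ℕ
  roughs k zero    = []
  roughs k (suc d) = cartesianProductWith ℕ._*_ (block k) (upTo (2 ℕ.^ suc d)) ++ roughs (suc k) d

  -- A geometric series: the blocks are uniformly bounded and the range of the cofactor halves from
  -- one interval to the next.
  length-roughs : ∀ r k d → (∀ i → i ℕ.< k ℕ.+ d → k ℕ.≤ i → Sparse r i) →
    length (roughs k d) ℕ.≤ L ℕ.* suc r ℕ.* 2 ℕ.^ suc d
  length-roughs r k zero    _ = z≤n
  length-roughs r k (suc d) sparse = begin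
    length (roughs k (suc d))     ≡⟨ Listₚ.length-++ (cartesianProductWith ℕ._*_ (block k) (upTo (2 ℕ.^ suc d))) ⟩
    length (cartesianProductWith ℕ._*_ (block k) (upTo (2 ℕ.^ suc d))) ℕ.+ length (roughs (suc k) d)
      ≡⟨ cong (ℕ._+ length (roughs (suc k) d))
          (trans (length-cartesianProductWith ℕ._*_ (block k) _) (cong (length (block k) ℕ.*_) (Listₚ.length-upTo _))) ⟩
    length (block k) ℕ.* 2 ℕ.^ suc d ℕ.+ length (roughs (suc k) d)
      ≤⟨ ℕₚ.+-mono-≤ (ℕₚ.*-monoˡ-≤ (2 ℕ.^ suc d) (length-block {r} {k} (sparse k (ℕₚ.m<m+n k (s≤s z≤n)) ℕₚ.≤-refl)))
           (length-roughs r (suc k) d (λ i i< k<i → sparse i (subst (i ℕ.<_) (sym (ℕₚ.+-suc k d)) i<) (ℕₚ.<⇒≤ k<i))) ⟩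
    R ℕ.* 2 ℕ.^ suc d ℕ.+ R ℕ.* 2 ℕ.^ suc d  ≡⟨ double R (2 ℕ.^ suc d) ⟩
    R ℕ.* 2 ℕ.^ suc (suc d)                  ∎
    where
    open ℕₚ.≤-Reasoning
    R = L ℕ.* suc r
    double : ∀ r t → r ℕ.* t ℕ.+ r ℕ.* t ≡ r ℕ.* (t ℕ.+ (t ℕ.+ 0))
    double = ℕ-Solver.solve-∀

  ∈-roughs : ∀ k d {p m} → Prime p → 2 ℕ.^ k ℕ.≤ p → 0 ℕ.< m → p ℕ.* m ℕ.< 2 ℕ.^ (k ℕ.+ d) → p ℕ.* m ∈ roughs k d
  ∈-roughs k zero {p} {m} p-prime lo m>0 hi = ⊥-elim (ℕₚ.<-irrefl refl (ℕₚ.<-≤-trans hi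
    (ℕₚ.≤-trans (ℕₚ.≤-reflexive (cong (2 ℕ.^_) (ℕₚ.+-identityʳ k)))
        (ℕₚ.≤-trans lo (ℕₚ.m≤m*n p m {{ℕ.>-nonZero m>0}})))))
  ∈-roughs k (suc d) {p} {m} p-prime lo m>0 hi with p ℕ.<? 2 ℕ.^ suc k
  ... | no p≮  = ∈-++⁺ʳ _ (∈-roughs (suc k) d p-prime (ℕₚ.≮⇒≥ p≮) m>0
      (subst (λ e → p ℕ.* m ℕ.< 2 ℕ.^ e) (ℕₚ.+-suc k d) hi))
  ... | yes p< = ∈-++⁺ˡ (∈-cartesianProductWith⁺ ℕ._*_ (∈-block {k} p-prime lo p<) (∈-upTo⁺ m<))
    where
    m< : m ℕ.< 2 ℕ.^ suc d
    m< = ℕₚ.*-cancelˡ-< (2 ℕ.^ k) m (2 ℕ.^ suc d) (ℕₚ.≤-<-trans (ℕₚ.*-monoˡ-≤ m lo)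
           (subst (p ℕ.* m ℕ.<_) (ℕₚ.^-distribˡ-+-* 2 k (suc d)) hi))

  smooths : ℕ → ℕ → List ℕ
  smooths y κ = cartesianProductWith (λ a b → a ℕ.* (b ℕ.* b)) (distinctProducts y) (upTo (2 ℕ.^ κ))

  -- Without a prime factor of at least `2 ^ k`, `n` has the form `a * (b * b)` of `smooth-form`; as
  -- the square of `b` is at most `n`, `b` is less than `2 ^ κ`.
  cover : ∀ k d κ → k ℕ.+ d ≡ κ ℕ.+ κ → ∀ {n} → 0 ℕ.< n → n ℕ.< 2 ℕ.^ (k ℕ.+ d) → n ∈ roughs k d ++ smooths (2 ℕ.^ k) κ
  cover k d κ eq {n} n>0 n< with factorise n {{ℕ.>-nonZero n>0}}
  ... | record { factors = fs ; isFactorisation = refl ; factorsPrime = fs-prime } with any? (λ p → 2 ℕ.^ k ℕ.≤? p) fs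
  ... | yes big = ∈-++⁺ˡ (rough big)
    where
    rough : Any (2 ℕ.^ k ℕ.≤_) fs → product fs ∈ roughs k d
    rough big with find big
    ... | p , p∈ , lo with ∈⇒∣product p∈
    ... | divides m fs≡ = subst (_∈ roughs k d) (sym fs≡pm)
        (∈-roughs k d (All.lookup fs-prime p∈) lo m>0 (subst (ℕ._< 2 ℕ.^ (k ℕ.+ d)) fs≡pm n<))
      where
      fs≡pm : product fs ≡ p ℕ.* m
      fs≡pm = trans fs≡ (ℕₚ.*-comm m p)
      m>0 : 0 ℕ.< m
      m>0 = ℕₚ.n≢0⇒n>0 λ m≡0 → ℕₚ.<⇒≢ n>0 (sym (trans fs≡ (cong (ℕ._* p) m≡0)))
  ... | no small with smooth-form (2 ℕ.^ k) fs (All.map ℕₚ.≰⇒> (Allₚ.¬Any⇒All¬ fs small))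
  ... | a , b , a∈ , fs≡ = ∈-++⁺ʳ (roughs k d) (subst (_∈ smooths (2 ℕ.^ k) κ) (sym fs≡)
          (∈-cartesianProductWith⁺ (λ a b → a ℕ.* (b ℕ.* b)) a∈ (∈-upTo⁺ (ℕₚ.≰⇒> b≱))))
    where
    a>0 : 0 ℕ.< a
    a>0 = ℕₚ.n≢0⇒n>0 λ a≡0 → ℕₚ.<⇒≢ n>0 (sym (trans fs≡ (cong (ℕ._* (b ℕ.* b)) a≡0)))
    b≱ : ¬ 2 ℕ.^ κ ℕ.≤ b
    b≱ 2^κ≤b = ℕₚ.<-irrefl refl (ℕₚ.<-≤-trans n< (begin
      2 ℕ.^ (k ℕ.+ d)        ≡⟨ trans (cong (2 ℕ.^_) eq) (ℕₚ.^-distribˡ-+-* 2 κ κ) ⟩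
      2 ℕ.^ κ ℕ.* 2 ℕ.^ κ    ≤⟨ ℕₚ.*-mono-≤ 2^κ≤b 2^κ≤b ⟩
      b ℕ.* b                ≤⟨ ℕₚ.m≤n*m (b ℕ.* b) a {{ℕ.>-nonZero a>0}} ⟩
      a ℕ.* (b ℕ.* b)        ≡⟨ fs≡ ⟨
      product fs             ∎))
      where open ℕₚ.≤-Reasoning

  counting : ∀ r k d κ → k ℕ.+ d ≡ κ ℕ.+ κ → (∀ i → i ℕ.< k ℕ.+ d → k ℕ.≤ i → Sparse r i) →
             2 ℕ.^ (k ℕ.+ d) ℕ.≤ suc (L ℕ.* suc r ℕ.* 2 ℕ.^ suc d ℕ.+ 2 ℕ.^ (2 ℕ.^ k) ℕ.* 2 ℕ.^ κ)
  counting r k d κ eq sparse = begin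
    N                                             ≤⟨ ℕₚ.m≤n+m∸n N 1 ⟩
    suc (N ℕ.∸ 1)                                 ≡⟨ cong suc (Listₚ.length-applyUpTo suc (N ℕ.∸ 1)) ⟨
    suc (length (applyUpTo suc (N ℕ.∸ 1)))
      ≤⟨ s≤s (unique-⊆-length (Uniqueₚ.applyUpTo⁺₁ suc (N ℕ.∸ 1) (λ i<j _ e → ℕₚ.<⇒≢ i<j (ℕₚ.suc-injective e))) sub) ⟩
    suc (length (roughs k d ++ smooths (2 ℕ.^ k) κ))  ≡⟨ cong suc (Listₚ.length-++ (roughs k d)) ⟩
    suc (length (roughs k d) ℕ.+ length (smooths (2 ℕ.^ k) κ))
      ≤⟨ s≤s (ℕₚ.+-mono-≤ (length-roughs r k d sparse)
          (ℕₚ.≤-reflexive (trans (length-cartesianProductWith (λ a b → a ℕ.* (b ℕ.* b))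
              (distinctProducts (2 ℕ.^ k)) (upTo (2 ℕ.^ κ)))
           (cong₂ ℕ._*_ (length-distinctProducts (2 ℕ.^ k)) (Listₚ.length-upTo (2 ℕ.^ κ)))))) ⟩
    suc (L ℕ.* suc r ℕ.* 2 ℕ.^ suc d ℕ.+ 2 ℕ.^ (2 ℕ.^ k) ℕ.* 2 ℕ.^ κ) ∎
    where
    open ℕₚ.≤-Reasoning
    N = 2 ℕ.^ (k ℕ.+ d)
    sub : ∀ {n} → n ∈ applyUpTo suc (N ℕ.∸ 1) → n ∈ roughs k d ++ smooths (2 ℕ.^ k) κ
    sub n∈ with ∈-applyUpTo⁻ suc n∈
    ... | i , i< , refl = cover k d κ eq (s≤s z≤n)
        (subst (suc i ℕ.<_) (ℕₚ.m+[n∸m]≡n {1} {N} (ℕₚ.m^n>0 2 (k ℕ.+ d))) (s≤s i<))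

  -- The exponents are chosen such that roughs and smooths each cover at most a quarter of [1, 2^(k+d)).
  notSparse : ∀ r B → let k = B ℕ.+ 8 ℕ.* (L ℕ.* suc r) ; y = 2 ℕ.^ k ; d = k ℕ.+ (4 ℕ.+ y ℕ.+ y) in
              ¬ (∀ i → i ℕ.< k ℕ.+ d → k ℕ.≤ i → Sparse r i)
  notSparse r B sparse = ℕₚ.<-irrefl refl (begin-strict
    4                                             <⟨ s≤s (s≤s (s≤s (s≤s (s≤s z≤n)))) ⟩
    2 ℕ.* 2 ℕ.^ 4                                 ≤⟨ ℕₚ.*-monoʳ-≤ 2 (ℕₚ.^-monoʳ-≤ 2 4≤K) ⟩
    2 ℕ.* N                                       ≤⟨ ℕₚ.+-cancelʳ-≤ (2 ℕ.* N) (2 ℕ.* N) 4 total ⟩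
    4                                             ∎)
    where
    open ℕₚ.≤-Reasoning
    R = L ℕ.* suc r
    -- `8 * R ≤ k < 2 ^ k` is what bounds the roughs; the summand `B` pushes the intervals beyond
    -- `B`.
    k = B ℕ.+ 8 ℕ.* R
    y = 2 ℕ.^ k
    d = k ℕ.+ (4 ℕ.+ y ℕ.+ y)
    -- Half of `k + d`. The summand `2 + y` lets `2 ^ κ` absorb the factor `2 ^ y` of the smooths
    -- together with the 4.
    κ = k ℕ.+ (2 ℕ.+ y)
    N = 2 ℕ.^ (k ℕ.+ d)
    halves : ∀ k y → k ℕ.+ (k ℕ.+ (4 ℕ.+ y ℕ.+ y)) ≡ (k ℕ.+ (2 ℕ.+ y)) ℕ.+ (k ℕ.+ (2 ℕ.+ y))
    halves = ℕ-Solver.solve-∀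
    4≤K : 4 ℕ.≤ k ℕ.+ d
    4≤K = ℕₚ.≤-trans (ℕₚ.m≤m+n 4 (y ℕ.+ y)) (ℕₚ.≤-trans (ℕₚ.m≤n+m _ k) (ℕₚ.m≤n+m _ k))
    roughs≤ : 4 ℕ.* (R ℕ.* 2 ℕ.^ suc d) ℕ.≤ N
    roughs≤ = begin
      4 ℕ.* (R ℕ.* (2 ℕ.* 2 ℕ.^ d))   ≡⟨ arith R (2 ℕ.^ d) ⟩
      8 ℕ.* R ℕ.* 2 ℕ.^ d             ≤⟨ ℕₚ.*-monoˡ-≤ (2 ℕ.^ d) (ℕₚ.≤-trans (ℕₚ.m≤n+m (8 ℕ.* R) B) (ℕₚ.<⇒≤ (n<2^n k))) ⟩
      y ℕ.* 2 ℕ.^ d                   ≡⟨ ℕₚ.^-distribˡ-+-* 2 k d ⟨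
      N                               ∎
      where
      arith : ∀ r t → 4 ℕ.* (r ℕ.* (2 ℕ.* t)) ≡ 8 ℕ.* r ℕ.* t
      arith = ℕ-Solver.solve-∀
    smooths≤ : 4 ℕ.* (2 ℕ.^ y ℕ.* 2 ℕ.^ κ) ℕ.≤ N
    smooths≤ = begin
      4 ℕ.* (2 ℕ.^ y ℕ.* 2 ℕ.^ κ)     ≡⟨ ℕₚ.*-assoc 4 (2 ℕ.^ y) (2 ℕ.^ κ) ⟨
      4 ℕ.* 2 ℕ.^ y ℕ.* 2 ℕ.^ κ       ≡⟨ cong (ℕ._* 2 ℕ.^ κ) (ℕₚ.^-distribˡ-+-* 2 2 y) ⟨
      2 ℕ.^ (2 ℕ.+ y) ℕ.* 2 ℕ.^ κ     ≤⟨ ℕₚ.*-monoˡ-≤ (2 ℕ.^ κ) (ℕₚ.^-monoʳ-≤ 2 (ℕₚ.m≤n+m (2 ℕ.+ y) k)) ⟩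
      2 ℕ.^ κ ℕ.* 2 ℕ.^ κ             ≡⟨ ℕₚ.^-distribˡ-+-* 2 κ κ ⟨
      2 ℕ.^ (κ ℕ.+ κ)                 ≡⟨ cong (2 ℕ.^_) (halves k y) ⟨
      N                               ∎
    -- This leaves `2 * N ≤ 4`, whereas `4≤K` gives `N ≥ 16`.
    total : 2 ℕ.* N ℕ.+ 2 ℕ.* N ℕ.≤ 4 ℕ.+ 2 ℕ.* N
    total = begin
      2 ℕ.* N ℕ.+ 2 ℕ.* N             ≡⟨ four N ⟩
      4 ℕ.* N                         ≤⟨ ℕₚ.*-monoʳ-≤ 4 (counting r k d κ (halves k y) sparse) ⟩
      4 ℕ.* suc (R ℕ.* 2 ℕ.^ suc d ℕ.+ 2 ℕ.^ y ℕ.* 2 ℕ.^ κ) ≡⟨ expand4 (R ℕ.* 2 ℕ.^ suc d) (2 ℕ.^ y ℕ.* 2 ℕ.^ κ) ⟩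
      4 ℕ.+ (4 ℕ.* (R ℕ.* 2 ℕ.^ suc d) ℕ.+ 4 ℕ.* (2 ℕ.^ y ℕ.* 2 ℕ.^ κ))
        ≤⟨ ℕₚ.+-monoʳ-≤ 4 (ℕₚ.+-mono-≤ roughs≤ smooths≤) ⟩
      4 ℕ.+ (N ℕ.+ N)                 ≡⟨ cong (4 ℕ.+_) (two N) ⟩
      4 ℕ.+ 2 ℕ.* N                   ∎
      where
      four : ∀ n → 2 ℕ.* n ℕ.+ 2 ℕ.* n ≡ 4 ℕ.* n
      four = ℕ-Solver.solve-∀
      two : ∀ n → n ℕ.+ n ≡ 2 ℕ.* n
      two = ℕ-Solver.solve-∀
      expand4 : ∀ a b → 4 ℕ.* suc (a ℕ.+ b) ≡ 4 ℕ.+ (4 ℕ.* a ℕ.+ 4 ℕ.* b)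
      expand4 = ℕ-Solver.solve-∀

  abstract
    -- A bounded search through exponents and residue classes. Its failure would make every interval
    -- in the range sparse, against `notSparse`.
    congruent-primes : ∀ r B → ∃[ X ] ∃[ c ] ∃[ ps ] (B ℕ.≤ X × length ps ≡ r × Unique ps ×
      All (λ p → (X ℕ.+ L ℕ.≤ p × p ℕ.< 2 ℕ.* X) × Prime p × p % L ≡ c) ps)
    congruent-primes r B with ℕₚ.anyUpTo?
        (λ i → k ℕ.≤? i ×-dec ℕₚ.anyUpTo? (λ c → r ℕ.≤? length (classPrimes i c)) L) (k ℕ.+ d)
      where
      k y d : ℕ
      k = B ℕ.+ 8 ℕ.* (L ℕ.* suc r)
      y = 2 ℕ.^ k
      d = k ℕ.+ (4 ℕ.+ y ℕ.+ y)
    ... | no none = ⊥-elim (notSparse r B λ i i< k≤i c c<L → ℕₚ.<⇒≤ (ℕₚ.≰⇒> λ r≤ → none (i , i< , k≤i , c , c<L , r≤)))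
    ... | yes (i , i< , k≤i , c , c<L , r≤) = 2 ℕ.^ i , c , take r qs
        , ℕₚ.≤-trans (ℕₚ.≤-trans (ℕₚ.m≤m+n B _) k≤i) (ℕₚ.<⇒≤ (n<2^n i))
        , trans (Listₚ.length-take r qs) (ℕₚ.m≤n⇒m⊓n≡m r≤)
        , Uniqueₚ.take⁺ r (Uniqueₚ.filter⁺ (class? c)
            (Uniqueₚ.applyUpTo⁺₁ (a ℕ.+_) n (λ i<j _ e → ℕₚ.<⇒≢ i<j (ℕₚ.+-cancelˡ-≡ a _ _ e))))
        , Allₚ.take⁺ r (All.tabulate in-range)
      where
      qs : List ℕ
      qs = classPrimes i c
      a n : ℕ
      a = 2 ℕ.^ i ℕ.+ L
      n = 2 ℕ.^ suc i ℕ.∸ a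
      in-range : ∀ {p} → p ∈ qs → (a ℕ.≤ p × p ℕ.< 2 ℕ.* 2 ℕ.^ i) × Prime p × p % L ≡ c
      in-range p∈ with ∈-filter⁻ (class? c) {xs = applyUpTo (a ℕ.+_) n} p∈
      ... | p∈′ , pc with ∈-applyUpTo⁻ (a ℕ.+_) p∈′
      ... | j , j<n , refl = (ℕₚ.m≤m+n a j , subst (ℕ._< 2 ℕ.^ suc i) (ℕₚ.+-comm j a)
          (ℕₚ.m≤o∸n⇒m+n≤o (suc j) (ℕₚ.<⇒≤ (ℕₚ.m∸n≢0⇒n<m (ℕₚ.m<n⇒n≢0 j<n))) j<n)) , pc

-- Residue classes

abstract
  prime-above : ∀ B → ∃[ p ] (Prime p × B ℕ.< p)
  prime-above B with congruent-primes 1 1 B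
  ... | X , c , p ∷ [] , B≤X , _ , _ , ((X<p , _) , p-prime , _) ∷ [] =
    p , p-prime , ℕₚ.≤-trans (s≤s B≤X) (ℕₚ.≤-trans (ℕₚ.≤-reflexive (ℕₚ.+-comm 1 X)) X<p)

>⇒∤ : ∀ {p n} → 0 ℕ.< n → n ℕ.< p → ¬ p ∣ n
>⇒∤ n>0 n<p p∣n = ℕₚ.<⇒≱ n<p (∣⇒≤ {{ℕ.>-nonZero n>0}} p∣n)

coprime-^-divisor : ∀ {s g} → Coprime s g → ∀ i {o} → s ∣ g ℕ.^ i ℕ.* o → s ∣ o
coprime-^-divisor co zero    {o} s∣ = subst (_ ∣_) (ℕₚ.+-identityʳ o) s∣
coprime-^-divisor {s} {g} co (suc i) {o} s∣ =
  coprime-^-divisor co i (coprime-divisor co (subst (s ∣_) (ℕₚ.*-assoc g (g ℕ.^ i) o) s∣))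

%≡⇒∣ : ∀ {s} .{{_ : NonZero s}} m o → m % s ≡ (o ℕ.+ m) % s → s ∣ o
%≡⇒∣ {s} m o eq = ∣m+n∣m⇒∣n (divides ((o ℕ.+ m) / s) (ℕₚ.+-cancelʳ-≡ (m % s) _ _ (begin
  (m / s) ℕ.* s ℕ.+ o ℕ.+ m % s
    ≡⟨ trans (cong (ℕ._+ m % s) (ℕₚ.+-comm ((m / s) ℕ.* s) o)) (ℕₚ.+-assoc o _ _) ⟩
  o ℕ.+ ((m / s) ℕ.* s ℕ.+ m % s)          ≡⟨ cong (o ℕ.+_) (trans (ℕₚ.+-comm _ (m % s)) (sym (m≡m%n+[m/n]*n m s))) ⟩
  o ℕ.+ m                                  ≡⟨ m≡m%n+[m/n]*n (o ℕ.+ m) s ⟩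
  (o ℕ.+ m) % s ℕ.+ ((o ℕ.+ m) / s) ℕ.* s  ≡⟨ cong (ℕ._+ ((o ℕ.+ m) / s) ℕ.* s) (sym eq) ⟩
  m % s ℕ.+ ((o ℕ.+ m) / s) ℕ.* s          ≡⟨ ℕₚ.+-comm (m % s) _ ⟩
  ((o ℕ.+ m) / s) ℕ.* s ℕ.+ m % s          ∎))) (n∣m*n (m / s))
  where open ≡-Reasoning

-- Two of the powers of `g` with exponents `0` to `s` agree modulo `s`; the smaller one cancels
-- because a prime `g > s` is coprime to `s`.
power≡1 : ∀ {s g} → 0 ℕ.< s → Prime g → s ℕ.< g → ∃[ h ] ∃[ w ] g ℕ.^ suc h ≡ suc (w ℕ.* s)
power≡1 {s} {g} s>0 g-prime s<g with Finₚ.pigeonhole (ℕₚ.n<1+n s) (λ (i : Fin (suc s)) → (g ℕ.^ toℕ i) mod s)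
  where instance _ = ℕ.>-nonZero s>0
... | i , j , i<j , eq = h , quotient , trans (sym (ℕₚ.m+[n∸m]≡n {1} g^>0)) (cong suc (_∣_.equality s∣o))
  where
  instance _ = ℕ.>-nonZero s>0
  instance _ = prime⇒nonZero g-prime
  open ≡-Reasoning
  m = toℕ i
  n = toℕ j
  h = n ℕ.∸ suc m
  o = g ℕ.^ suc h ℕ.∸ 1
  g^>0 : 0 ℕ.< g ℕ.^ suc h
  g^>0 = ℕₚ.m^n>0 g (suc h)
  n≡ : m ℕ.+ suc h ≡ n
  n≡ = trans (ℕₚ.+-suc m h) (ℕₚ.m+[n∸m]≡n i<j)
  split : g ℕ.^ n ≡ g ℕ.^ m ℕ.* o ℕ.+ g ℕ.^ m
  split = begin
    g ℕ.^ n                          ≡⟨ cong (g ℕ.^_) n≡ ⟨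
    g ℕ.^ (m ℕ.+ suc h)              ≡⟨ ℕₚ.^-distribˡ-+-* g m (suc h) ⟩
    g ℕ.^ m ℕ.* g ℕ.^ suc h          ≡⟨ cong (g ℕ.^ m ℕ.*_) (ℕₚ.m+[n∸m]≡n {1} g^>0) ⟨
    g ℕ.^ m ℕ.* suc o                ≡⟨ trans (ℕₚ.*-suc (g ℕ.^ m) o) (ℕₚ.+-comm (g ℕ.^ m) _) ⟩
    g ℕ.^ m ℕ.* o ℕ.+ g ℕ.^ m        ∎
  rem≡ : (g ℕ.^ m) % s ≡ (g ℕ.^ n) % s
  rem≡ = trans (sym (Finₚ.toℕ-fromℕ< (m%n<n (g ℕ.^ m) s))) (trans (cong toℕ eq) (Finₚ.toℕ-fromℕ< (m%n<n (g ℕ.^ n) s)))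
  s∣o : s ∣ o
  s∣o = coprime-^-divisor (coprime-sym (prime⇒coprime g-prime s<g)) m
          (%≡⇒∣ (g ℕ.^ m) (g ℕ.^ m ℕ.* o) (trans rem≡ (cong (_% s) split)))
  quotient = _∣_.quotient s∣o

-- Raising the exponents of the primes in gs makes their product ≡ 1 mod s.
powers≡1 : ∀ {s} → 0 ℕ.< s → ∀ gs → All (λ g → Prime g × s ℕ.< g) gs →
           ∃[ es ] ∃[ w ] (All (λ e → Prime e × e ∈ gs) es × product gs ℕ.* product es ≡ suc (w ℕ.* s))
powers≡1 s>0 [] [] = [] , 0 , [] , refl
powers≡1 {s} s>0 (g ∷ gs) ((g-prime , s<g) ∷ gs-ok) with power≡1 s>0 g-prime s<g | powers≡1 s>0 gs gs-ok
-- One factor `g` is already present in the product of the primes, so `h` further copies complete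
-- `g ^ suc h`.
... | h , w , eq | es , w′ , es∈ , eq′ = replicate h g ++ es , w ℕ.* w′ ℕ.* s ℕ.+ w ℕ.+ w′
    , Allₚ.++⁺ (Allₚ.replicate⁺ h (g-prime , here refl)) (All.map (λ (p , e∈) → p , there e∈) es∈)
    , (begin
  g ℕ.* product gs ℕ.* product (replicate h g ++ es)
    ≡⟨ cong (g ℕ.* product gs ℕ.*_)
        (trans (product-++ (replicate h g) es) (cong (ℕ._* product es) (product-replicate h))) ⟩
  g ℕ.* product gs ℕ.* (g ℕ.^ h ℕ.* product es)                   ≡⟨ rearrange g (product gs) (g ℕ.^ h) (product es) ⟩
  g ℕ.^ suc h ℕ.* (product gs ℕ.* product es)                     ≡⟨ cong₂ ℕ._*_ eq eq′ ⟩
  suc (w ℕ.* s) ℕ.* suc (w′ ℕ.* s)                                ≡⟨ multiply w w′ s ⟩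
  suc ((w ℕ.* w′ ℕ.* s ℕ.+ w ℕ.+ w′) ℕ.* s)                       ∎)
  where
  open ≡-Reasoning
  product-replicate : ∀ h → product (replicate h g) ≡ g ℕ.^ h
  product-replicate zero    = refl
  product-replicate (suc h) = cong (g ℕ.*_) (product-replicate h)
  rearrange : ∀ a b c d → a ℕ.* b ℕ.* (c ℕ.* d) ≡ a ℕ.* c ℕ.* (b ℕ.* d)
  rearrange = ℕ-Solver.solve-∀
  multiply : ∀ w v s → suc (w ℕ.* s) ℕ.* suc (v ℕ.* s) ≡ suc ((w ℕ.* v ℕ.* s ℕ.+ w ℕ.+ v) ℕ.* s)
  multiply = ℕ-Solver.solve-∀

-- Adjoining primes above `s` and the construction of `N`

record Extension (s N N′ : ℕ) : Set where
  constructor extension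
  field
    primes  : List ℕ
    large   : All (λ g → Prime g × s ℕ.< g) primes
    factors : N′ ≡ N ℕ.* product primes

extend-prime : ∀ {s p} N → Prime p → s ℕ.< p → Extension s N (N ℕ.* p)
extend-prime {p = p} N p-prime s<p = extension (p ∷ []) ((p-prime , s<p) ∷ []) (cong (N ℕ.*_) (sym (ℕₚ.*-identityʳ p)))

extend-trans : ∀ {s N N′ N″} → Extension s N N′ → Extension s N′ N″ → Extension s N N″
extend-trans {N = N} (extension gs ok refl) (extension hs ok′ refl) = extension (gs ++ hs) (Allₚ.++⁺ ok ok′)
  (trans (ℕₚ.*-assoc N (product gs) (product hs)) (cong (N ℕ.*_) (sym (product-++ gs hs))))

abstract
  -- One prime always has to be adjoined, to make the constant term 1; a second one flips the linear
  -- coefficient if it has the wrong sign.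
  normal-extension : ∀ s {R} → Low R → ∀ {ε} → Unit ε → ∃[ M ] (Extension s R M × Normal M ε)
  normal-extension s {R} lowR@(low R>0 u₀ u₁) {ε} uε with prime-above (s ℕ.⊔ R)
  ... | p , p-prime , p> = choose (ε₀ ℤₚ.≟ ε)
    where
    ε₀ : ℤ
    ε₀ = - (coeff (Φ R) 1 * coeff (Φ R) 0)
    uε₀ : Unit ε₀
    uε₀ = unit-neg (unit-* u₁ u₀)
    nRp : Normal (R ℕ.* p) ε₀
    nRp = low-step lowR p-prime (>⇒∤ R>0 (ℕₚ.≤-<-trans (ℕₚ.m≤n⊔m s R) p>))
    ext : Extension s R (R ℕ.* p)
    ext = extend-prime R p-prime (ℕₚ.≤-<-trans (ℕₚ.m≤m⊔n s R) p>)
    opposite : ∀ {x y} → Unit x → Unit y → x ≢ y → - x ≡ y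
    opposite (inj₁ refl) (inj₁ refl) x≢y = ⊥-elim (x≢y refl)
    opposite (inj₁ refl) (inj₂ refl) x≢y = refl
    opposite (inj₂ refl) (inj₁ refl) x≢y = refl
    opposite (inj₂ refl) (inj₂ refl) x≢y = ⊥-elim (x≢y refl)
    choose : Dec (ε₀ ≡ ε) → ∃[ M ] (Extension s R M × Normal M ε)
    choose (yes refl) = R ℕ.* p , ext , nRp
    choose (no ε₀≢ε) with prime-above (s ℕ.⊔ (R ℕ.* p))
    ... | p′ , p′-prime , p′> = R ℕ.* p ℕ.* p′
      , extend-trans ext (extend-prime (R ℕ.* p) p′-prime (ℕₚ.≤-<-trans (ℕₚ.m≤m⊔n s _) p′>))
      , subst (Normal (R ℕ.* p ℕ.* p′)) (opposite uε₀ uε ε₀≢ε)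
          (normal-step uε₀ nRp p′-prime (>⇒∤ (positive nRp) (ℕₚ.≤-<-trans (ℕₚ.m≤n⊔m s _) p′>)))

congruent-difference : ∀ {L} .{{_ : NonZero L}} p p₀ i → p % L ≡ p₀ % L → p ℕ.≤ p₀ ℕ.+ i ℕ.* L →
  ∃[ l ] p₀ ℕ.+ i ℕ.* L ≡ p ℕ.+ l ℕ.* L
congruent-difference {L} p p₀ i eq p≤ = (p₀ / L ℕ.+ i) ℕ.∸ p / L , (begin
  p₀ ℕ.+ i ℕ.* L                                           ≡⟨ top≡ ⟩
  p % L ℕ.+ Q ℕ.* L                                        ≡⟨ cong (λ z → p % L ℕ.+ z ℕ.* L) (ℕₚ.m+[n∸m]≡n q≤) ⟨
  p % L ℕ.+ (p / L ℕ.+ (Q ℕ.∸ p / L)) ℕ.* L                ≡⟨ distribute (p % L) (p / L) (Q ℕ.∸ p / L) L ⟩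
  (p % L ℕ.+ (p / L) ℕ.* L) ℕ.+ (Q ℕ.∸ p / L) ℕ.* L        ≡⟨ cong (ℕ._+ (Q ℕ.∸ p / L) ℕ.* L) (m≡m%n+[m/n]*n p L) ⟨
  p ℕ.+ (Q ℕ.∸ p / L) ℕ.* L                                ∎)
  where
  open ≡-Reasoning
  Q = p₀ / L ℕ.+ i
  distribute : ∀ r a b l → r ℕ.+ (a ℕ.+ b) ℕ.* l ≡ (r ℕ.+ a ℕ.* l) ℕ.+ b ℕ.* l
  distribute = ℕ-Solver.solve-∀
  top≡ : p₀ ℕ.+ i ℕ.* L ≡ p % L ℕ.+ Q ℕ.* L
  top≡ = trans (cong (ℕ._+ i ℕ.* L) (trans (m≡m%n+[m/n]*n p₀ L) (cong (ℕ._+ (p₀ / L) ℕ.* L) (sym eq))))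
      (sym (distribute (p % L) (p₀ / L) i L))
  q≤ : p / L ℕ.≤ Q
  q≤ = ℕₚ.*-cancelʳ-≤ (p / L) Q L (ℕₚ.+-cancelˡ-≤ (p % L) _ _ (subst₂ ℕ._≤_ (m≡m%n+[m/n]*n p L) top≡ p≤))

step-into : ∀ {L} .{{_ : NonZero L}} a T → a ℕ.≤ T → ∃[ i ] (T ℕ.< a ℕ.+ i ℕ.* L × a ℕ.+ i ℕ.* L ℕ.≤ T ℕ.+ L)
step-into {L} a T a≤T = suc (w / L)
  , subst (ℕ._< a ℕ.+ suc (w / L) ℕ.* L) a+w
      (ℕₚ.+-monoʳ-< a (subst (ℕ._< suc (w / L) ℕ.* L) (sym (m≡m%n+[m/n]*n w L))
          (ℕₚ.+-monoˡ-< ((w / L) ℕ.* L) (m%n<n w L))))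
  , (begin
  a ℕ.+ (L ℕ.+ (w / L) ℕ.* L)
    ≤⟨ ℕₚ.+-monoʳ-≤ a (ℕₚ.+-monoʳ-≤ L (subst ((w / L) ℕ.* L ℕ.≤_) (sym (m≡m%n+[m/n]*n w L)) (ℕₚ.m≤n+m _ (w % L)))) ⟩
  a ℕ.+ (L ℕ.+ w)                        ≡⟨ rearrange a L w ⟩
  a ℕ.+ w ℕ.+ L                          ≡⟨ cong (ℕ._+ L) a+w ⟩
  T ℕ.+ L                                ∎)
  where
  open ℕₚ.≤-Reasoning
  w = T ℕ.∸ a
  a+w : a ℕ.+ w ≡ T
  a+w = ℕₚ.m+[n∸m]≡n a≤T
  rearrange : ∀ a b c → a ℕ.+ (b ℕ.+ c) ≡ a ℕ.+ c ℕ.+ b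
  rearrange = ℕ-Solver.solve-∀

module _ (b : Bool) {s R ε} (uε : Unit ε) {M} (extM : Extension s R M) (nM : Normal M ε) where

  private
    D : ℕ
    D = deg (Φ-cyclotomic (positive nM))

    mΦ : Monic D (Φ M)
    mΦ = isMonic (Φ-cyclotomic (positive nM))

  attains-construction : ∀ {q} → Prime q → s ℕ.⊔ (M ℕ.⊔ (D ℕ.+ D)) ℕ.< q → .{{_ : NonZero (M ℕ.* q)}} →
    ∀ r → ∃[ X ] ∃[ c ] ∃[ ps ] (s ℕ.⊔ (M ℕ.* q) ℕ.≤ X × length ps ≡ suc r × Unique ps ×
      All (λ p → (X ℕ.+ M ℕ.* q ℕ.≤ p × p ℕ.< 2 ℕ.* X) × Prime p × p % (M ℕ.* q) ≡ c) ps) →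
    ∃[ N ] (Extension s R N × Attains b (Φ N) (- ε * + r))
  -- One prime more than `r` is requested: `p₀` fixes the exponent `k` but is not a factor of `N`,
  -- so that `r = 0` needs no separate treatment.
  attains-construction {q} q-prime q> r
    (X , c , p₀ ∷ ps , B≤X , len , (p₀∉ ∷ ps-unique) , ((p₀≥ , p₀<) , p₀-prime , p₀c) ∷ ps-ok) =
    N , ext , subst₂ (λ b l → Attains b (Φ N) (- ε * + l)) parity len′ attained
    where
    L = M ℕ.* q
    L>0 : 0 ℕ.< L
    L>0 = ℕₚ.*-mono-≤ (positive nM) (prime>0 q-prime)
    instance _ = prime⇒nonZero q-prime
    len′ : length ps ≡ r
    len′ = ℕₚ.suc-injective len
    M<q : M ℕ.< q
    M<q = ℕₚ.≤-<-trans (ℕₚ.≤-trans (ℕₚ.m≤m⊔n M _) (ℕₚ.m≤n⊔m s _)) q>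
    2D<q : D ℕ.+ D ℕ.< q
    2D<q = ℕₚ.≤-<-trans (ℕₚ.≤-trans (ℕₚ.m≤n⊔m M _) (ℕₚ.m≤n⊔m s _)) q>
    D<q : D ℕ.< q
    D<q = ℕₚ.≤-<-trans (ℕₚ.m≤m+n D D) 2D<q
    q≤L : q ℕ.≤ L
    q≤L = ℕₚ.m≤n*m q M {{ℕ.>-nonZero (positive nM)}}
    L≤X : L ℕ.≤ X
    L≤X = ℕₚ.≤-trans (ℕₚ.m≤n⊔m s L) B≤X
    s≤X : s ℕ.≤ X
    s≤X = ℕₚ.≤-trans (ℕₚ.m≤m⊔n s L) B≤X
    X<p : ∀ {p} → X ℕ.+ L ℕ.≤ p → X ℕ.< p
    X<p X+L≤p = ℕₚ.<-≤-trans (ℕₚ.m<m+n X L>0) X+L≤p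
    β = p₀ % q
    -- For `β = 0` neither offset would reach the gap, as `β + D` would be just `D`. It is excluded
    -- since `p₀` is a prime larger than `q`.
    β>0 : 0 ℕ.< β
    β>0 = ℕₚ.n≢0⇒n>0 λ β≡0 → >⇒∤ {p₀} {q} (prime>0 q-prime) (ℕₚ.≤-<-trans q≤L (ℕₚ.≤-<-trans L≤X (X<p p₀≥)))
            (subst (p₀ ∣_) (q≡p₀ (prime⇒irreducible p₀-prime
                (divides (p₀ / q) (trans (m≡m%n+[m/n]*n p₀ q) (cong (ℕ._+ (p₀ / q) ℕ.* q) β≡0))))) ∣-refl)
      where
      q≡p₀ : q ≡ 1 ⊎ q ≡ p₀ → p₀ ≡ q
      q≡p₀ (inj₁ q≡1) = ⊥-elim (ℕₚ.<⇒≢ (prime>1 q-prime) (sym q≡1))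
      q≡p₀ (inj₂ q≡p₀) = sym q≡p₀
    -- The offset j must move the residue of k mod q into the gap (deg Φ M, q).
    offset : ∃[ j ] (j ℕ.< q × coeff (Φ M) j ≡ + 1 × D ℕ.< β ℕ.+ j × β ℕ.+ j ℕ.< q)
    offset with D ℕ.<? β
    ... | yes D<β = 0 , prime>0 q-prime , Normal.const nM , subst (D ℕ.<_) (sym (ℕₚ.+-identityʳ β)) D<β
                  , subst (ℕ._< q) (sym (ℕₚ.+-identityʳ β)) (m%n<n p₀ q)
    ... | no D≮β  = D , D<q , top mΦ , ℕₚ.+-monoˡ-≤ D β>0 , ℕₚ.≤-<-trans (ℕₚ.+-monoˡ-≤ D (ℕₚ.≮⇒≥ D≮β)) 2D<q
    j = proj₁ offset
    j<q : j ℕ.< q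
    j<q = proj₁ (proj₂ offset)
    -- Stopping just after `2 * X` places `k` above all the primes `p` of the interval, yet below
    -- `2 * (X + L)` and thus below `p + p`.
    stepped = step-into {L} p₀ (2 ℕ.* X) (ℕₚ.<⇒≤ p₀<)
    i₀ = proj₁ stepped
    k = p₀ ℕ.+ i₀ ℕ.* L ℕ.+ j
    2X<k : 2 ℕ.* X ℕ.< k
    2X<k = ℕₚ.<-≤-trans (proj₁ (proj₂ stepped)) (ℕₚ.m≤m+n _ j)
    X≤k : X ℕ.≤ k
    X≤k = ℕₚ.≤-trans (ℕₚ.m≤m+n X _) (ℕₚ.<⇒≤ 2X<k)
    k<2p : ∀ {p} → X ℕ.+ L ℕ.≤ p → k ℕ.< p ℕ.+ p
    k<2p {p} X+L≤p = begin-strict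
      p₀ ℕ.+ i₀ ℕ.* L ℕ.+ j     ≤⟨ ℕₚ.+-monoˡ-≤ j (proj₂ (proj₂ stepped)) ⟩
      2 ℕ.* X ℕ.+ L ℕ.+ j       <⟨ ℕₚ.+-monoʳ-< (2 ℕ.* X ℕ.+ L) (ℕₚ.<-≤-trans j<q q≤L) ⟩
      2 ℕ.* X ℕ.+ L ℕ.+ L       ≡⟨ double X L ⟩
      (X ℕ.+ L) ℕ.+ (X ℕ.+ L)   ≤⟨ ℕₚ.+-mono-≤ X+L≤p X+L≤p ⟩
      p ℕ.+ p                   ∎
      where
      open ℕₚ.≤-Reasoning
      double : ∀ x l → 2 ℕ.* x ℕ.+ l ℕ.+ l ≡ (x ℕ.+ l) ℕ.+ (x ℕ.+ l)
      double = ℕ-Solver.solve-∀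
    k≡ : k ≡ (p₀ / q ℕ.+ i₀ ℕ.* M) ℕ.* q ℕ.+ (β ℕ.+ j)
    k≡ = trans (cong (λ z → z ℕ.+ i₀ ℕ.* L ℕ.+ j) (m≡m%n+[m/n]*n p₀ q)) (rearrange β (p₀ / q) q i₀ M j)
      where
      rearrange : ∀ b a q i m j → (b ℕ.+ a ℕ.* q) ℕ.+ i ℕ.* (m ℕ.* q) ℕ.+ j ≡ (a ℕ.+ i ℕ.* m) ℕ.* q ℕ.+ (b ℕ.+ j)
      rearrange = ℕ-Solver.solve-∀
    hits : All (λ p → ∃[ i ] k ≡ p ℕ.+ (i ℕ.* L ℕ.+ j)) ps
    hits = All.map (λ {p} ((_ , p<) , _ , pc) →
      let (l , eq) = congruent-difference {L} p p₀ i₀ (trans pc (sym p₀c)) (ℕₚ.<⇒≤ (ℕₚ.<-trans p< (proj₁ (proj₂ stepped))))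
      in l , trans (cong (ℕ._+ j) eq) (ℕₚ.+-assoc p (l ℕ.* L) j)) ps-ok
    big₁ = prime-above k
    q₁ = proj₁ big₁
    big₂ = prime-above q₁
    q₂ = proj₁ big₂
    Big : ℕ → Set
    Big g = Prime g × k ℕ.< g
    -- One or two primes beyond `k`, whichever number gives the parity `b`.
    fresh : ∃[ qs ] (All Big qs × Unique qs × odd? (qs ++ ps) ≡ b)
    fresh with odd? (q₁ ∷ ps) Boolₚ.≟ b
    ... | yes eq = q₁ ∷ [] , proj₂ big₁ ∷ [] , [] ∷ [] , eq
    ... | no neq = q₂ ∷ q₁ ∷ [] , (proj₁ (proj₂ big₂) , ℕₚ.<-trans (proj₂ (proj₂ big₁))
        (proj₂ (proj₂ big₂))) ∷ proj₂ big₁ ∷ []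
                 , ((λ q₂≡q₁ → ℕₚ.<⇒≢ (proj₂ (proj₂ big₂)) (sym q₂≡q₁)) ∷ []) ∷ [] ∷ []
                 , trans (cong not (Boolₚ.¬-not neq)) (Boolₚ.not-involutive b)
    qs = proj₁ fresh
    qs-big : All Big qs
    qs-big = proj₁ (proj₂ fresh)
    parity : odd? (qs ++ ps) ≡ b
    parity = proj₂ (proj₂ (proj₂ fresh))
    rs = qs ++ ps
    N = L ℕ.* product rs
    uniq : Unique rs
    uniq = Uniqueₚ.++⁺ (proj₁ (proj₂ (proj₂ fresh))) ps-unique λ (x∈qs , x∈ps) →
      ℕₚ.<-irrefl refl (ℕₚ.<-trans (ℕₚ.<-trans (proj₂ (All.lookup qs-big x∈qs))
          (proj₂ (proj₁ (All.lookup ps-ok x∈ps)))) 2X<k)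
    primes : All Prime rs
    primes = Allₚ.++⁺ (All.map proj₁ qs-big) (All.map (proj₁ ∘ proj₂) ps-ok)
    sizes : All (λ p → ¬ p ∣ L × k ℕ.< p ℕ.+ p) rs
    sizes = Allₚ.++⁺ (All.map (λ {g} (_ , k<g) → >⇒∤ L>0
        (ℕₚ.≤-<-trans (ℕₚ.≤-trans L≤X X≤k) k<g) , ℕₚ.<-≤-trans k<g (ℕₚ.m≤m+n g g)) qs-big)
                     (All.map (λ ((X+L≤p , _) , _) → >⇒∤ L>0 (ℕₚ.≤-<-trans L≤X (X<p X+L≤p)) , k<2p X+L≤p) ps-ok)
    attained : Attains (odd? rs) (Φ N) (- ε * + length ps)
    attained = attains-window uε nM mΦ q-prime (>⇒∤ (positive nM) M<q) D<q k (p₀ / q ℕ.+ i₀ ℕ.* M) (β ℕ.+ j) k≡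
      (proj₁ (proj₂ (proj₂ (proj₂ offset)))) (proj₂ (proj₂ (proj₂ (proj₂ offset)))) j j<q (proj₁ (proj₂ (proj₂ offset)))
      qs (All.map proj₂ qs-big) ps hits uniq primes sizes
    ext : Extension s R N
    ext = extend-trans extM (extend-trans (extend-prime M q-prime (ℕₚ.≤-<-trans (ℕₚ.m≤m⊔n s _) q>)) (extension rs
      (All.zip (primes , Allₚ.++⁺ (All.map (λ (_ , k<g) → ℕₚ.≤-<-trans (ℕₚ.≤-trans s≤X X≤k) k<g) qs-big)
                                   (All.map (λ ((X+L≤p , _) , _) → ℕₚ.≤-<-trans s≤X (X<p X+L≤p)) ps-ok))) refl))

attains-extension : ∀ b s {R} → Low R → ∀ {ε} → Unit ε → ∀ r → ∃[ N ] (Extension s R N × Attains b (Φ N) (- ε * + r))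
attains-extension b s lowR uε r =
  let (M , extM , nM)       = normal-extension s lowR uε
      D                     = deg (Φ-cyclotomic (positive nM))
      (q , q-prime , q>)    = prime-above (s ℕ.⊔ (M ℕ.⊔ (D ℕ.+ D)))
      instance L≢0          = ℕ.>-nonZero (ℕₚ.*-mono-≤ (positive nM) (prime>0 q-prime))
  in attains-construction b uε extM nM q-prime q> r (congruent-primes (M ℕ.* q) (suc r) (s ℕ.⊔ (M ℕ.* q)))

-- Only the radical of N matters for the set of coefficients, so the exponents are free to fix N mod s.
attains-multiple : ∀ b {s t} → 0 ℕ.< s → 0 ℕ.< t → ∀ z → ∃[ w ] ∃[ k ] coefficient b (t ℕ.* suc (w ℕ.* s)) k ≡ z
attains-multiple b {s} {t} s>0 t>0 z with factorise t {{ℕ.>-nonZero t>0}}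
... | record { factors = ts ; isFactorisation = refl ; factorsPrime = ts-prime } with radical ts ts-prime | sign z
  where
  sign : ∀ z → ∃[ ε ] (Unit ε × - ε * + ℤ.∣ z ∣ ≡ z)
  sign (+ n)        = - (+ 1) , inj₂ refl , ℤₚ.*-identityˡ (+ n)
  sign (ℤ.-[1+ n ]) = + 1 , inj₁ refl , ℤₚ.-1*i≡-i (+ suc n)
... | R , E₀ , t≡ , E₀∣R , lowR | ε , uε , z≡ with attains-extension b s lowR uε ℤ.∣ z ∣
... | N , extension gs gs-ok N≡ , att with powers≡1 s>0 gs gs-ok
... | es , w , es∈ , eq = w , subst (λ n → ∃[ k ] coefficient b n k ≡ z) NE≡
        (attains⇒coefficient {b} (subst (Attains b (Φ (N ℕ.* product E))) z≡
          (attains-expand (product E) E>0 (Φ-*-product N>0 E E∣N) att)))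
  where
  open ≡-Reasoning
  -- `E₀` restores `t` from its radical, and `es` makes the cofactor of `t` congruent to 1 modulo
  -- `s`.
  E = E₀ ++ es
  R∣N : R ∣ N
  R∣N = subst (R ∣_) (sym N≡) (m∣m*n (product gs))
  E∣N : All (λ e → Prime e × e ∣ N) E
  E∣N = Allₚ.++⁺ (All.map (λ (e-prime , e∣R) → e-prime , ∣-trans e∣R R∣N) E₀∣R)
                 (All.map (λ (e-prime , e∈) → e-prime , subst (_ ∣_) (sym N≡) (∣n⇒∣m*n R (∈⇒∣product e∈))) es∈)
  NE≡ : N ℕ.* product E ≡ product ts ℕ.* suc (w ℕ.* s)
  NE≡ = begin
    N ℕ.* product E                                          ≡⟨ cong₂ ℕ._*_ N≡ (product-++ E₀ es) ⟩
    R ℕ.* product gs ℕ.* (product E₀ ℕ.* product es)         ≡⟨ rearrange R (product gs) (product E₀) (product es) ⟩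
    R ℕ.* product E₀ ℕ.* (product gs ℕ.* product es)         ≡⟨ cong₂ ℕ._*_ (sym t≡) eq ⟩
    product ts ℕ.* suc (w ℕ.* s)                             ∎
    where
    rearrange : ∀ a b c d → a ℕ.* b ℕ.* (c ℕ.* d) ≡ a ℕ.* c ℕ.* (b ℕ.* d)
    rearrange = ℕ-Solver.solve-∀
  NE>0 : 0 ℕ.< N ℕ.* product E
  NE>0 = subst (0 ℕ.<_) (sym NE≡) (ℕₚ.*-mono-≤ t>0 (s≤s z≤n))
  N>0 : 0 ℕ.< N
  N>0 = ∣-pos NE>0 (m∣m*n (product E))
  E>0 : 0 ℕ.< product E
  E>0 = ∣-pos NE>0 (n∣m*n N)

attains-residue : ∀ b s t → t ℕ.< s → ∀ z → ∃[ n ] ∃[ k ] (1 ℕ.≤ n ℕ.* s ℕ.+ t × coefficient b (n ℕ.* s ℕ.+ t) k ≡ z)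
-- `attains-multiple` wants a positive number, so `s` represents the residue 0.
attains-residue b s zero    t<s z with attains-multiple b t<s t<s z
... | w , k , eq = suc (w ℕ.* s) , k
    , subst (1 ℕ.≤_) N≡ (ℕₚ.*-mono-≤ t<s (s≤s z≤n))
    , subst (λ n → coefficient b n k ≡ z) N≡ eq
  where
  N≡ : s ℕ.* suc (w ℕ.* s) ≡ suc (w ℕ.* s) ℕ.* s ℕ.+ 0
  N≡ = trans (ℕₚ.*-comm s _) (sym (ℕₚ.+-identityʳ _))
attains-residue b s (suc t) t<s z with attains-multiple b {t = suc t} (ℕₚ.≤-<-trans z≤n t<s) (s≤s z≤n) z
... | w , k , eq = suc t ℕ.* w , k , ℕₚ.≤-trans (s≤s z≤n) (ℕₚ.m≤n+m (suc t) _) , subst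
    (λ n → coefficient b n k ≡ z) N≡ eq
  where
  N≡ : suc t ℕ.* suc (w ℕ.* s) ≡ suc t ℕ.* w ℕ.* s ℕ.+ suc t
  N≡ = trans (ℕₚ.*-suc (suc t) (w ℕ.* s))
      (trans (ℕₚ.+-comm (suc t) _) (cong (ℕ._+ suc t) (sym (ℕₚ.*-assoc (suc t) w s))))

open Defs using (a; c)

theorem1p2 : (s t : ℕ) → t ℕ.< s →
    ((z : ℤ) → ∃[ n ] ∃[ k ] (1 ℕ.≤ n ℕ.* s ℕ.+ t × a (n ℕ.* s ℕ.+ t) k ≡ z))
    × ((z : ℤ) → ∃[ n ] ∃[ k ] (1 ℕ.≤ n ℕ.* s ℕ.+ t × c (n ℕ.* s ℕ.+ t) k ≡ z))
theorem1p2 s t t<s = attains-residue true s t t<s , attains-residue false s t t<s
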